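{- Let $\lambda$ be a partition with at most $n$ parts and $\mu\in S_n(\lambda)$ with $|\mu|=d$. Then $f^*_\mu$ is the unique polynomial $g$ in $x_1,\dots,x_n$ of degree at most $d$ such that (i) $g(\widetilde\nu)=0$ for every $\nu\in\mathbb{N}^n$ with $|\nu|\le|\mu|$ and $\nu\notin S_n(\lambda)$, and (ii) for every $\tau\in S_n(\lambda)$, the coefficient of $x^\tau$ in $g$ equals $\delta_{\tau,\mu}$.
   Context: Polynomials are in $x_1,\dots,x_n$ over $\mathbb{Q}(q,t)$. For $\mu\in\mathbb{N}^n$ let $k_i(\mu)=\#\{j<i:\mu_j>\mu_i\}+\#\{j>i:\mu_j\ge\mu_i\}$ and $\widetilde\mu=(q^{\mu_1}t^{ -k_1(\mu)},\dots,q^{\mu_n}t^{ -k_n(\mu)})$. For $\mu\in\mathbb{N}^n$, $|\mu|=d$, $E^*_\mu$ is the unique polynomial of degree at most $d$ with coefficient of $x^\mu$ equal to $1$ and $E^*_\mu(\widetilde\nu)=0$ for all $\nu\in\mathbb{N}^n$, $|\nu|\le d$, $\nu\ne\mu$. $S_n$ acts on compositions by $\sigma\cdot\mu=(\mu_{\sigma^{ -1}(1)},\dots,\mu_{\sigma^{ -1}(n)})$ and on polynomials by permuting variables; $s_i=(i,i+1)$; $T_i=t-\frac{tx_i-x_{i+1}}{x_i-x_{i+1}}(1-s_i)$; $T_\sigma=T_{i_1}\cdots T_{i_\ell}$ for a reduced word. $S_n(\lambda)$ is the set of rearrangements of $\lambda$; for $\mu\in S_n(\lambda)$, $\sigma_\mu$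 is the shortest permutation with $\sigma_\mu(\lambda)=\mu$, and $f^*_\mu=T_{\sigma_\mu}E^*_\lambda$. -}

module Defs where

open import Algebra.Bundles using (CommutativeRing)
open import Algebra.Structures using (IsCommutativeRing)
import Algebra.Properties.CommutativeSemigroup as CommutativeSemigroupProperties
import Algebra.Properties.Ring as RingProperties
import Algebra.Solver.Ring.NaturalCoefficients.Default as SemiringSolver
open import Data.Bool.Base using (if_then_else_)
open import Data.Fin.Base as Fin using (Fin; inject₁)
import Data.Fin.Properties as Fin
open import Data.Fin.Permutation as Perm using (Permutation′; _⟨$⟩ˡ_; _∘ₚ_; transpose)
open import Data.List.Base as List using (List; []; _∷_; _++_; length; filter; allFin; applyUpTo; concatMap)
open import Data.List.Properties using (concatMap-++; length-filter)
open import Data.List.Relation.Unary.All as All using (All; []; _∷_)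
open import Data.Nat.Base as ℕ using (ℕ; zero; suc; _∸_; z≤n; s≤s)
import Data.Nat.Properties as ℕ
open import Data.Product.Base using (∃-syntax; _×_; _,_; proj₁; proj₂; map₂)
open import Data.Rational.Base as ℚ using (ℚ)
import Data.Rational.Properties as ℚ
open import Data.Sum.Base using (_⊎_; inj₁; inj₂)
open import Data.Vec.Base as Vec using (Vec; []; _∷_; lookup; tabulate; zipWith; replicate; _[_]≔_)
import Data.Vec.Properties as Vec
open import Function.Base using (_∘_; id)
open import Level using (0ℓ)
open import Relation.Binary.Definitions using (Decidable; tri<; tri≈; tri>)
open import Relation.Binary.Structures using (IsEquivalence)
open import Relation.Binary.PropositionalEquality as ≡ using (_≡_; _≢_)
import Relation.Binary.Reasoning.Setoid as SetoidReasoning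
open import Relation.Nullary.Decidable using (Dec; yes; no; does; ¬?; _×-dec_; map′)
open import Relation.Nullary.Negation using (¬_; contradiction)

private
  variable
    n : ℕ

infixl 6 _⊕_
_⊕_ : Vec ℕ n → Vec ℕ n → Vec ℕ n
_⊕_ = zipWith ℕ._+_

_≟ᵉ_ : Decidable {A = Vec ℕ n} _≡_
_≟ᵉ_ = Vec.≡-dec ℕ._≟_

-- Proofs are kept abstract: they end up inside the elements of the field ℚ⟨q,t⟩,
-- where unfolding them is very expensive.
module Polynomial (R : CommutativeRing 0ℓ 0ℓ) where
  open CommutativeRing R
  open RingProperties ring using (-‿+-comm; -0#≈0#; -‿distribˡ-*)
  open import Algebra.Properties.Semiring.Exp semiring using (_^_)
  open CommutativeSemigroupProperties +-commutativeSemigroup using (x∙yz≈y∙xz)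
  private module S = SemiringSolver commutativeSemiring

  -- The list [ (c₁ , α₁) , … ] stands for c₁ x^α₁ + … ; exponents may repeat
  -- and coefficients may vanish, so polynomials are compared with _≈ₚ_.
  Poly : ℕ → Set
  Poly n = List (Carrier × Vec ℕ n)

  -- The linear map from polynomials to R sending x^α to φ α.
  linear : (Vec ℕ n → Carrier) → Poly n → Carrier
  linear φ []            = 0#
  linear φ ((c , α) ∷ p) = c * φ α + linear φ p

  δ : Vec ℕ n → Vec ℕ n → Carrier
  δ α β = if does (α ≟ᵉ β) then 1# else 0#

  coeff : Poly n → Vec ℕ n → Carrier
  coeff p α = linear (δ α) p

  infix 4 _≈ₚ_
  record _≈ₚ_ {n} (p r : Poly n) : Set where
    constructor coeffs-≈
    field
      coeff-≈ : ∀ α → coeff p α ≈ coeff r α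
  open _≈ₚ_ public

  monomialValue : Vec Carrier n → Vec ℕ n → Carrier
  monomialValue []      []      = 1#
  monomialValue (x ∷ v) (a ∷ α) = x ^ a * monomialValue v α

  eval : Poly n → Vec Carrier n → Carrier
  eval p v = linear (monomialValue v) p

  infixl 6 _+ₚ_ _-ₚ_
  infixl 7 _*ₚ_
  infix  8 -ₚ_

  _+ₚ_ : Poly n → Poly n → Poly n
  _+ₚ_ = _++_

  -ₚ_ : Poly n → Poly n
  -ₚ_ = List.map (λ (c , α) → (- c , α))

  _-ₚ_ : Poly n → Poly n → Poly n
  p -ₚ r = p +ₚ -ₚ r

  _*ₚ_ : Poly n → Poly n → Poly n
  p *ₚ r = concatMap (λ (c , α) → List.map (λ (d , β) → (c * d , α ⊕ β)) r) p

  const : Carrier → Poly n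
  const c = (c , replicate _ 0) ∷ []

  var : Fin n → Poly n
  var i = (1# , replicate _ 0 [ i ]≔ 1) ∷ []

  private
    shift : Carrier × Vec ℕ n → Poly n → Poly n
    shift (c , α) = List.map (λ (d , β) → (c * d , α ⊕ β))

    remove : Vec ℕ n → Poly n → Poly n
    remove α = filter (λ m → ¬? (α ≟ᵉ proj₂ m))

  open SetoidReasoning setoid

  abstract
    δ-refl : (α : Vec ℕ n) → δ α α ≈ 1#
    δ-refl α with α ≟ᵉ α
    ... | yes _  = refl
    ... | no α≢α = contradiction ≡.refl α≢α

    δ-≢ : {α β : Vec ℕ n} → α ≢ β → δ α β ≈ 0#
    δ-≢ {α = α} {β} α≢β with α ≟ᵉ β
    ... | yes α≡β = contradiction α≡β α≢β
    ... | no _    = refl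

    linear-congˡ : {φ ψ : Vec ℕ n → Carrier} → (∀ α → φ α ≈ ψ α) → ∀ p → linear φ p ≈ linear ψ p
    linear-congˡ φ≈ψ []            = refl
    linear-congˡ φ≈ψ ((c , α) ∷ p) = +-cong (*-congˡ (φ≈ψ α)) (linear-congˡ φ≈ψ p)

    linear-0 : (φ : Vec ℕ n → Carrier) → ∀ p → All (λ m → φ (proj₂ m) ≈ 0#) p → linear φ p ≈ 0#
    linear-0 φ []            []         = refl
    linear-0 φ ((c , α) ∷ p) (eq ∷ eqs) = begin
      c * φ α + linear φ p ≈⟨ +-cong (*-congˡ eq) (linear-0 φ p eqs) ⟩
      c * 0# + 0#          ≈⟨ +-identityʳ _ ⟩
      c * 0#               ≈⟨ zeroʳ c ⟩
      0#                   ∎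

    linear-+ : (φ : Vec ℕ n → Carrier) → ∀ p r → linear φ (p +ₚ r) ≈ linear φ p + linear φ r
    linear-+ φ []            r = sym (+-identityˡ _)
    linear-+ φ ((c , α) ∷ p) r = trans (+-congˡ (linear-+ φ p r)) (sym (+-assoc _ _ _))

    linear-neg : (φ : Vec ℕ n → Carrier) → ∀ p → linear φ (-ₚ p) ≈ - linear φ p
    linear-neg φ []            = sym -0#≈0#
    linear-neg φ ((c , α) ∷ p) = begin
      - c * φ α + linear φ (-ₚ p)   ≈⟨ +-cong (sym (-‿distribˡ-* c (φ α))) (linear-neg φ p) ⟩
      - (c * φ α) + - linear φ p    ≈⟨ -‿+-comm _ _ ⟩
      - (c * φ α + linear φ p)      ∎

    linear-- : (φ : Vec ℕ n → Carrier) → ∀ p r → linear φ (p -ₚ r) ≈ linear φ p - linear φ r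
    linear-- φ p r = trans (linear-+ φ p (-ₚ r)) (+-congˡ (linear-neg φ r))

    linear-+ˡ : (φ ψ : Vec ℕ n → Carrier) → ∀ p → linear (λ α → φ α + ψ α) p ≈ linear φ p + linear ψ p
    linear-+ˡ φ ψ []            = sym (+-identityˡ _)
    linear-+ˡ φ ψ ((c , α) ∷ p) = trans (+-congˡ (linear-+ˡ φ ψ p))
      (S.solve 5 (λ c x y u v → (c S.:* (x S.:+ y) S.:+ (u S.:+ v)) S.:= ((c S.:* x S.:+ u) S.:+ (c S.:* y S.:+ v)))
        refl c (φ α) (ψ α) (linear φ p) (linear ψ p))

    linear-*ˡ : ∀ c (φ : Vec ℕ n → Carrier) → ∀ p → linear (λ α → c * φ α) p ≈ c * linear φ p
    linear-*ˡ c φ []            = sym (zeroʳ c)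
    linear-*ˡ c φ ((d , α) ∷ p) = trans (+-congˡ (linear-*ˡ c φ p))
      (S.solve 4 (λ c d x u → (d S.:* (c S.:* x) S.:+ c S.:* u) S.:= (c S.:* (d S.:* x S.:+ u)))
        refl c d (φ α) (linear φ p))

    linear-swap : ∀ {m} (ψ : Vec ℕ n → Vec ℕ m → Carrier) → ∀ p r →
      linear (λ α → linear (ψ α) r) p ≈ linear (λ β → linear (λ α → ψ α β) p) r
    linear-swap ψ []            r = sym (linear-0 _ r (All.universal (λ _ → refl) r))
    linear-swap ψ ((c , α) ∷ p) r = begin
      c * linear (ψ α) r + linear (λ α → linear (ψ α) r) p
        ≈⟨ +-cong (sym (linear-*ˡ c (ψ α) r)) (linear-swap ψ p r) ⟩
      linear (λ β → c * ψ α β) r + linear (λ β → linear (λ α → ψ α β) p) r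
        ≈⟨ linear-+ˡ _ _ r ⟨
      linear (λ β → c * ψ α β + linear (λ α → ψ α β) p) r ∎

    private
      linear-shift : (φ : Vec ℕ n → Carrier) → ∀ c α r →
        linear φ (shift (c , α) r) ≈ c * linear (λ β → φ (α ⊕ β)) r
      linear-shift φ c α []            = sym (zeroʳ c)
      linear-shift φ c α ((d , β) ∷ r) = trans (+-cong (*-assoc c d _) (linear-shift φ c α r)) (sym (distribˡ c _ _))

    linear-* : (φ : Vec ℕ n → Carrier) → ∀ p r →
      linear φ (p *ₚ r) ≈ linear (λ α → linear (λ β → φ (α ⊕ β)) r) p
    linear-* φ []            r = refl
    linear-* φ ((c , α) ∷ p) r =
      trans (linear-+ φ (shift (c , α) r) (p *ₚ r)) (+-cong (linear-shift φ c α r) (linear-* φ p r))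

    linear-remove : (φ : Vec ℕ n → Carrier) → ∀ α p →
      linear φ p ≈ coeff p α * φ α + linear φ (remove α p)
    linear-remove φ α []            = sym (trans (+-identityʳ _) (zeroˡ _))
    linear-remove φ α ((c , β) ∷ p) with α ≟ᵉ β | linear-remove φ α p
    ... | yes ≡.refl | ih = begin
      c * φ α + linear φ p                                      ≈⟨ +-congˡ ih ⟩
      c * φ α + (coeff p α * φ α + linear φ (remove α p))       ≈⟨ +-assoc _ _ _ ⟨
      c * φ α + coeff p α * φ α + linear φ (remove α p)         ≈⟨ +-congʳ (distribʳ _ _ _) ⟨
      (c + coeff p α) * φ α + linear φ (remove α p)             ≈⟨ +-congʳ (*-congʳ (+-congʳ (*-identityʳ c))) ⟨
      (c * 1# + coeff p α) * φ α + linear φ (remove α p)        ∎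
    ... | no _       | ih = begin
      c * φ β + linear φ p                                      ≈⟨ +-congˡ ih ⟩
      c * φ β + (coeff p α * φ α + linear φ (remove α p))       ≈⟨ x∙yz≈y∙xz _ _ _ ⟩
      coeff p α * φ α + (c * φ β + linear φ (remove α p))       ≈⟨ +-congʳ (*-congʳ (+-identityˡ _)) ⟨
      (0# + coeff p α) * φ α + (c * φ β + linear φ (remove α p)) ≈⟨ +-congʳ (*-congʳ (+-congʳ (zeroʳ c))) ⟨
      (c * 0# + coeff p α) * φ α + (c * φ β + linear φ (remove α p)) ∎

    length-remove : ∀ c (α : Vec ℕ n) p → length (remove α ((c , α) ∷ p)) ℕ.≤ length p
    length-remove c α p with α ≟ᵉ α
    ... | yes _  = length-filter _ p
    ... | no α≢α = contradiction ≡.refl α≢α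

    coeff-remove : ∀ (α : Vec ℕ n) p → (∀ β → coeff p β ≈ 0#) → ∀ β → coeff (remove α p) β ≈ 0#
    coeff-remove α p p≈0 β = begin
      coeff (remove α p) β                         ≈⟨ +-identityˡ _ ⟨
      0# + coeff (remove α p) β                    ≈⟨ +-congʳ (zeroˡ _) ⟨
      0# * δ β α + coeff (remove α p) β            ≈⟨ +-congʳ (*-congʳ (p≈0 α)) ⟨
      coeff p α * δ β α + coeff (remove α p) β     ≈⟨ linear-remove (δ β) α p ⟨
      coeff p β                                    ≈⟨ p≈0 β ⟩
      0#                                           ∎

    linear-coeff≈0 : ∀ (φ : Vec ℕ n → Carrier) p → (∀ α → coeff p α ≈ 0#) → linear φ p ≈ 0#
    linear-coeff≈0 {n} φ p = go (length p) p ℕ.≤-refl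
      where
      go : ∀ l (p : Poly n) → length p ℕ.≤ l → (∀ α → coeff p α ≈ 0#) → linear φ p ≈ 0#
      go l       []              _       _   = refl
      go (suc l) p@((c , α) ∷ r) (s≤s r≤l) p≈0 = begin
        linear φ p                              ≈⟨ linear-remove φ α p ⟩
        coeff p α * φ α + linear φ (remove α p) ≈⟨ +-cong (*-congʳ (p≈0 α))
                                                     (go l (remove α p) (ℕ.≤-trans (length-remove c α r) r≤l) (coeff-remove α p p≈0)) ⟩
        0# * φ α + 0#                           ≈⟨ +-identityʳ _ ⟩
        0# * φ α                                ≈⟨ zeroˡ _ ⟩
        0#                                      ∎

    x-y≈0⇒x≈y : ∀ {x y} → x - y ≈ 0# → x ≈ y
    x-y≈0⇒x≈y {x} {y} x-y≈0 = begin
      x              ≈⟨ +-identityʳ x ⟨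
      x + 0#         ≈⟨ +-congˡ (-‿inverseˡ y) ⟨
      x + (- y + y)  ≈⟨ +-assoc x (- y) y ⟨
      x - y + y      ≈⟨ +-congʳ x-y≈0 ⟩
      0# + y         ≈⟨ +-identityˡ y ⟩
      y              ∎

    x≈y⇒x-y≈0 : ∀ {x y} → x ≈ y → x - y ≈ 0#
    x≈y⇒x-y≈0 {x} {y} x≈y = trans (+-congʳ x≈y) (-‿inverseʳ y)

    linear-cong : ∀ (φ : Vec ℕ n → Carrier) {p r} → p ≈ₚ r → linear φ p ≈ linear φ r
    linear-cong φ {p} {r} p≈r = x-y≈0⇒x≈y (trans (sym (linear-- φ p r))
      (linear-coeff≈0 φ (p -ₚ r) (λ α → trans (linear-- (δ α) p r) (x≈y⇒x-y≈0 (coeff-≈ p≈r α)))))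

    linear-ext : ∀ {p r : Poly n} → (∀ φ → linear φ p ≈ linear φ r) → p ≈ₚ r
    linear-ext eq = coeffs-≈ (λ α → eq (δ α))

    ⊕-identityˡ : (α : Vec ℕ n) → replicate n 0 ⊕ α ≡ α
    ⊕-identityˡ []      = ≡.refl
    ⊕-identityˡ (a ∷ α) = ≡.cong (a ∷_) (⊕-identityˡ α)

    linear-≡ : (φ : Vec ℕ n → Carrier) → ∀ {α β} → α ≡ β → φ α ≈ φ β
    linear-≡ φ ≡.refl = refl

    ≈ₚ-isEquivalence : IsEquivalence (_≈ₚ_ {n})
    ≈ₚ-isEquivalence = record
      { refl  = coeffs-≈ (λ _ → refl)
      ; sym   = λ p≈r → coeffs-≈ (λ α → sym (coeff-≈ p≈r α))
      ; trans = λ p≈r r≈s → coeffs-≈ (λ α → trans (coeff-≈ p≈r α) (coeff-≈ r≈s α))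
      }

    +ₚ-cong : ∀ {p p′ r r′ : Poly n} → p ≈ₚ p′ → r ≈ₚ r′ → p +ₚ r ≈ₚ p′ +ₚ r′
    +ₚ-cong {p = p} {p′} {r} {r′} p≈ r≈ = coeffs-≈ λ α → begin
      coeff (p +ₚ r) α        ≈⟨ linear-+ (δ α) p r ⟩
      coeff p α + coeff r α   ≈⟨ +-cong (coeff-≈ p≈ α) (coeff-≈ r≈ α) ⟩
      coeff p′ α + coeff r′ α ≈⟨ linear-+ (δ α) p′ r′ ⟨
      coeff (p′ +ₚ r′) α      ∎

    +ₚ-assoc : (p r s : Poly n) → (p +ₚ r) +ₚ s ≈ₚ p +ₚ (r +ₚ s)
    +ₚ-assoc p r s = linear-ext λ φ → begin
      linear φ ((p +ₚ r) +ₚ s)                 ≈⟨ linear-+ φ (p +ₚ r) s ⟩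
      linear φ (p +ₚ r) + linear φ s           ≈⟨ +-congʳ (linear-+ φ p r) ⟩
      linear φ p + linear φ r + linear φ s     ≈⟨ +-assoc _ _ _ ⟩
      linear φ p + (linear φ r + linear φ s)   ≈⟨ +-congˡ (linear-+ φ r s) ⟨
      linear φ p + linear φ (r +ₚ s)           ≈⟨ linear-+ φ p (r +ₚ s) ⟨
      linear φ (p +ₚ (r +ₚ s))                 ∎

    +ₚ-comm : (p r : Poly n) → p +ₚ r ≈ₚ r +ₚ p
    +ₚ-comm p r = linear-ext λ φ → begin
      linear φ (p +ₚ r)       ≈⟨ linear-+ φ p r ⟩
      linear φ p + linear φ r ≈⟨ +-comm _ _ ⟩
      linear φ r + linear φ p ≈⟨ linear-+ φ r p ⟨
      linear φ (r +ₚ p)       ∎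

    +ₚ-identityˡ : (p : Poly n) → [] +ₚ p ≈ₚ p
    +ₚ-identityˡ p = coeffs-≈ (λ _ → refl)

    +ₚ-identityʳ : (p : Poly n) → p +ₚ [] ≈ₚ p
    +ₚ-identityʳ p = linear-ext λ φ → trans (linear-+ φ p []) (+-identityʳ _)

    -ₚ-cong : {p r : Poly n} → p ≈ₚ r → -ₚ p ≈ₚ -ₚ r
    -ₚ-cong {p = p} {r} p≈r = coeffs-≈ λ α →
      trans (linear-neg (δ α) p) (trans (-‿cong (coeff-≈ p≈r α)) (sym (linear-neg (δ α) r)))

    -ₚ-inverseˡ : (p : Poly n) → -ₚ p +ₚ p ≈ₚ []
    -ₚ-inverseˡ p = linear-ext λ φ →
      trans (linear-+ φ (-ₚ p) p) (trans (+-congʳ (linear-neg φ p)) (-‿inverseˡ _))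

    -ₚ-inverseʳ : (p : Poly n) → p +ₚ -ₚ p ≈ₚ []
    -ₚ-inverseʳ p = linear-ext λ φ → trans (linear-- φ p p) (-‿inverseʳ _)

    *ₚ-cong : ∀ {p p′ r r′ : Poly n} → p ≈ₚ p′ → r ≈ₚ r′ → p *ₚ r ≈ₚ p′ *ₚ r′
    *ₚ-cong {p = p} {p′} {r} {r′} p≈ r≈ = linear-ext λ φ → begin
      linear φ (p *ₚ r)                                ≈⟨ linear-* φ p r ⟩
      linear (λ α → linear (λ β → φ (α ⊕ β)) r) p      ≈⟨ linear-congˡ (λ α → linear-cong _ r≈) p ⟩
      linear (λ α → linear (λ β → φ (α ⊕ β)) r′) p     ≈⟨ linear-cong _ p≈ ⟩
      linear (λ α → linear (λ β → φ (α ⊕ β)) r′) p′    ≈⟨ linear-* φ p′ r′ ⟨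
      linear φ (p′ *ₚ r′)                              ∎

    *ₚ-assoc : (p r s : Poly n) → (p *ₚ r) *ₚ s ≈ₚ p *ₚ (r *ₚ s)
    *ₚ-assoc p r s = linear-ext λ φ → begin
      linear φ ((p *ₚ r) *ₚ s)
        ≈⟨ linear-* φ (p *ₚ r) s ⟩
      linear (λ α → linear (λ γ → φ (α ⊕ γ)) s) (p *ₚ r)
        ≈⟨ linear-* _ p r ⟩
      linear (λ α → linear (λ β → linear (λ γ → φ ((α ⊕ β) ⊕ γ)) s) r) p
        ≈⟨ linear-congˡ (λ α → linear-congˡ (λ β → linear-congˡ (λ γ →
             linear-≡ φ (Vec.zipWith-assoc ℕ.+-assoc α β γ)) s) r) p ⟩
      linear (λ α → linear (λ β → linear (λ γ → φ (α ⊕ (β ⊕ γ))) s) r) p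
        ≈⟨ linear-congˡ (λ α → linear-* _ r s) p ⟨
      linear (λ α → linear (λ ε → φ (α ⊕ ε)) (r *ₚ s)) p
        ≈⟨ linear-* φ p (r *ₚ s) ⟨
      linear φ (p *ₚ (r *ₚ s)) ∎

    *ₚ-comm : (p r : Poly n) → p *ₚ r ≈ₚ r *ₚ p
    *ₚ-comm p r = linear-ext λ φ → begin
      linear φ (p *ₚ r)                              ≈⟨ linear-* φ p r ⟩
      linear (λ α → linear (λ β → φ (α ⊕ β)) r) p    ≈⟨ linear-swap _ p r ⟩
      linear (λ β → linear (λ α → φ (α ⊕ β)) p) r    ≈⟨ linear-congˡ (λ β → linear-congˡ (λ α →
                                                          linear-≡ φ (Vec.zipWith-comm ℕ.+-comm α β)) p) r ⟩
      linear (λ β → linear (λ α → φ (β ⊕ α)) p) r    ≈⟨ linear-* φ r p ⟨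
      linear φ (r *ₚ p)                              ∎

    *ₚ-identityˡ : (p : Poly n) → const 1# *ₚ p ≈ₚ p
    *ₚ-identityˡ p = linear-ext λ φ → begin
      linear φ (const 1# *ₚ p)                             ≈⟨ linear-* φ (const 1#) p ⟩
      1# * linear (λ β → φ (replicate _ 0 ⊕ β)) p + 0#     ≈⟨ +-identityʳ _ ⟩
      1# * linear (λ β → φ (replicate _ 0 ⊕ β)) p          ≈⟨ *-identityˡ _ ⟩
      linear (λ β → φ (replicate _ 0 ⊕ β)) p               ≈⟨ linear-congˡ (λ β → linear-≡ φ (⊕-identityˡ β)) p ⟩
      linear φ p                                           ∎

    *ₚ-distribʳ : (p r s : Poly n) → (r +ₚ s) *ₚ p ≈ₚ r *ₚ p +ₚ s *ₚ p
    *ₚ-distribʳ {n} p r s = linear-ext λ φ → begin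
      linear φ ((r +ₚ s) *ₚ p)                     ≈⟨ linear-* φ (r +ₚ s) p ⟩
      linear (ψ φ) (r +ₚ s)                        ≈⟨ linear-+ (ψ φ) r s ⟩
      linear (ψ φ) r + linear (ψ φ) s              ≈⟨ +-cong (linear-* φ r p) (linear-* φ s p) ⟨
      linear φ (r *ₚ p) + linear φ (s *ₚ p)        ≈⟨ linear-+ φ (r *ₚ p) (s *ₚ p) ⟨
      linear φ (r *ₚ p +ₚ s *ₚ p)                  ∎
      where
      ψ : (Vec ℕ n → Carrier) → Vec ℕ n → Carrier
      ψ φ α = linear (λ β → φ (α ⊕ β)) p

    private
      transₚ : {p r s : Poly n} → p ≈ₚ r → r ≈ₚ s → p ≈ₚ s
      transₚ = IsEquivalence.trans ≈ₚ-isEquivalence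

    ₚ-isCommutativeRing : IsCommutativeRing (_≈ₚ_ {n}) _+ₚ_ _*ₚ_ -ₚ_ [] (const 1#)
    ₚ-isCommutativeRing = record
      { isRing = record
        { +-isAbelianGroup = record
          { isGroup = record
            { isMonoid = record
              { isSemigroup = record
                { isMagma = record { isEquivalence = ≈ₚ-isEquivalence ; ∙-cong = +ₚ-cong }
                ; assoc = +ₚ-assoc
                }
              ; identity = +ₚ-identityˡ , +ₚ-identityʳ
              }
            ; inverse = -ₚ-inverseˡ , -ₚ-inverseʳ
            ; ⁻¹-cong = -ₚ-cong
            }
          ; comm = +ₚ-comm
          }
        ; *-cong = *ₚ-cong
        ; *-assoc = *ₚ-assoc
        ; *-identity = *ₚ-identityˡ , λ p → transₚ (*ₚ-comm p (const 1#)) (*ₚ-identityˡ p)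
        ; distrib = (λ p r s → transₚ (*ₚ-comm p (r +ₚ s)) (transₚ (*ₚ-distribʳ p r s)
                      (+ₚ-cong (*ₚ-comm r p) (*ₚ-comm s p))))
                  , *ₚ-distribʳ
        }
      ; *-comm = *ₚ-comm
      }

  ₚ-commutativeRing : ℕ → CommutativeRing 0ℓ 0ℓ
  ₚ-commutativeRing n = record { isCommutativeRing = ₚ-isCommutativeRing {n} }

record IntegralDomain : Set₁ where
  field
    commutativeRing : CommutativeRing 0ℓ 0ℓ
  open CommutativeRing commutativeRing public
  field
    _≈?_        : Decidable _≈_
    1≉0         : ¬ 1# ≈ 0#
    xy≉0        : ∀ {x y} → ¬ x ≈ 0# → ¬ y ≈ 0# → ¬ x * y ≈ 0#

infix 4 _<ˡ_
data _<ˡ_ : Vec ℕ n → Vec ℕ n → Set where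
  here  : ∀ {a b} {α β : Vec ℕ n} → a ℕ.< b → a ∷ α <ˡ b ∷ β
  there : ∀ {a} {α β : Vec ℕ n} → α <ˡ β → a ∷ α <ˡ a ∷ β

<ˡ-irrefl : {α : Vec ℕ n} → ¬ α <ˡ α
<ˡ-irrefl (here a<a)  = ℕ.<-irrefl ≡.refl a<a
<ˡ-irrefl (there α<α) = <ˡ-irrefl α<α

<ˡ-trans : {α β γ : Vec ℕ n} → α <ˡ β → β <ˡ γ → α <ˡ γ
<ˡ-trans (here a<b)  (here b<c)  = here (ℕ.<-trans a<b b<c)
<ˡ-trans (here a<b)  (there _)   = here a<b
<ˡ-trans (there _)   (here b<c)  = here b<c
<ˡ-trans (there α<β) (there β<γ) = there (<ˡ-trans α<β β<γ)

<ˡ-total : (α β : Vec ℕ n) → α ≢ β → α <ˡ β ⊎ β <ˡ α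
<ˡ-total []      []      α≢β = contradiction ≡.refl α≢β
<ˡ-total (a ∷ α) (b ∷ β) α≢β with ℕ.<-cmp a b
... | tri< a<b _ _ = inj₁ (here a<b)
... | tri> _ _ b<a = inj₂ (here b<a)
... | tri≈ _ ≡.refl _ with <ˡ-total α β (α≢β ∘ ≡.cong (a ∷_))
...   | inj₁ α<β = inj₁ (there α<β)
...   | inj₂ β<α = inj₂ (there β<α)

⊕-monoʳ-<ˡ : (γ : Vec ℕ n) {α β : Vec ℕ n} → α <ˡ β → γ ⊕ α <ˡ γ ⊕ β
⊕-monoʳ-<ˡ (c ∷ γ) (here a<b)  = here (ℕ.+-monoʳ-< c a<b)
⊕-monoʳ-<ˡ (c ∷ γ) (there α<β) = there (⊕-monoʳ-<ˡ γ α<β)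

⊕-comm : (α β : Vec ℕ n) → α ⊕ β ≡ β ⊕ α
⊕-comm = Vec.zipWith-comm ℕ.+-comm

⊕-monoˡ-<ˡ : {α β : Vec ℕ n} → α <ˡ β → (γ : Vec ℕ n) → α ⊕ γ <ˡ β ⊕ γ
⊕-monoˡ-<ˡ {α = α} {β} α<β γ = ≡.subst₂ _<ˡ_ (⊕-comm γ α) (⊕-comm γ β) (⊕-monoʳ-<ˡ γ α<β)

module PolynomialDomain (D : IntegralDomain) where
  open IntegralDomain D
  open Polynomial commutativeRing
  open CommutativeSemigroupProperties +-commutativeSemigroup using (x∙yz≈y∙xz)
  open SetoidReasoning setoid

  -- Normal forms: strictly decreasing exponents, nonzero coefficients.
  Below : Vec ℕ n → Poly n → Set
  Below α = All (λ m → proj₂ m <ˡ α)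

  data Descending {n} : Poly n → Set where
    []   : Descending []
    cons : ∀ {c α r} → ¬ c ≈ 0# → Below α r → Descending r → Descending ((c , α) ∷ r)

  private
    module E {n} = IsEquivalence (≈ₚ-isEquivalence {n})

  abstract
    private
      below-trans : {α β : Vec ℕ n} {r : Poly n} → α <ˡ β → Below α r → Below β r
      below-trans α<β = All.map (λ γ<α → <ˡ-trans γ<α α<β)

      drop : ∀ {c} (α : Vec ℕ n) r → c ≈ 0# → (c , α) ∷ r ≈ₚ r
      drop α r c≈0 = linear-ext (λ φ → trans (+-congʳ (trans (*-congʳ c≈0) (zeroˡ _))) (+-identityˡ _))

      merge : ∀ c d (α : Vec ℕ n) r → (c , α) ∷ (d , α) ∷ r ≈ₚ (c + d , α) ∷ r
      merge c d α r = linear-ext (λ φ → trans (sym (+-assoc _ _ _)) (+-congʳ (sym (distribʳ _ c d))))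

      swap : ∀ c (α : Vec ℕ n) d β r → (c , α) ∷ (d , β) ∷ r ≈ₚ (d , β) ∷ (c , α) ∷ r
      swap c α d β r = linear-ext (λ φ → x∙yz≈y∙xz _ _ _)

      insert : ∀ c (α : Vec ℕ n) r → Descending r →
        ∃[ s ] (c , α) ∷ r ≈ₚ s × Descending s × (∀ {γ} → α <ˡ γ → Below γ r → Below γ s)
      insert c α [] [] with c ≈? 0#
      ... | yes c≈0 = [] , drop α [] c≈0 , [] , λ _ _ → []
      ... | no c≉0  = (c , α) ∷ [] , E.refl , cons c≉0 [] [] , λ α<γ _ → α<γ ∷ []
      insert c α r@((d , β) ∷ r′) r↓@(cons d≉0 r′<β r′↓) with α ≟ᵉ β
      ... | yes ≡.refl with (c + d) ≈? 0#
      ...   | yes c+d≈0 = r′ , E.trans (merge c d α r′) (drop α r′ c+d≈0) , r′↓ , λ _ → All.tail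
      ...   | no c+d≉0  = (c + d , α) ∷ r′ , merge c d α r′ , cons c+d≉0 r′<β r′↓ , λ { α<γ (_ ∷ r′<γ) → α<γ ∷ r′<γ }
      insert c α r@((d , β) ∷ r′) r↓@(cons d≉0 r′<β r′↓) | no α≢β with <ˡ-total α β α≢β
      ... | inj₂ β<α with c ≈? 0#
      ...   | yes c≈0 = r , drop α r c≈0 , r↓ , λ _ → id
      ...   | no c≉0  = (c , α) ∷ r , E.refl , cons c≉0 (β<α ∷ below-trans β<α r′<β) r↓ , _∷_
      insert c α r@((d , β) ∷ r′) r↓@(cons d≉0 r′<β r′↓) | no α≢β | inj₁ α<β with insert c α r′ r′↓
      ... | s , eq , s↓ , below =
        (d , β) ∷ s , E.trans (swap c α d β r′) (+ₚ-cong (E.refl {x = (d , β) ∷ []}) eq) , cons d≉0 (below α<β r′<β) s↓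
        , λ { α<γ (β<γ ∷ r′<γ) → β<γ ∷ below α<γ r′<γ }

    normalForm : (p : Poly n) → ∃[ r ] p ≈ₚ r × Descending r
    normalForm []            = [] , E.refl , []
    normalForm ((c , α) ∷ p) with normalForm p
    ... | r , p≈r , r↓ with insert c α r r↓
    ...   | s , eq , s↓ , _ = s , E.trans (+ₚ-cong (E.refl {x = (c , α) ∷ []}) p≈r) eq , s↓

    private
      <ˡ⇒≢ : {α β : Vec ℕ n} → α <ˡ β → β ≢ α
      <ˡ⇒≢ α<β ≡.refl = <ˡ-irrefl α<β

      top : ∀ c (α : Vec ℕ n) r → Below α r → coeff ((c , α) ∷ r) α ≈ c
      top c α r r<α = begin
        c * δ α α + coeff r α ≈⟨ +-cong (*-congˡ (δ-refl α)) (linear-0 (δ α) r (All.map (δ-≢ ∘ <ˡ⇒≢) r<α)) ⟩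
        c * 1# + 0#           ≈⟨ +-identityʳ _ ⟩
        c * 1#                ≈⟨ *-identityʳ c ⟩
        c                     ∎

    _≈ₚ0? : (p : Poly n) → Dec (p ≈ₚ [])
    p ≈ₚ0? with normalForm p
    ... | []          , p≈r , _            = yes p≈r
    ... | (c , α) ∷ r , p≈r , cons c≉0 r<α _ =
      no (λ p≈0 → c≉0 (trans (sym (top c α r r<α)) (trans (sym (coeff-≈ p≈r α)) (coeff-≈ p≈0 α))))

    _≈ₚ?_ : Decidable (_≈ₚ_ {n})
    p ≈ₚ? r = map′
      (λ p-r≈0 → coeffs-≈ (λ α → x-y≈0⇒x≈y (trans (sym (linear-- (δ α) p r)) (coeff-≈ p-r≈0 α))))
      (λ p≈r → coeffs-≈ (λ α → trans (linear-- (δ α) p r) (x≈y⇒x-y≈0 (coeff-≈ p≈r α))))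
      ((p -ₚ r) ≈ₚ0?)

    1ₚ≉0 : ¬ const {n} 1# ≈ₚ []
    1ₚ≉0 {n} 1≈0 = 1≉0 (trans (sym (top 1# 0s [] [])) (coeff-≈ 1≈0 0s))
      where
      0s : Vec ℕ n
      0s = replicate n 0

    var≉0 : (i : Fin n) → ¬ var i ≈ₚ []
    var≉0 {n} i x≈0 = 1≉0 (trans (sym (top 1# eᵢ [] [])) (coeff-≈ x≈0 eᵢ))
      where
      eᵢ : Vec ℕ n
      eᵢ = replicate n 0 [ i ]≔ 1

    *ₚ-≉0 : {p r : Poly n} → ¬ p ≈ₚ [] → ¬ r ≈ₚ [] → ¬ p *ₚ r ≈ₚ []
    *ₚ-≉0 {n} {p} {r} p≉0 r≉0 pr≈0 with normalForm p | normalForm r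
    ... | []           , p≈ , _ | _            = p≉0 p≈
    ... | (_ ∷ _)      , _  , _ | [] , r≈ , _  = r≉0 r≈
    ... | (c , α) ∷ p′ , p≈ , cons c≉0 p′<α _ | (d , β) ∷ r′ , r≈ , cons d≉0 r′<β _ =
      xy≉0 c≉0 d≉0 (begin
        c * d                                           ≈⟨ *-congˡ head ⟨
        c * inner α                                     ≈⟨ +-identityʳ _ ⟨
        c * inner α + 0#                                ≈⟨ +-congˡ (linear-0 inner p′ (All.map (λ {m} → tail {m}) p′<α)) ⟨
        linear inner ((c , α) ∷ p′)                     ≈⟨ linear-* (δ (α ⊕ β)) ((c , α) ∷ p′) ((d , β) ∷ r′) ⟨
        coeff (((c , α) ∷ p′) *ₚ ((d , β) ∷ r′)) (α ⊕ β) ≈⟨ coeff-≈ (*ₚ-cong p≈ r≈) (α ⊕ β) ⟨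
        coeff (p *ₚ r) (α ⊕ β)                          ≈⟨ coeff-≈ pr≈0 (α ⊕ β) ⟩
        0#                                              ∎)
      where
      inner : Vec ℕ n → Carrier
      inner γ = linear (λ ε → δ (α ⊕ β) (γ ⊕ ε)) ((d , β) ∷ r′)

      head : inner α ≈ d
      head = begin
        d * δ (α ⊕ β) (α ⊕ β) + linear (λ ε → δ (α ⊕ β) (α ⊕ ε)) r′
          ≈⟨ +-cong (*-congˡ (δ-refl (α ⊕ β)))
               (linear-0 _ r′ (All.map (λ ε<β → δ-≢ (<ˡ⇒≢ (⊕-monoʳ-<ˡ α ε<β))) r′<β)) ⟩
        d * 1# + 0#  ≈⟨ +-identityʳ _ ⟩
        d * 1#       ≈⟨ *-identityʳ d ⟩
        d            ∎

      tail : ∀ {m : Carrier × Vec ℕ n} → proj₂ m <ˡ α → inner (proj₂ m) ≈ 0#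
      tail {_ , γ} γ<α = linear-0 _ ((d , β) ∷ r′)
        ( δ-≢ (<ˡ⇒≢ (⊕-monoˡ-<ˡ γ<α β))
        ∷ All.map (λ ε<β → δ-≢ (<ˡ⇒≢ (<ˡ-trans (⊕-monoʳ-<ˡ γ ε<β) (⊕-monoˡ-<ˡ γ<α β)))) r′<β )

  polynomialDomain : ℕ → IntegralDomain
  polynomialDomain n = record
    { commutativeRing = ₚ-commutativeRing n
    ; _≈?_            = _≈ₚ?_
    ; 1≉0             = 1ₚ≉0
    ; xy≉0            = *ₚ-≉0
    }

module FieldOfFractions (D : IntegralDomain) where
  open IntegralDomain D
  open RingProperties ring using (-‿distribˡ-*; x[y-z]≈xy-xz)
  open CommutativeSemigroupProperties *-commutativeSemigroup using (xy∙z≈xz∙y; xy∙z≈y∙xz)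
  open SetoidReasoning setoid
  private module S = SemiringSolver commutativeSemiring

  infix 7 _//_[_]
  record Fraction : Set where
    constructor _//_[_]
    field
      num   : Carrier
      den   : Carrier
      den≉0 : ¬ den ≈ 0#
  open Fraction public

  infix 4 _≃_
  record _≃_ (x y : Fraction) : Set where
    constructor cross
    field
      uncross : num x * den y ≈ num y * den x
  open _≃_ public

  infixl 6 _+ᶠ_
  infixl 7 _*ᶠ_
  infix  8 -ᶠ_

  _+ᶠ_ _*ᶠ_ : Fraction → Fraction → Fraction
  x +ᶠ y = (num x * den y + num y * den x) // (den x * den y) [ xy≉0 (den≉0 x) (den≉0 y) ]
  x *ᶠ y = (num x * num y) // (den x * den y) [ xy≉0 (den≉0 x) (den≉0 y) ]

  -ᶠ_ : Fraction → Fraction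
  -ᶠ x = (- num x) // den x [ den≉0 x ]

  embed : Carrier → Fraction
  embed a = a // 1# [ 1≉0 ]

  0ᶠ 1ᶠ : Fraction
  0ᶠ = embed 0#
  1ᶠ = embed 1#

  abstract
    *-cancelʳ : ∀ {a b c} → ¬ c ≈ 0# → a * c ≈ b * c → a ≈ b
    *-cancelʳ {a} {b} {c} c≉0 ac≈bc with (a - b) ≈? 0#
    ... | yes a-b≈0 = Polynomial.x-y≈0⇒x≈y commutativeRing a-b≈0
    ... | no a-b≉0  = contradiction (begin
      (a - b) * c      ≈⟨ distribʳ c a (- b) ⟩
      a * c + - b * c  ≈⟨ +-cong ac≈bc (sym (-‿distribˡ-* b c)) ⟩
      b * c - b * c    ≈⟨ -‿inverseʳ (b * c) ⟩
      0#               ∎) (xy≉0 a-b≉0 c≉0)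

    ≃-isEquivalence : IsEquivalence _≃_
    ≃-isEquivalence = record
      { refl  = cross refl
      ; sym   = λ x≃y → cross (sym (uncross x≃y))
      ; trans = λ {x} {y} {z} x≃y y≃z → cross (*-cancelʳ (den≉0 y) (begin
          num x * den z * den y   ≈⟨ xy∙z≈xz∙y _ _ _ ⟩
          num x * den y * den z   ≈⟨ *-congʳ (uncross x≃y) ⟩
          num y * den x * den z   ≈⟨ xy∙z≈xz∙y _ _ _ ⟩
          num y * den z * den x   ≈⟨ *-congʳ (uncross y≃z) ⟩
          num z * den y * den x   ≈⟨ xy∙z≈xz∙y _ _ _ ⟩
          num z * den x * den y   ∎))
      }

    +ᶠ-cong : ∀ {x x′ y y′} → x ≃ x′ → y ≃ y′ → x +ᶠ y ≃ x′ +ᶠ y′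
    +ᶠ-cong {x} {x′} {y} {y′} x≃ y≃ = cross (begin
      (num x * den y + num y * den x) * (den x′ * den y′)
        ≈⟨ S.solve 6 (λ a b c d b′ d′ → ((a S.:* d S.:+ c S.:* b) S.:* (b′ S.:* d′))
             S.:= ((a S.:* b′) S.:* (d S.:* d′) S.:+ (c S.:* d′) S.:* (b S.:* b′)))
             refl (num x) (den x) (num y) (den y) (den x′) (den y′) ⟩
      (num x * den x′) * (den y * den y′) + (num y * den y′) * (den x * den x′)
        ≈⟨ +-cong (*-congʳ (uncross x≃)) (*-congʳ (uncross y≃)) ⟩
      (num x′ * den x) * (den y * den y′) + (num y′ * den y) * (den x * den x′)
        ≈⟨ S.solve 6 (λ b d a′ b′ c′ d′ → ((a′ S.:* b) S.:* (d S.:* d′) S.:+ (c′ S.:* d) S.:* (b S.:* b′))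
             S.:= ((a′ S.:* d′ S.:+ c′ S.:* b′) S.:* (b S.:* d)))
             refl (den x) (den y) (num x′) (den x′) (num y′) (den y′) ⟩
      (num x′ * den y′ + num y′ * den x′) * (den x * den y) ∎)

    *ᶠ-cong : ∀ {x x′ y y′} → x ≃ x′ → y ≃ y′ → x *ᶠ y ≃ x′ *ᶠ y′
    *ᶠ-cong {x} {x′} {y} {y′} x≃ y≃ = cross (begin
      (num x * num y) * (den x′ * den y′)     ≈⟨ medial _ _ _ _ ⟩
      (num x * den x′) * (num y * den y′)     ≈⟨ *-cong (uncross x≃) (uncross y≃) ⟩
      (num x′ * den x) * (num y′ * den y)     ≈⟨ medial _ _ _ _ ⟩
      (num x′ * num y′) * (den x * den y)     ∎)
      where open CommutativeSemigroupProperties *-commutativeSemigroup using () renaming (interchange to medial)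

    -ᶠ-cong : ∀ {x y} → x ≃ y → -ᶠ x ≃ -ᶠ y
    -ᶠ-cong {x} {y} x≃y = cross (begin
      - num x * den y    ≈⟨ -‿distribˡ-* _ _ ⟨
      - (num x * den y)  ≈⟨ -‿cong (uncross x≃y) ⟩
      - (num y * den x)  ≈⟨ -‿distribˡ-* _ _ ⟩
      - num y * den x    ∎)

    private
      module F = IsEquivalence ≃-isEquivalence

      same-den : ∀ {x y} → num x ≈ num y → den x ≈ den y → x ≃ y
      same-den n≈ d≈ = cross (*-cong n≈ (sym d≈))

    +ᶠ-assoc : ∀ x y z → (x +ᶠ y) +ᶠ z ≃ x +ᶠ (y +ᶠ z)
    +ᶠ-assoc x y z = same-den
      (S.solve 6 (λ a b c d e f → ((a S.:* d S.:+ c S.:* b) S.:* f S.:+ e S.:* (b S.:* d))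
         S.:= (a S.:* (d S.:* f) S.:+ (c S.:* f S.:+ e S.:* d) S.:* b))
         refl (num x) (den x) (num y) (den y) (num z) (den z))
      (*-assoc _ _ _)

    +ᶠ-comm : ∀ x y → x +ᶠ y ≃ y +ᶠ x
    +ᶠ-comm x y = same-den (+-comm _ _) (*-comm _ _)

    +ᶠ-identityˡ : ∀ x → 0ᶠ +ᶠ x ≃ x
    +ᶠ-identityˡ x = same-den
      (trans (+-cong (zeroˡ _) (*-identityʳ _)) (+-identityˡ _)) (*-identityˡ _)

    -ᶠ-inverseˡ : ∀ x → -ᶠ x +ᶠ x ≃ 0ᶠ
    -ᶠ-inverseˡ x = cross (begin
      (- num x * den x + num x * den x) * 1#  ≈⟨ *-identityʳ _ ⟩
      - num x * den x + num x * den x         ≈⟨ distribʳ (den x) (- num x) (num x) ⟨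
      (- num x + num x) * den x               ≈⟨ *-congʳ (-‿inverseˡ (num x)) ⟩
      0# * den x                              ≈⟨ zeroˡ _ ⟩
      0#                                      ≈⟨ zeroˡ _ ⟨
      0# * (den x * den x)                    ∎)

    *ᶠ-assoc : ∀ x y z → (x *ᶠ y) *ᶠ z ≃ x *ᶠ (y *ᶠ z)
    *ᶠ-assoc x y z = same-den (*-assoc _ _ _) (*-assoc _ _ _)

    *ᶠ-comm : ∀ x y → x *ᶠ y ≃ y *ᶠ x
    *ᶠ-comm x y = same-den (*-comm _ _) (*-comm _ _)

    *ᶠ-identityˡ : ∀ x → 1ᶠ *ᶠ x ≃ x
    *ᶠ-identityˡ x = same-den (*-identityˡ _) (*-identityˡ _)

    *ᶠ-distribʳ : ∀ x y z → (y +ᶠ z) *ᶠ x ≃ y *ᶠ x +ᶠ z *ᶠ x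
    *ᶠ-distribʳ x y z = cross
      (S.solve 6 (λ a b c d e f →
           (((c S.:* f S.:+ e S.:* d) S.:* a) S.:* ((d S.:* b) S.:* (f S.:* b)))
           S.:= (((c S.:* a) S.:* (f S.:* b) S.:+ (e S.:* a) S.:* (d S.:* b)) S.:* ((d S.:* f) S.:* b)))
         refl (num x) (den x) (num y) (den y) (num z) (den z))

    isFractionRing : IsCommutativeRing _≃_ _+ᶠ_ _*ᶠ_ -ᶠ_ 0ᶠ 1ᶠ
    isFractionRing = record
      { isRing = record
        { +-isAbelianGroup = record
          { isGroup = record
            { isMonoid = record
              { isSemigroup = record
                { isMagma = record { isEquivalence = ≃-isEquivalence ; ∙-cong = +ᶠ-cong }
                ; assoc = +ᶠ-assoc
                }
              ; identity = +ᶠ-identityˡ , λ x → F.trans (+ᶠ-comm x 0ᶠ) (+ᶠ-identityˡ x)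
              }
            ; inverse = -ᶠ-inverseˡ , λ x → F.trans (+ᶠ-comm x (-ᶠ x)) (-ᶠ-inverseˡ x)
            ; ⁻¹-cong = -ᶠ-cong
            }
          ; comm = +ᶠ-comm
          }
        ; *-cong = *ᶠ-cong
        ; *-assoc = *ᶠ-assoc
        ; *-identity = *ᶠ-identityˡ , λ x → F.trans (*ᶠ-comm x 1ᶠ) (*ᶠ-identityˡ x)
        ; distrib = (λ x y z → F.trans (*ᶠ-comm x (y +ᶠ z)) (F.trans (*ᶠ-distribʳ x y z)
                      (+ᶠ-cong (*ᶠ-comm y x) (*ᶠ-comm z x))))
                  , *ᶠ-distribʳ
        }
      ; *-comm = *ᶠ-comm
      }

    num≉0 : ∀ {x} → ¬ x ≃ 0ᶠ → ¬ num x ≈ 0#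
    num≉0 x≄0 n≈0 = x≄0 (cross (trans (*-identityʳ _) (trans n≈0 (sym (zeroˡ _)))))

    embed-≄0 : ∀ {a} → ¬ a ≈ 0# → ¬ embed a ≃ 0ᶠ
    embed-≄0 a≉0 a≃0 = a≉0 (trans (sym (*-identityʳ _)) (trans (uncross a≃0) (*-identityʳ _)))

    *ᶠ-≄0 : ∀ {x y} → ¬ x ≃ 0ᶠ → ¬ y ≃ 0ᶠ → ¬ x *ᶠ y ≃ 0ᶠ
    *ᶠ-≄0 {x} {y} x≄0 y≄0 xy≃0 = xy≉0 (num≉0 x≄0) (num≉0 y≄0) (begin
      num x * num y              ≈⟨ *-identityʳ _ ⟨
      num x * num y * 1#         ≈⟨ uncross xy≃0 ⟩
      0# * (den x * den y)       ≈⟨ zeroˡ _ ⟩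
      0#                         ∎)

    _≃?_ : Decidable _≃_
    x ≃? y = map′ cross uncross ((num x * den y) ≈? (num y * den x))

  fractionDomain : IntegralDomain
  fractionDomain = record
    { commutativeRing = record { isCommutativeRing = isFractionRing }
    ; _≈?_            = _≃?_
    ; 1≉0             = embed-≄0 1≉0
    ; xy≉0            = *ᶠ-≄0
    }

  _⁻¹[_] : ∀ x → ¬ x ≃ 0ᶠ → Fraction
  x ⁻¹[ x≄0 ] = den x // num x [ num≉0 x≄0 ]

  abstract
    *ᶠ-inverseʳ : ∀ x (x≄0 : ¬ x ≃ 0ᶠ) → x *ᶠ (x ⁻¹[ x≄0 ]) ≃ 1ᶠ
    *ᶠ-inverseʳ x x≄0 = cross (trans (*-identityʳ _) (trans (*-comm _ _) (sym (*-identityˡ _))))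

abstract
  ℚ-xy≢0 : ∀ {x y} → x ≢ ℚ.0ℚ → y ≢ ℚ.0ℚ → x ℚ.* y ≢ ℚ.0ℚ
  ℚ-xy≢0 {x} {y} x≢0 y≢0 xy≡0 = x≢0 (begin
    x                  ≡⟨ ℚ.*-identityʳ x ⟨
    x ℚ.* ℚ.1ℚ         ≡⟨ ≡.cong (x ℚ.*_) (ℚ.*-inverseʳ y) ⟨
    x ℚ.* (y ℚ.* 1/y)  ≡⟨ ℚ.*-assoc x y 1/y ⟨
    x ℚ.* y ℚ.* 1/y    ≡⟨ ≡.cong (ℚ._* 1/y) xy≡0 ⟩
    ℚ.0ℚ ℚ.* 1/y       ≡⟨ ℚ.*-zeroˡ 1/y ⟩
    ℚ.0ℚ               ∎)
    where
    open ≡.≡-Reasoning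
    instance
      y-nonZero : ℚ.NonZero y
      y-nonZero = ℚ.≢-nonZero y≢0
    1/y : ℚ
    1/y = ℚ.1/ y

ℚ-domain : IntegralDomain
ℚ-domain = record
  { commutativeRing = ℚ.+-*-commutativeRing
  ; _≈?_            = ℚ._≟_
  ; 1≉0             = λ ()
  ; xy≉0            = ℚ-xy≢0
  }

infixr 7 _·_
_·_ : Permutation′ n → Vec ℕ n → Vec ℕ n
σ · μ = tabulate (λ i → lookup μ (σ ⟨$⟩ˡ i))

-- pos i, for i = 0 , … , n - 1, is the pair of neighbouring positions (i , i + 1)
-- among n + 1 positions.
data Adjacent : ℕ → Set where
  pos : Fin n → Adjacent (suc n)

left right : Adjacent n → Fin n
left  (pos i) = inject₁ i
right (pos i) = Fin.suc i

s : Adjacent n → Permutation′ n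
s i = transpose (left i) (right i)

module Hecke (R : CommutativeRing 0ℓ 0ℓ) (t : CommutativeRing.Carrier R) where
  open CommutativeRing R hiding (zero)
  open RingProperties ring
    using (-‿distribˡ-*; -‿distribʳ-*; -1*x≈-x; -‿+-comm; -‿involutive; x[y-z]≈xy-xz)
  open CommutativeSemigroupProperties +-commutativeSemigroup using (interchange)
  open Polynomial R
  open SetoidReasoning setoid

  permute : Permutation′ n → Poly n → Poly n
  permute σ = List.map (map₂ (σ ·_))

  -- The divided difference (f - s i f) / (x_i - x_{i+1}), see ∂-quotient below.
  -- With x = x_i and y = x_{i+1}, the monomial x^a y^b is sent to
  --   Σ_{k < a-b} x^{a-1-k} y^{b+k}   if a ≥ b,
  -- - Σ_{k < b-a} x^{a+k} y^{b-1-k}   if a ≤ b.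
  ∂ : Adjacent n → Poly n → Poly n
  ∂ i = concatMap quotient
    where
    quotient : Carrier × Vec ℕ _ → Poly _
    quotient (c , α) =
         applyUpTo (λ k →   c , α [ left i ]≔ (a ∸ suc k) [ right i ]≔ (b ℕ.+ k)) (a ∸ b)
      ++ applyUpTo (λ k → - c , α [ left i ]≔ (a ℕ.+ k) [ right i ]≔ (b ∸ suc k)) (b ∸ a)
      where
      a = lookup α (left i)
      b = lookup α (right i)

  T : Adjacent n → Poly n → Poly n
  T i f = const t *ₚ f -ₚ (const t *ₚ var (left i) -ₚ var (right i)) *ₚ ∂ i f

  Tʷ : List (Adjacent n) → Poly n → Poly n
  Tʷ []      f = f
  Tʷ (i ∷ w) f = T i (Tʷ w f)

  private
    left≢right : (i : Adjacent n) → left i ≢ right i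
    left≢right (pos (Fin.suc i)) eq = left≢right (pos i) (Fin.suc-injective eq)

    e : Fin n → Vec ℕ n
    e i = replicate _ 0 [ i ]≔ 1

    e-⊕ : (i : Fin n) (α : Vec ℕ n) → e i ⊕ α ≡ α [ i ]≔ suc (lookup α i)
    e-⊕ Fin.zero    (a ∷ α) = ≡.cong (suc a ∷_) (⊕-identityˡ α)
    e-⊕ (Fin.suc i) (a ∷ α) = ≡.cong (a ∷_) (e-⊕ i α)

    telescope : ∀ c (ψ : Vec ℕ n → Carrier) (γ : ℕ → Vec ℕ n) (G : ℕ → Carrier) m →
      (∀ k → k ℕ.< m → ψ (γ k) ≈ G k - G (suc k)) →
      linear ψ (applyUpTo (λ k → c , γ k) m) ≈ c * (G 0 - G m)
    telescope c ψ γ G zero    step = sym (trans (*-congˡ (-‿inverseʳ (G 0))) (zeroʳ c))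
    telescope c ψ γ G (suc m) step = begin
      c * ψ (γ 0) + linear ψ (applyUpTo (λ k → c , γ (suc k)) m)
        ≈⟨ +-cong (*-congˡ (step 0 (s≤s z≤n)))
             (telescope c ψ (γ ∘ suc) (G ∘ suc) m (λ k k<m → step (suc k) (s≤s k<m))) ⟩
      c * (G 0 - G 1) + c * (G 1 - G (suc m))
        ≈⟨ distribˡ c _ _ ⟨
      c * ((G 0 - G 1) + (G 1 - G (suc m)))
        ≈⟨ *-congˡ (begin
             (G 0 - G 1) + (G 1 - G (suc m))    ≈⟨ +-assoc _ _ _ ⟩
             G 0 + (- G 1 + (G 1 - G (suc m)))  ≈⟨ +-congˡ (+-assoc _ _ _) ⟨
             G 0 + (- G 1 + G 1 - G (suc m))    ≈⟨ +-congˡ (+-congʳ (-‿inverseˡ (G 1))) ⟩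
             G 0 + (0# - G (suc m))             ≈⟨ +-congˡ (+-identityˡ _) ⟩
             G 0 - G (suc m)                    ∎) ⟩
      c * (G 0 - G (suc m)) ∎

    module Quotient (i : Adjacent n) (φ : Vec ℕ n → Carrier) where
      ψ : Vec ℕ n → Carrier
      ψ β = φ (e (left i) ⊕ β) - φ (e (right i) ⊕ β)

      module _ (α : Vec ℕ n) where
        a b : ℕ
        a = lookup α (left i)
        b = lookup α (right i)

        put : ℕ → ℕ → Vec ℕ n
        put u v = α [ left i ]≔ u [ right i ]≔ v

        eₗ-put : ∀ u v → e (left i) ⊕ put u v ≡ put (suc u) v
        eₗ-put u v = ≡.trans (e-⊕ (left i) (put u v)) (≡.trans
          (≡.cong (λ w → put u v [ left i ]≔ suc w)
            (≡.trans (Vec.lookup∘update′ (left≢right i) (α [ left i ]≔ u) v) (Vec.lookup∘update (left i) α u)))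
          (≡.trans (Vec.[]≔-commutes (α [ left i ]≔ u) (right i) (left i) (left≢right i ∘ ≡.sym))
            (≡.cong (_[ right i ]≔ v) (Vec.[]≔-idempotent α (left i)))))

        eᵣ-put : ∀ u v → e (right i) ⊕ put u v ≡ put u (suc v)
        eᵣ-put u v = ≡.trans (e-⊕ (right i) (put u v)) (≡.trans
          (≡.cong (λ w → put u v [ right i ]≔ suc w) (Vec.lookup∘update (right i) (α [ left i ]≔ u) v))
          (Vec.[]≔-idempotent (α [ left i ]≔ u) (right i)))

        ψ-put : ∀ u v → ψ (put u v) ≈ φ (put (suc u) v) - φ (put u (suc v))
        ψ-put u v = +-cong (linear-≡ φ (eₗ-put u v)) (-‿cong (linear-≡ φ (eᵣ-put u v)))

        put-self : put a b ≡ α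
        put-self = ≡.trans (≡.cong (_[ right i ]≔ b) (Vec.[]≔-lookup α (left i))) (Vec.[]≔-lookup α (right i))

        lookup-ext : (β γ : Vec ℕ n) → (∀ j → lookup β j ≡ lookup γ j) → β ≡ γ
        lookup-ext β γ eq = ≡.trans (≡.sym (Vec.tabulate∘lookup β)) (≡.trans (Vec.tabulate-cong eq) (Vec.tabulate∘lookup γ))

        put-swap : put b a ≡ s i · α
        put-swap = lookup-ext (put b a) (s i · α) λ j → ≡.trans (entry j) (≡.sym (Vec.lookup∘tabulate _ j))
          where
          entry : ∀ j → lookup (put b a) j ≡ lookup α (s i ⟨$⟩ˡ j)
          entry j with j Fin.≟ right i
          ... | yes ≡.refl = Vec.lookup∘update (right i) (α [ left i ]≔ b) a
          ... | no j≢r with j Fin.≟ left i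
          ...   | yes ≡.refl = ≡.trans (Vec.lookup∘update′ j≢r (α [ left i ]≔ b) a) (Vec.lookup∘update (left i) α b)
          ...   | no j≢l = ≡.trans (Vec.lookup∘update′ j≢r (α [ left i ]≔ b) a) (Vec.lookup∘update′ j≢l α b)

        down : ∀ c → linear ψ (applyUpTo (λ k → c , put (a ∸ suc k) (b ℕ.+ k)) (a ∸ b))
                     ≈ c * (φ (put a (b ℕ.+ 0)) - φ (put (a ∸ (a ∸ b)) (b ℕ.+ (a ∸ b))))
        down c = telescope c ψ _ (λ k → φ (put (a ∸ k) (b ℕ.+ k))) (a ∸ b) λ k k<m →
          trans (ψ-put (a ∸ suc k) (b ℕ.+ k))
            (+-cong (linear-≡ φ (≡.cong (λ u → put u (b ℕ.+ k)) (≡.sym (ℕ.+-∸-assoc 1 (ℕ.≤-trans k<m (ℕ.m∸n≤m a b))))))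
                    (-‿cong (linear-≡ φ (≡.cong (put (a ∸ suc k)) (≡.sym (ℕ.+-suc b k))))))

        up : ∀ c → linear ψ (applyUpTo (λ k → - c , put (a ℕ.+ k) (b ∸ suc k)) (b ∸ a))
                   ≈ c * (φ (put (a ℕ.+ 0) b) - φ (put (a ℕ.+ (b ∸ a)) (b ∸ (b ∸ a))))
        up c = trans (telescope (- c) ψ _ (λ k → - φ (put (a ℕ.+ k) (b ∸ k))) (b ∸ a) λ k k<m →
            trans (ψ-put (a ℕ.+ k) (b ∸ suc k)) (trans (+-comm _ _)
              (+-cong (-‿cong (linear-≡ φ (≡.cong (put (a ℕ.+ k)) (≡.sym (ℕ.+-∸-assoc 1 (ℕ.≤-trans k<m (ℕ.m∸n≤m b a)))))))
                (trans (linear-≡ φ (≡.cong (λ u → put u (b ∸ suc k)) (≡.sym (ℕ.+-suc a k)))) (sym (-‿involutive _))))))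
          (begin
            - c * (- x - - y)    ≈⟨ *-congˡ (-‿+-comm x (- y)) ⟩
            - c * - (x - y)      ≈⟨ -‿distribʳ-* (- c) (x - y) ⟨
            - (- c * (x - y))    ≈⟨ -‿cong (-‿distribˡ-* c (x - y)) ⟨
            - - (c * (x - y))    ≈⟨ -‿involutive _ ⟩
            c * (x - y)          ∎)
          where
          x = φ (put (a ℕ.+ 0) b)
          y = φ (put (a ℕ.+ (b ∸ a)) (b ∸ (b ∸ a)))

        monomial : ∀ c → linear ψ (∂ i ((c , α) ∷ [])) ≈ c * (φ α - φ (s i · α))
        monomial c = begin
          linear ψ (∂ i ((c , α) ∷ []))   ≈⟨ linear-+ ψ (D₁ ++ D₂) [] ⟩
          linear ψ (D₁ ++ D₂) + 0#        ≈⟨ +-identityʳ _ ⟩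
          linear ψ (D₁ ++ D₂)             ≈⟨ linear-+ ψ D₁ D₂ ⟩
          linear ψ D₁ + linear ψ D₂       ≈⟨ +-cong (down c) (up c) ⟩
          c * (φ (put a (b ℕ.+ 0)) - φ (put (a ∸ (a ∸ b)) (b ℕ.+ (a ∸ b))))
            + c * (φ (put (a ℕ.+ 0) b) - φ (put (a ℕ.+ (b ∸ a)) (b ∸ (b ∸ a))))
            ≈⟨ cases (ℕ.≤-total b a) ⟩
          c * (φ (put a b) - φ (put b a))
            ≈⟨ *-congˡ (+-cong (linear-≡ φ put-self) (-‿cong (linear-≡ φ put-swap))) ⟩
          c * (φ α - φ (s i · α))         ∎
          where
          D₁ D₂ : Poly n
          D₁ = applyUpTo (λ k →   c , put (a ∸ suc k) (b ℕ.+ k)) (a ∸ b)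
          D₂ = applyUpTo (λ k → - c , put (a ℕ.+ k) (b ∸ suc k)) (b ∸ a)

          diff : ∀ {u v u′ v′ w z w′ z′} → u ≡ w → v ≡ z → u′ ≡ w′ → v′ ≡ z′ →
            c * (φ (put u v) - φ (put u′ v′)) ≈ c * (φ (put w z) - φ (put w′ z′))
          diff ≡.refl ≡.refl ≡.refl ≡.refl = refl

          nil : ∀ x → c * (x - x) ≈ 0#
          nil x = trans (*-congˡ (-‿inverseʳ x)) (zeroʳ c)

          cases : b ℕ.≤ a ⊎ a ℕ.≤ b →
            c * (φ (put a (b ℕ.+ 0)) - φ (put (a ∸ (a ∸ b)) (b ℕ.+ (a ∸ b))))
              + c * (φ (put (a ℕ.+ 0) b) - φ (put (a ℕ.+ (b ∸ a)) (b ∸ (b ∸ a))))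
            ≈ c * (φ (put a b) - φ (put b a))
          cases (inj₁ b≤a) = trans (+-cong
            (diff ≡.refl (ℕ.+-identityʳ b) (ℕ.m∸[m∸n]≡n b≤a) (ℕ.m+[n∸m]≡n b≤a))
            (trans (diff (ℕ.+-identityʳ a) ≡.refl
                     (≡.trans (≡.cong (a ℕ.+_) b∸a≡0) (ℕ.+-identityʳ a)) (≡.cong (b ∸_) b∸a≡0))
              (nil (φ (put a b)))))
            (+-identityʳ _)
            where
            b∸a≡0 : b ∸ a ≡ 0
            b∸a≡0 = ℕ.m≤n⇒m∸n≡0 b≤a
          cases (inj₂ a≤b) = trans (+-cong
            (trans (diff ≡.refl (ℕ.+-identityʳ b)
                     (≡.cong (a ∸_) a∸b≡0) (≡.trans (≡.cong (b ℕ.+_) a∸b≡0) (ℕ.+-identityʳ b)))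
              (nil (φ (put a b))))
            (diff (ℕ.+-identityʳ a) ≡.refl (ℕ.m+[n∸m]≡n a≤b) (ℕ.m∸[m∸n]≡n a≤b)))
            (+-identityˡ _)
            where
            a∸b≡0 : a ∸ b ≡ 0
            a∸b≡0 = ℕ.m≤n⇒m∸n≡0 a≤b

      polynomial : ∀ f → linear ψ (∂ i f) ≈ linear φ f - linear φ (permute (s i) f)
      polynomial []            = sym (-‿inverseʳ 0#)
      polynomial ((c , α) ∷ f) = begin
        linear ψ (∂ i ((c , α) ∷ f))
          ≈⟨ linear-list-≡ (∂-∷ f) ⟩
        linear ψ (∂ i ((c , α) ∷ []) +ₚ ∂ i f)
          ≈⟨ linear-+ ψ (∂ i ((c , α) ∷ [])) (∂ i f) ⟩
        linear ψ (∂ i ((c , α) ∷ [])) + linear ψ (∂ i f)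
          ≈⟨ +-cong (monomial α c) (polynomial f) ⟩
        c * (φ α - φ (s i · α)) + (linear φ f - linear φ (permute (s i) f))
          ≈⟨ +-congʳ (x[y-z]≈xy-xz c _ _) ⟩
        (c * φ α - c * φ (s i · α)) + (linear φ f - linear φ (permute (s i) f))
          ≈⟨ interchange _ _ _ _ ⟩
        (c * φ α + linear φ f) + (- (c * φ (s i · α)) - linear φ (permute (s i) f))
          ≈⟨ +-congˡ (-‿+-comm _ _) ⟩
        (c * φ α + linear φ f) - (c * φ (s i · α) + linear φ (permute (s i) f)) ∎
        where
        linear-list-≡ : ∀ {p r} → p ≡ r → linear ψ p ≈ linear ψ r
        linear-list-≡ ≡.refl = refl
        ∂-∷ : ∀ f → ∂ i ((c , α) ∷ f) ≡ ∂ i ((c , α) ∷ []) ++ ∂ i f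
        ∂-∷ f = concatMap-++ _ ((c , α) ∷ []) f

  ∂-quotient : (i : Adjacent n) (f : Poly n) →
    (var (left i) -ₚ var (right i)) *ₚ ∂ i f ≈ₚ f -ₚ permute (s i) f
  ∂-quotient i f = linear-ext λ φ → let open Quotient i φ in begin
    linear φ ((var (left i) -ₚ var (right i)) *ₚ ∂ i f)
      ≈⟨ linear-* φ (var (left i) -ₚ var (right i)) (∂ i f) ⟩
    1# * linear (φ ∘ (e (left i) ⊕_)) (∂ i f) + (- 1# * linear (φ ∘ (e (right i) ⊕_)) (∂ i f) + 0#)
      ≈⟨ +-cong (*-identityˡ _) (trans (+-identityʳ _) (-1*x≈-x _)) ⟩
    linear (φ ∘ (e (left i) ⊕_)) (∂ i f) - linear (φ ∘ (e (right i) ⊕_)) (∂ i f)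
      ≈⟨ +-congˡ (neg-inside (φ ∘ (e (right i) ⊕_)) (∂ i f)) ⟩
    linear (φ ∘ (e (left i) ⊕_)) (∂ i f) + linear (λ β → - φ (e (right i) ⊕ β)) (∂ i f)
      ≈⟨ linear-+ˡ _ _ (∂ i f) ⟨
    linear ψ (∂ i f)
      ≈⟨ polynomial f ⟩
    linear φ f - linear φ (permute (s i) f)
      ≈⟨ linear-- φ f (permute (s i) f) ⟨
    linear φ (f -ₚ permute (s i) f) ∎
    where
    neg-inside : (χ : Vec ℕ _ → Carrier) → ∀ p → - linear χ p ≈ linear (λ β → - χ β) p
    neg-inside χ p = begin
      - linear χ p                    ≈⟨ -1*x≈-x _ ⟨
      - 1# * linear χ p               ≈⟨ linear-*ˡ (- 1#) χ p ⟨
      linear (λ β → - 1# * χ β) p     ≈⟨ linear-congˡ (λ β → -1*x≈-x (χ β)) p ⟩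
      linear (λ β → - χ β) p          ∎

ℚ[q,t] ℚ⟨q,t⟩ : IntegralDomain
ℚ[q,t] = PolynomialDomain.polynomialDomain ℚ-domain 2
ℚ⟨q,t⟩ = FieldOfFractions.fractionDomain ℚ[q,t]


K : CommutativeRing 0ℓ 0ℓ
K = IntegralDomain.commutativeRing ℚ⟨q,t⟩

open FieldOfFractions ℚ[q,t] using (Fraction; embed; embed-≄0; _⁻¹[_])

q t t⁻¹ : Fraction
q   = embed (Polynomial.var ℚ.+-*-commutativeRing Fin.zero)
t   = embed (Polynomial.var ℚ.+-*-commutativeRing (Fin.suc Fin.zero))
t⁻¹ = t ⁻¹[ embed-≄0 (PolynomialDomain.var≉0 ℚ-domain (Fin.suc Fin.zero)) ]

open CommutativeRing K using (_≈_; 0#; 1#; semiring) renaming (_*_ to _*ᴷ_)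
open import Algebra.Properties.Semiring.Exp semiring using (_^_)
open Polynomial K public using (Poly; _≈ₚ_; coeff; eval; δ)
open Hecke K t public using (Tʷ)

∣_∣ : Vec ℕ n → ℕ
∣ μ ∣ = Vec.sum μ

k : Vec ℕ n → Fin n → ℕ
k μ i = length (filter (λ j → (j Fin.<? i) ×-dec (lookup μ i ℕ.<? lookup μ j)) (allFin _))
  ℕ.+   length (filter (λ j → (i Fin.<? j) ×-dec (lookup μ i ℕ.≤? lookup μ j)) (allFin _))

-- spectral μ is the point μ̃ = (q^{μ_i} t^{-k_i(μ)})_i.
spectral : Vec ℕ n → Vec Fraction n
spectral μ = tabulate (λ i → q ^ lookup μ i *ᴷ t⁻¹ ^ k μ i)

DegreeAtMost : ℕ → Poly n → Set
DegreeAtMost d f = ∀ α → d ℕ.< ∣ α ∣ → coeff f α ≈ 0#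

record IsE* {n} (μ : Vec ℕ n) (E : Poly n) : Set where
  field
    degree    : DegreeAtMost ∣ μ ∣ E
    monic     : coeff E μ ≈ 1#
    vanishing : ∀ ν → ∣ ν ∣ ℕ.≤ ∣ μ ∣ → ν ≢ μ → eval E (spectral ν) ≈ 0#

IsPartition : Vec ℕ n → Set
IsPartition lam = ∀ i j → i Fin.≤ j → lookup lam j ℕ.≤ lookup lam i

infix 4 _∈S[_] _∉S[_]
_∈S[_] _∉S[_] : Vec ℕ n → Vec ℕ n → Set
μ ∈S[ lam ] = ∃[ σ ] σ · lam ≡ μ
μ ∉S[ lam ] = ¬ μ ∈S[ lam ]

-- The product s i₁ ∘ … ∘ s iₗ; note that ρ ∘ₚ σ applies ρ first.
⟦_⟧ : List (Adjacent n) → Permutation′ n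
⟦ []    ⟧ = Perm.id
⟦ i ∷ w ⟧ = ⟦ w ⟧ ∘ₚ s i

record IsReducedWord {n} (σ : Permutation′ n) (w : List (Adjacent n)) : Set where
  field
    represents : ⟦ w ⟧ Perm.≈ σ
    minimal    : ∀ v → ⟦ v ⟧ Perm.≈ σ → length w ℕ.≤ length v

-- The length of a permutation is the length of any of its reduced words.
record IsShortest {n} (lam μ : Vec ℕ n) (σ : Permutation′ n) : Set where
  field
    maps    : σ · lam ≡ μ
    minimal : ∀ τ → τ · lam ≡ μ →
              ∀ v w → IsReducedWord σ v → IsReducedWord τ w → length v ℕ.≤ length w

-- f*_μ = T_{σ_μ} E*_λ, for any choice of the objects E*_λ, σ_μ and reduced word
-- having their defining properties.
record IsF* {n} (lam μ : Vec ℕ n) (f : Poly n) : Set where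
  field
    E          : Poly n
    E-is-E*    : IsE* lam E
    σ          : Permutation′ n
    σ-shortest : IsShortest lam μ σ
    word       : List (Adjacent n)
    reduced    : IsReducedWord σ word
    f≈TE       : f ≈ₚ Tʷ word E

record Characterised {n} (lam μ : Vec ℕ n) (d : ℕ) (g : Poly n) : Set where
  field
    degree       : DegreeAtMost d g
    vanishing    : ∀ ν → ∣ ν ∣ ℕ.≤ ∣ μ ∣ → ν ∉S[ lam ] → eval g (spectral ν) ≈ 0#
    coefficients : ∀ τ → τ ∈S[ lam ] → coeff g τ ≈ δ τ μ

-- The points ν̃ with ν₁ = 0 lie on the hyperplane x₁ = t^{-(n-1)}, and if ν̃ = (x₁, …, xₙ)
-- with ν₁ > 0, then (x₂, …, xₙ, q⁻¹ x₁) is the spectral point of (ν₂, …, νₙ, ν₁ - 1). So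
-- restriction to the hyperplane and division by x₁ - t^{-(n-1)} show, by induction on n and the
-- degree, that a polynomial of degree at most d vanishing at all ν̃ with |ν| ≤ d is zero. The
-- same rotation, together with the operators T_i, constructs interpolation polynomials. Both
-- steps respect the affine Bruhat order ⊑ on compositions, so the top-degree part of E*_μ
-- involves only x^α with α ⊑ μ. Since a partition λ is ⊑-minimal among its rearrangements, the
-- coefficients of E*_λ on S_n(λ) are δ_λ; T_i maps the pattern δ_μ to δ_{s_i μ} when
-- μ_i > μ_{i+1}, and a reduced word of σ_μ consists of such steps. Uniqueness is the
-- unitriangularity of the E*_μ with respect to ⊑.

module Submission where

open import Algebra.Bundles using (CommutativeRing)
import Algebra.Properties.CommutativeSemigroup as CommutativeSemigroupProperties
import Algebra.Properties.Ring as RingProperties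
import Algebra.Properties.Semiring.Exp as Exp
import Algebra.Solver.Ring
import Algebra.Solver.Ring.AlmostCommutativeRing as ACR
open import Data.Bool.Base using (Bool; true; false; _∧_; if_then_else_)
open import Data.Fin.Base as Fin using (Fin; zero; suc; inject₁; toℕ)
import Data.Fin.Properties as Fin
open import Data.Fin.Permutation as Perm using (Permutation′; _⟨$⟩ˡ_; _⟨$⟩ʳ_; _∘ₚ_)
open import Data.Integer.Base as ℤ using (ℤ; +_; -[1+_]; _⊖_)
import Data.Integer.Properties as ℤ
open import Data.Maybe.Base using (Maybe; just; nothing)
open import Data.List.Base as List using (List; []; _∷_; _++_; length; filter; applyUpTo; upTo)
open import Data.List.Membership.Propositional using (_∈_; _∉_)
import Data.List.Membership.Propositional.Properties as ∈
import Data.List.Properties as List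
open import Data.List.Relation.Unary.All as All using (All; []; _∷_)
import Data.List.Relation.Unary.All.Properties as All
open import Data.List.Relation.Unary.Any using (here; there)
open import Data.Nat.Base as ℕ using (ℕ; zero; suc; _∸_; _⊔_; z≤n; s≤s; s≤s⁻¹; z<s)
open import Data.Nat.ListAction using () renaming (sum to sumᴸ)
import Data.Nat.Properties as ℕ
open import Data.Product.Base using (∃-syntax; _×_; _,_; proj₁; proj₂)
open import Data.Sum.Base using (_⊎_; inj₁; inj₂)
open import Data.Vec.Base as Vec using (Vec; []; _∷_; _∷ʳ_; lookup; tabulate; zipWith; replicate; _[_]≔_; init; last)
import Data.Vec.Properties as Vec
open import Function.Base using (_∘_; id)
open import Level using (0ℓ)
open import Relation.Binary.Definitions using (tri<; tri≈; tri>)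
open import Relation.Binary.PropositionalEquality as ≡ using (_≡_; _≢_; cong; cong₂; subst; module ≡-Reasoning)
import Relation.Binary.Reasoning.Setoid as SetoidReasoning
open import Relation.Nullary.Decidable using (Dec; yes; no; does; ¬?; _×-dec_; dec-true; dec-false)
open import Relation.Nullary.Negation using (¬_; contradiction)
open import Defs hiding (K; q; t; t⁻¹; Poly; _≈ₚ_; coeff; eval; δ; Tʷ; spectral)

-- Operators on polynomials are handled through their transposes: `linear φ` of the result is
-- rewritten as `linear` of other functionals on the argument. Taking φ = `δ α` yields coefficients
-- and φ = `monomialValue v` yields values, so that one identity serves both the coefficient and the
-- vanishing conditions.
--
-- Interpolants are kept only up to a nonzero scalar and are eliminated by cross-multiplication a p
-- - b r. No division occurs, and the argument runs over any decidable domain in which q and t are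
-- invertible and q^a t^x determines a.
--
-- Apart from x^α and its swap, T_i x^α has interior terms, whose exponents at i and i + 1 both lie
-- strictly below the larger of the two old ones. They are the obstacle to computing coefficients on
-- S_n(λ). By convexity some sum Σ (α_j - m)⁺ drops strictly at an interior term. Hence, if every
-- top-degree monomial of f is dominated by λ in these sums, no interior term falls into the orbit.
-- This domination survives every T_i, whereas a bound by κ in the finer order ⊑ may move up to s_i
-- κ.

private
  variable
    n : ℕ
    A B C : Set

open CommutativeSemigroupProperties ℕ.+-commutativeSemigroup using (x∙yz≈y∙xz; interchange)

-- Neighbouring entries

swap : Adjacent n → Vec A n → Vec A n
swap (pos zero)    (a ∷ b ∷ v) = b ∷ a ∷ v
swap (pos (suc i)) (a ∷ v@(_ ∷ _)) = a ∷ swap (pos i) v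

-- Two neighbouring entries `a b` become `u v` and the others stay. The relation is inductive in the
-- position, so that size and truncated sums can be compared by recursion on it.
data Related (R : ℕ → ℕ → ℕ → ℕ → Set) : Adjacent n → Vec ℕ n → Vec ℕ n → Set where
  here  : ∀ {a b u v} {α : Vec ℕ n} → R a b u v → Related R (pos zero) (a ∷ b ∷ α) (u ∷ v ∷ α)
  there : ∀ {a} {i : Fin n} {α β : Vec ℕ (suc n)} → Related R (pos i) α β → Related R (pos (suc i)) (a ∷ α) (a ∷ β)

module _ {A : Set} where
  lookup-swap-left : (i : Adjacent n) (v : Vec A n) → lookup (swap i v) (left i) ≡ lookup v (right i)
  lookup-swap-left (pos zero)    (a ∷ b ∷ v)     = ≡.refl
  lookup-swap-left (pos (suc i)) (a ∷ v@(_ ∷ _)) = lookup-swap-left (pos i) v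

  lookup-swap-right : (i : Adjacent n) (v : Vec A n) → lookup (swap i v) (right i) ≡ lookup v (left i)
  lookup-swap-right (pos zero)    (a ∷ b ∷ v)     = ≡.refl
  lookup-swap-right (pos (suc i)) (a ∷ v@(_ ∷ _)) = lookup-swap-right (pos i) v

  lookup-swap-other : (i : Adjacent n) (v : Vec A n) → ∀ {j} → j ≢ left i → j ≢ right i →
    lookup (swap i v) j ≡ lookup v j
  lookup-swap-other (pos zero)    (a ∷ b ∷ v) {zero}        j≢l j≢r = contradiction ≡.refl j≢l
  lookup-swap-other (pos zero)    (a ∷ b ∷ v) {suc zero}    j≢l j≢r = contradiction ≡.refl j≢r
  lookup-swap-other (pos zero)    (a ∷ b ∷ v) {suc (suc j)} j≢l j≢r = ≡.refl
  lookup-swap-other (pos (suc i)) (a ∷ v@(_ ∷ _)) {zero}  j≢l j≢r = ≡.refl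
  lookup-swap-other (pos (suc i)) (a ∷ v@(_ ∷ _)) {suc j} j≢l j≢r =
    lookup-swap-other (pos i) v (j≢l ∘ cong suc) (j≢r ∘ cong suc)

  swap-involutive : (i : Adjacent n) (v : Vec A n) → swap i (swap i v) ≡ v
  swap-involutive (pos zero)    (a ∷ b ∷ v)             = ≡.refl
  swap-involutive (pos (suc zero)) (a ∷ v@(_ ∷ _ ∷ _))  = ≡.refl
  swap-involutive (pos (suc i@(suc _))) (a ∷ v@(_ ∷ _ ∷ _)) = cong (a ∷_) (swap-involutive (pos i) v)

  swap-fixed : (i : Adjacent n) (v : Vec A n) → lookup v (left i) ≡ lookup v (right i) → swap i v ≡ v
  swap-fixed (pos zero)    (a ∷ b ∷ v)     ≡.refl = ≡.refl
  swap-fixed (pos (suc i)) (a ∷ v@(_ ∷ _)) eq     = cong (a ∷_) (swap-fixed (pos i) v eq)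

swap-zipWith : (f : A → B → C) (i : Adjacent n) (u : Vec A n) (v : Vec B n) →
  swap i (zipWith f u v) ≡ zipWith f (swap i u) (swap i v)
swap-zipWith f (pos zero)    (a ∷ b ∷ u)     (c ∷ d ∷ v)     = ≡.refl
swap-zipWith f (pos (suc i)) (a ∷ u@(_ ∷ _)) (c ∷ v@(_ ∷ _)) = cong (f a c ∷_) (swap-zipWith f (pos i) u v)

left≢right : (i : Adjacent n) → left i ≢ right i
left≢right (pos (suc i)) eq = left≢right (pos i) (Fin.suc-injective eq)

lookup-extensional : {u v : Vec A n} → (∀ j → lookup u j ≡ lookup v j) → u ≡ v
lookup-extensional {u = u} {v} eq =
  ≡.trans (≡.sym (Vec.tabulate∘lookup u)) (≡.trans (Vec.tabulate-cong eq) (Vec.tabulate∘lookup v))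

s-swap : (i : Adjacent n) (α : Vec ℕ n) → s i · α ≡ swap i α
s-swap i α = lookup-extensional λ j → ≡.trans (Vec.lookup∘tabulate _ j) (entry j)
  where
  entry : ∀ j → lookup α (s i ⟨$⟩ˡ j) ≡ lookup (swap i α) j
  entry j with j Fin.≟ right i
  ... | yes ≡.refl = ≡.sym (lookup-swap-right i α)
  ... | no j≢r with j Fin.≟ left i
  ...   | yes ≡.refl = ≡.sym (lookup-swap-left i α)
  ...   | no j≢l     = ≡.sym (lookup-swap-other i α j≢l j≢r)

related-update : ∀ {R u v} (i : Adjacent n) (α : Vec ℕ n) →
  R (lookup α (left i)) (lookup α (right i)) u v → Related R i α (α [ left i ]≔ u [ right i ]≔ v)
related-update (pos zero)    (a ∷ b ∷ α)     r = here r
related-update (pos (suc i)) (a ∷ α@(_ ∷ _)) r = there (related-update (pos i) α r)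

related-map : ∀ {R R′ : ℕ → ℕ → ℕ → ℕ → Set} {i : Adjacent n} {α β : Vec ℕ n} →
  (∀ {a b u v} → R a b u v → R′ a b u v) → Related R i α β → Related R′ i α β
related-map f (here r)  = here (f r)
related-map f (there r) = there (related-map f r)

related-entries : ∀ {R} {i : Adjacent n} {α β : Vec ℕ n} → Related R i α β →
  R (lookup α (left i)) (lookup α (right i)) (lookup β (left i)) (lookup β (right i))
related-entries (here r)  = r
related-entries (there r) = related-entries r

related-from-entries : ∀ {R R′} {i : Adjacent n} {α β : Vec ℕ n} → Related R i α β →
  R′ (lookup α (left i)) (lookup α (right i)) (lookup β (left i)) (lookup β (right i)) → Related R′ i α β
related-from-entries (here _)  r = here r
related-from-entries (there p) r = there (related-from-entries p r)

-- The exponent pairs that can occur in T_i x^a y^b: equal sum, and neither above the larger of `a`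
-- and `b`. `StrictlyWithin` keeps the interior pairs, leaving out `a b` and `b a`.
Within : ℕ → ℕ → ℕ → ℕ → Set
Within a b u v = u ℕ.+ v ≡ a ℕ.+ b × u ℕ.≤ a ⊔ b × v ℕ.≤ a ⊔ b

StrictlyWithin : ℕ → ℕ → ℕ → ℕ → Set
StrictlyWithin a b u v = u ℕ.+ v ≡ a ℕ.+ b × u ℕ.< a ⊔ b × v ℕ.< a ⊔ b

within-refl : ∀ a b → Within a b a b
within-refl a b = ≡.refl , ℕ.m≤m⊔n a b , ℕ.m≤n⊔m a b

within-swap : ∀ a b → Within a b b a
within-swap a b = ℕ.+-comm b a , ℕ.m≤n⊔m a b , ℕ.m≤m⊔n a b

related-refl : (i : Adjacent n) (α : Vec ℕ n) → Related Within i α α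
related-refl (pos zero)    (a ∷ b ∷ α)     = here (within-refl a b)
related-refl (pos (suc i)) (a ∷ α@(_ ∷ _)) = there (related-refl (pos i) α)

related-swap : (i : Adjacent n) (α : Vec ℕ n) → Related Within i α (swap i α)
related-swap (pos zero)    (a ∷ b ∷ α)     = here (within-swap a b)
related-swap (pos (suc i)) (a ∷ α@(_ ∷ _)) = there (related-swap (pos i) α)

-- x ↦ x ∸ m is convex.
within-∸ : ∀ {a b u v} → Within a b u v → ∀ m → (u ∸ m) ℕ.+ (v ∸ m) ℕ.≤ (a ∸ m) ℕ.+ (b ∸ m)
within-∸ {a} {b} {u} {v} (eq , u≤ , v≤) m with ℕ.≤-total u m | ℕ.≤-total v m
... | inj₁ u≤m | _ = begin
  (u ∸ m) ℕ.+ (v ∸ m)   ≡⟨ cong (ℕ._+ (v ∸ m)) (ℕ.m≤n⇒m∸n≡0 u≤m) ⟩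
  v ∸ m                 ≤⟨ ℕ.∸-monoˡ-≤ m v≤ ⟩
  (a ⊔ b) ∸ m           ≡⟨ ℕ.∸-distribʳ-⊔ m a b ⟩
  (a ∸ m) ⊔ (b ∸ m)     ≤⟨ ℕ.m⊔n≤m+n (a ∸ m) (b ∸ m) ⟩
  (a ∸ m) ℕ.+ (b ∸ m)   ∎
  where open ℕ.≤-Reasoning
... | inj₂ m≤u | inj₁ v≤m = begin
  (u ∸ m) ℕ.+ (v ∸ m)   ≡⟨ cong ((u ∸ m) ℕ.+_) (ℕ.m≤n⇒m∸n≡0 v≤m) ⟩
  (u ∸ m) ℕ.+ 0         ≡⟨ ℕ.+-identityʳ _ ⟩
  u ∸ m                 ≤⟨ ℕ.∸-monoˡ-≤ m u≤ ⟩
  (a ⊔ b) ∸ m           ≡⟨ ℕ.∸-distribʳ-⊔ m a b ⟩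
  (a ∸ m) ⊔ (b ∸ m)     ≤⟨ ℕ.m⊔n≤m+n (a ∸ m) (b ∸ m) ⟩
  (a ∸ m) ℕ.+ (b ∸ m)   ∎
  where open ℕ.≤-Reasoning
... | inj₂ m≤u | inj₂ m≤v = ℕ.+-cancelʳ-≤ (m ℕ.+ m) _ _ (begin
  (u ∸ m) ℕ.+ (v ∸ m) ℕ.+ (m ℕ.+ m)       ≡⟨ interchange (u ∸ m) (v ∸ m) m m ⟩
  ((u ∸ m) ℕ.+ m) ℕ.+ ((v ∸ m) ℕ.+ m)     ≡⟨ cong₂ ℕ._+_ (ℕ.m∸n+n≡m m≤u) (ℕ.m∸n+n≡m m≤v) ⟩
  u ℕ.+ v                                 ≡⟨ eq ⟩
  a ℕ.+ b                                 ≤⟨ ℕ.+-mono-≤ (ℕ.m≤n+m∸n a m) (ℕ.m≤n+m∸n b m) ⟩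
  (m ℕ.+ (a ∸ m)) ℕ.+ (m ℕ.+ (b ∸ m))     ≡⟨ cong₂ ℕ._+_ (ℕ.+-comm m _) (ℕ.+-comm m _) ⟩
  ((a ∸ m) ℕ.+ m) ℕ.+ ((b ∸ m) ℕ.+ m)     ≡⟨ interchange (a ∸ m) (b ∸ m) m m ⟨
  (a ∸ m) ℕ.+ (b ∸ m) ℕ.+ (m ℕ.+ m)       ∎)
  where
  open ℕ.≤-Reasoning

-- At the level m = u ⊔ v both summands on the left are truncated to zero, while the larger of `a`
-- and `b` still exceeds m.
strictlyWithin-∸ : ∀ {a b u v} → StrictlyWithin a b u v →
  ∃[ m ] (u ∸ m) ℕ.+ (v ∸ m) ℕ.< (a ∸ m) ℕ.+ (b ∸ m)
strictlyWithin-∸ {a} {b} {u} {v} (_ , u< , v<) = m , (begin-strict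
  (u ∸ m) ℕ.+ (v ∸ m)   ≡⟨ cong₂ ℕ._+_ (ℕ.m≤n⇒m∸n≡0 (ℕ.m≤m⊔n u v)) (ℕ.m≤n⇒m∸n≡0 (ℕ.m≤n⊔m u v)) ⟩
  0                     <⟨ ℕ.m<n⇒0<n∸m (ℕ.⊔-lub u< v<) ⟩
  (a ⊔ b) ∸ m           ≡⟨ ℕ.∸-distribʳ-⊔ m a b ⟩
  (a ∸ m) ⊔ (b ∸ m)     ≤⟨ ℕ.m⊔n≤m+n (a ∸ m) (b ∸ m) ⟩
  (a ∸ m) ℕ.+ (b ∸ m)   ∎)
  where
  open ℕ.≤-Reasoning
  m = u ⊔ v

∣swap∣ : (i : Adjacent n) (α : Vec ℕ n) → ∣ swap i α ∣ ≡ ∣ α ∣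
∣swap∣ (pos zero)    (a ∷ b ∷ α)     = x∙yz≈y∙xz b a ∣ α ∣
∣swap∣ (pos (suc i)) (a ∷ α@(_ ∷ _)) = cong (a ℕ.+_) (∣swap∣ (pos i) α)

∣related∣ : {i : Adjacent n} {α β : Vec ℕ n} → Related Within i α β → ∣ β ∣ ≡ ∣ α ∣
∣related∣ (here {a = a} {b} {u} {v} {α} (eq , _)) =
  ≡.trans (≡.sym (ℕ.+-assoc u v _)) (≡.trans (cong (ℕ._+ ∣ α ∣) eq) (ℕ.+-assoc a b _))
∣related∣ (there {a = a} r) = cong (a ℕ.+_) (∣related∣ r)

∣∷ʳ∣ : (α : Vec ℕ n) (a : ℕ) → ∣ α ∷ʳ a ∣ ≡ a ℕ.+ ∣ α ∣
∣∷ʳ∣ []      a = ≡.refl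
∣∷ʳ∣ (b ∷ α) a = ≡.trans (cong (b ℕ.+_) (∣∷ʳ∣ α a)) (x∙yz≈y∙xz b a ∣ α ∣)

-- The affine Bruhat order

-- S α m p = Σ_{i ≤ p} (α_i - m - 1)⁺ + Σ_{i > p} (α_i - m)⁺. These numbers are the
-- dimensions of the intersections of the lattice with exponents α with the standard
-- periodic flag, so that _⊑_ is the Bruhat order of the affine Grassmannian.
S : Vec ℕ n → ℕ → ℕ → ℕ
S []      m p       = 0
S (a ∷ α) m zero    = (a ∸ m) ℕ.+ S α m zero
S (a ∷ α) m (suc p) = (a ∸ suc m) ℕ.+ S α m p

infix 4 _⊑_ _≼_
-- For compositions of equal size, `≼` is the dominance order of their decreasing rearrangements:
-- the sums with p = 0 see only the multiset of entries.
_⊑_ _≼_ : Vec ℕ n → Vec ℕ n → Set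
_⊑_ {n} α β = ∀ m p → p ℕ.≤ n → S α m p ℕ.≤ S β m p
α ≼ β = ∀ m → S α m 0 ℕ.≤ S β m 0

S-00 : (α : Vec ℕ n) → S α 0 0 ≡ ∣ α ∣
S-00 []      = ≡.refl
S-00 (a ∷ α) = cong (a ℕ.+_) (S-00 α)

-- Periodicity of the flag: the last step of level m is the first step of the next level.
S-full : (α : Vec ℕ n) → ∀ m → S α m n ≡ S α (suc m) 0
S-full []      m = ≡.refl
S-full (a ∷ α) m = cong ((a ∸ suc m) ℕ.+_) (S-full α m)

-- The rotation of `suc a ∷ α` into `α ∷ʳ a` shifts the periodic flag by one step.
S-∷ʳ : (α : Vec ℕ n) → ∀ a m p → p ℕ.≤ n → S (α ∷ʳ a) m p ≡ S (suc a ∷ α) m (suc p)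
S-∷ʳ []      a m zero    _         = ≡.refl
S-∷ʳ (b ∷ α) a m zero    _         = ≡.trans (cong ((b ∸ m) ℕ.+_) (S-∷ʳ α a m zero z≤n)) (x∙yz≈y∙xz (b ∸ m) (a ∸ m) (S α m 0))
S-∷ʳ (b ∷ α) a m (suc p) (s≤s p≤n) =
  ≡.trans (cong ((b ∸ suc m) ℕ.+_) (S-∷ʳ α a m p p≤n)) (x∙yz≈y∙xz (b ∸ suc m) (a ∸ m) (S α m p))

⊑-rotate : (α β : Vec ℕ n) → ∀ a b → a ℕ.+ ∣ α ∣ ≡ b ℕ.+ ∣ β ∣ → α ∷ʳ a ⊑ β ∷ʳ b → suc a ∷ α ⊑ suc b ∷ β
⊑-rotate {n} α β a b eq α⊑β m (suc p) (s≤s p≤n) =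
  ≡.subst₂ ℕ._≤_ (S-∷ʳ α a m p p≤n) (S-∷ʳ β b m p p≤n) (α⊑β m p (ℕ.m≤n⇒m≤1+n p≤n))
-- The very first step has no predecessor in the flag. There S is the size, which is why equal sizes
-- are assumed.
⊑-rotate {n} α β a b eq α⊑β zero    zero _ =
  ℕ.≤-reflexive (≡.trans (S-00 (suc a ∷ α)) (≡.trans (cong suc eq) (≡.sym (S-00 (suc b ∷ β)))))
⊑-rotate {n} α β a b eq α⊑β (suc m) zero _ =
  ≡.subst₂ ℕ._≤_ (S-full (suc a ∷ α) m) (S-full (suc b ∷ β) m) (⊑-rotate α β a b eq α⊑β m (suc n) ℕ.≤-refl)

-- The only p for which S α m p distinguishes the entries at left i and right i.
split : Adjacent n → ℕ
split (pos i) = suc (toℕ i)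

S-related : ∀ {i : Adjacent n} {α β} → Related Within i α β → ∀ m p → p ≢ split i → S β m p ℕ.≤ S α m p
S-related (here {a = a} {b} {u} {v} {α} w) m zero p≢ = ≡.subst₂ ℕ._≤_ (ℕ.+-assoc (u ∸ m) _ _) (ℕ.+-assoc (a ∸ m) _ _)
  (ℕ.+-monoˡ-≤ (S α m 0) (within-∸ {a} {b} w m))
S-related (here w) m (suc zero) p≢ = contradiction ≡.refl p≢
S-related (here {a = a} {b} {u} {v} {α} w) m (suc (suc p)) p≢ =
  ≡.subst₂ ℕ._≤_ (ℕ.+-assoc (u ∸ suc m) _ _) (ℕ.+-assoc (a ∸ suc m) _ _)
  (ℕ.+-monoˡ-≤ (S α m p) (within-∸ {a} {b} w (suc m)))
S-related (there {a = a} r) m zero    p≢ = ℕ.+-monoʳ-≤ (a ∸ m) (S-related r m zero (λ ()))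
S-related (there {a = a} r) m (suc p) p≢ = ℕ.+-monoʳ-≤ (a ∸ suc m) (S-related r m p (p≢ ∘ cong suc))

S-strictlyRelated : ∀ {i : Adjacent n} {α β} → Related StrictlyWithin i α β → ∃[ m ] S β m 0 ℕ.< S α m 0
S-strictlyRelated (here {a = a} {b} {u} {v} {α} w) with strictlyWithin-∸ {a} {b} w
... | m , lt = m , ≡.subst₂ ℕ._<_ (ℕ.+-assoc (u ∸ m) _ _) (ℕ.+-assoc (a ∸ m) _ _) (ℕ.+-monoˡ-< (S α m 0) lt)
S-strictlyRelated (there {a = a} r) with S-strictlyRelated r
... | m , lt = m , ℕ.+-monoʳ-< (a ∸ m) lt

S-suc≤ : (α : Vec ℕ n) → ∀ m p → S α m (suc p) ℕ.≤ S α m p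
S-suc≤ []      m p       = z≤n
S-suc≤ (a ∷ α) m zero    = ℕ.+-monoˡ-≤ (S α m 0) (ℕ.∸-monoʳ-≤ a (ℕ.n≤1+n m))
S-suc≤ (a ∷ α) m (suc p) = ℕ.+-monoʳ-≤ (a ∸ suc m) (S-suc≤ α m p)

m∸n≤1+m∸1+n : ∀ a m → a ∸ m ℕ.≤ suc (a ∸ suc m)
m∸n≤1+m∸1+n zero    m       = ℕ.≤-trans (ℕ.≤-reflexive (ℕ.0∸n≡0 m)) z≤n
m∸n≤1+m∸1+n (suc a) zero    = ℕ.≤-refl
m∸n≤1+m∸1+n (suc a) (suc m) = m∸n≤1+m∸1+n a m

S≤1+S-suc : (α : Vec ℕ n) → ∀ m p → S α m p ℕ.≤ suc (S α m (suc p))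
S≤1+S-suc []      m p       = z≤n
S≤1+S-suc (a ∷ α) m zero    = ℕ.+-monoˡ-≤ (S α m 0) (m∸n≤1+m∸1+n a m)
S≤1+S-suc (a ∷ α) m (suc p) =
  ≡.subst ((a ∸ suc m) ℕ.+ S α m p ℕ.≤_) (ℕ.+-suc (a ∸ suc m) _) (ℕ.+-monoʳ-≤ (a ∸ suc m) (S≤1+S-suc α m p))

-- Let a < b be the two entries. Either a ≤ m, and raising the truncation level of a changes
-- nothing, or m < b, and raising that of b lowers the sum by one. So the value at `split i` is
-- controlled by a neighbouring step.
S-ascent : (i : Adjacent n) (μ : Vec ℕ n) → lookup μ (left i) ℕ.< lookup μ (right i) → ∀ m →
  S μ m (ℕ.pred (split i)) ℕ.≤ S μ m (split i) ⊎ suc (S μ m (suc (split i))) ℕ.≤ S μ m (split i)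
S-ascent (pos zero) (a ∷ b ∷ μ) a<b m with ℕ.≤-total a m
... | inj₁ a≤m = inj₁ (ℕ.+-monoˡ-≤ ((b ∸ m) ℕ.+ S μ m 0)
                   (≡.subst (ℕ._≤ (a ∸ suc m)) (≡.sym (ℕ.m≤n⇒m∸n≡0 a≤m)) z≤n))
... | inj₂ m≤a = inj₂ (begin
  suc ((a ∸ suc m) ℕ.+ ((b ∸ suc m) ℕ.+ S μ m 0)) ≡⟨ ℕ.+-suc (a ∸ suc m) _ ⟨
  (a ∸ suc m) ℕ.+ (suc (b ∸ suc m) ℕ.+ S μ m 0)   ≡⟨ cong (λ x → (a ∸ suc m) ℕ.+ (x ℕ.+ S μ m 0)) (ℕ.+-∸-assoc 1 (ℕ.≤-<-trans m≤a a<b)) ⟨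
  (a ∸ suc m) ℕ.+ ((b ∸ m) ℕ.+ S μ m 0) ∎)
  where open ℕ.≤-Reasoning
S-ascent (pos (suc zero)) (a ∷ μ@(_ ∷ _)) lt m with S-ascent (pos zero) μ lt m
... | inj₁ le = inj₁ (ℕ.+-monoʳ-≤ (a ∸ suc m) le)
... | inj₂ le = inj₂ (ℕ.≤-trans (ℕ.≤-reflexive (≡.sym (ℕ.+-suc (a ∸ suc m) _))) (ℕ.+-monoʳ-≤ (a ∸ suc m) le))
S-ascent (pos (suc i@(suc _))) (a ∷ μ@(_ ∷ _)) lt m with S-ascent (pos i) μ lt m
... | inj₁ le = inj₁ (ℕ.+-monoʳ-≤ (a ∸ suc m) le)
... | inj₂ le = inj₂ (ℕ.≤-trans (ℕ.≤-reflexive (≡.sym (ℕ.+-suc (a ∸ suc m) _))) (ℕ.+-monoʳ-≤ (a ∸ suc m) le))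

-- The lifting property of Bruhat order, for all exponents of T_i x^α instead of s_i α alone. Away
-- from `split i`, S does not distinguish κ from its swap and convexity suffices. At `split i`,
-- `S-ascent` leads to an adjacent step, and S β changes by at most one between adjacent steps.
⊑-lift : (i : Adjacent n) {α β κ : Vec ℕ n} → lookup κ (right i) ℕ.< lookup κ (left i) →
  α ⊑ κ → Related Within i α β → β ⊑ swap i κ
⊑-lift {n} i@(pos j) {α} {β} {κ} κ↓ α⊑κ r m p p≤n = cases (p ℕ.≟ split i)
  where
  away : ∀ p → p ≢ split i → p ℕ.≤ n → S β m p ℕ.≤ S (swap i κ) m p
  away p p≢ p≤n = ℕ.≤-trans (S-related r m p p≢) (ℕ.≤-trans (α⊑κ m p p≤n)
    (≡.subst (λ γ → S γ m p ℕ.≤ S (swap i κ) m p) (swap-involutive i κ)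
      (S-related (related-swap i (swap i κ)) m p p≢)))

  μ↑ : lookup (swap i κ) (left i) ℕ.< lookup (swap i κ) (right i)
  μ↑ = ≡.subst₂ ℕ._<_ (≡.sym (lookup-swap-left i κ)) (≡.sym (lookup-swap-right i κ)) κ↓

  cases : Dec (p ≡ split i) → S β m p ℕ.≤ S (swap i κ) m p
  cases (no p≢)      = away p p≢ p≤n
  cases (yes ≡.refl) with S-ascent i (swap i κ) μ↑ m
  ... | inj₁ le = ℕ.≤-trans (S-suc≤ β m (toℕ j))
                    (ℕ.≤-trans (away (toℕ j) (ℕ.<⇒≢ ℕ.≤-refl) (ℕ.<⇒≤ p≤n)) le)
  ... | inj₂ le = ℕ.≤-trans (S≤1+S-suc β m p)
                    (ℕ.≤-trans (s≤s (away (suc p) (ℕ.<⇒≢ ℕ.≤-refl ∘ ≡.sym) (s≤s (Fin.toℕ<n j)))) le)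

≼-related : ∀ {i : Adjacent n} {α β} → Related Within i α β → β ≼ α
≼-related {i = pos _} r m = S-related r m 0 (λ ())

S-swap-0 : (i : Adjacent n) (α : Vec ℕ n) → ∀ m → S (swap i α) m 0 ≡ S α m 0
S-swap-0 i α m = ℕ.≤-antisym (≼-related (related-swap i α) m)
  (≡.subst (λ γ → S γ m 0 ℕ.≤ S (swap i α) m 0) (swap-involutive i α) (≼-related (related-swap i (swap i α)) m))

-- A numerical linear extension of ⊑

sum< : (ℕ → ℕ) → ℕ → ℕ
sum< f zero    = 0
sum< f (suc N) = f 0 ℕ.+ sum< (f ∘ suc) N

sum<-mono : ∀ {f g} N → (∀ i → i ℕ.< N → f i ℕ.≤ g i) → sum< f N ℕ.≤ sum< g N
sum<-mono zero    f≤g = z≤n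
sum<-mono (suc N) f≤g = ℕ.+-mono-≤ (f≤g 0 z<s) (sum<-mono N (λ i i<N → f≤g (suc i) (s≤s i<N)))

sum<-tight : ∀ {f g} N → (∀ i → i ℕ.< N → f i ℕ.≤ g i) → sum< g N ℕ.≤ sum< f N →
  ∀ i → i ℕ.< N → f i ≡ g i
sum<-tight {f} {g} (suc N) f≤g Σg≤Σf zero _ = ℕ.≤-antisym (f≤g 0 z<s)
  (ℕ.+-cancelʳ-≤ (sum< (g ∘ suc) N) _ _ (ℕ.≤-trans Σg≤Σf
    (ℕ.+-monoʳ-≤ (f 0) (sum<-mono N (λ i i<N → f≤g (suc i) (s≤s i<N))))))
sum<-tight {f} {g} (suc N) f≤g Σg≤Σf (suc i) (s≤s i<N) =
  sum<-tight N (λ i i<N → f≤g (suc i) (s≤s i<N))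
    (ℕ.+-cancelˡ-≤ (g 0) _ _ (ℕ.≤-trans Σg≤Σf (ℕ.+-monoˡ-≤ _ (f≤g 0 z<s)))) i i<N

-- The drop of S from p = 0 to p = 1 is one exactly when the first entry exceeds m. The level m = a
-- therefore separates the heads a < b.
S-head : ∀ {a b} (α β : Vec ℕ n) → a ℕ.< b →
  S (a ∷ α) a 0 ≡ S (b ∷ β) a 0 → S (a ∷ α) a 1 ≢ S (b ∷ β) a 1
S-head {a = a} {b} α β a<b eq₀ eq₁ = ℕ.1+n≢n (ℕ.+-cancelʳ-≡ (S β a 0) _ _ (begin
  suc (b ∸ suc a) ℕ.+ S β a 0   ≡⟨ cong (ℕ._+ S β a 0) (ℕ.+-∸-assoc 1 a<b) ⟨
  (b ∸ a) ℕ.+ S β a 0           ≡⟨ eq₀ ⟨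
  (a ∸ a) ℕ.+ S α a 0           ≡⟨ cong (ℕ._+ S α a 0) (ℕ.n∸n≡0 a) ⟩
  S α a 0                       ≡⟨ cong (ℕ._+ S α a 0) (ℕ.m≤n⇒m∸n≡0 (ℕ.n≤1+n a)) ⟨
  (a ∸ suc a) ℕ.+ S α a 0       ≡⟨ eq₁ ⟩
  (b ∸ suc a) ℕ.+ S β a 0       ∎))
  where open ≡-Reasoning

S-injective : ∀ N (α β : Vec ℕ n) → ∣ α ∣ ℕ.≤ N → ∣ β ∣ ℕ.≤ N →
  (∀ m p → m ℕ.< N → p ℕ.≤ n → S α m p ≡ S β m p) → α ≡ β
S-injective N [] [] _ _ _ = ≡.refl
S-injective N (a ∷ α) (b ∷ β) α≤N β≤N eq with ℕ.<-cmp a b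
... | tri< a<b _ _ = contradiction (eq a 1 a<N (s≤s z≤n)) (S-head α β a<b (eq a 0 a<N z≤n))
  where a<N = ℕ.<-≤-trans a<b (ℕ.m+n≤o⇒m≤o b β≤N)
... | tri> _ _ b<a = contradiction (≡.sym (eq b 1 b<N (s≤s z≤n))) (S-head β α b<a (≡.sym (eq b 0 b<N z≤n)))
  where b<N = ℕ.<-≤-trans b<a (ℕ.m+n≤o⇒m≤o a α≤N)
... | tri≈ _ ≡.refl _ = cong (a ∷_) (S-injective N α β (ℕ.m+n≤o⇒n≤o a α≤N) (ℕ.m+n≤o⇒n≤o a β≤N)
        (λ m p m<N p≤n → ℕ.+-cancelˡ-≡ (a ∸ suc m) _ _ (eq m (suc p) m<N (s≤s p≤n))))

⊑-antisym : {α β : Vec ℕ n} → α ⊑ β → β ⊑ α → α ≡ β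
⊑-antisym {α = α} {β} α⊑β β⊑α = S-injective (∣ α ∣ ℕ.+ ∣ β ∣) α β (ℕ.m≤m+n _ _) (ℕ.m≤n+m _ _)
  (λ m p _ p≤n → ℕ.≤-antisym (α⊑β m p p≤n) (β⊑α m p p≤n))

-- The sum of all the statistics that define ⊑, hence strictly monotone for it. Levels below N
-- determine a composition of size at most N, by `S-injective`.
weight : ℕ → Vec ℕ n → ℕ
weight {n} N α = sum< (λ m → sum< (S α m) (suc n)) N

weight-strict : ∀ N {α β : Vec ℕ n} → ∣ α ∣ ℕ.≤ N → ∣ β ∣ ℕ.≤ N → α ⊑ β → α ≢ β → weight N α ℕ.< weight N β
weight-strict {n} N {α} {β} α≤N β≤N α⊑β α≢β = ℕ.≰⇒> λ le → α≢β (S-injective N α β α≤N β≤N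
  (λ m p m<N p≤n → sum<-tight (suc n) (λ i i<n → α⊑β m i (s≤s⁻¹ i<n))
    (ℕ.≤-reflexive (≡.sym (sum<-tight N (λ m _ → sum<-mono (suc n) (λ i i<n → α⊑β m i (s≤s⁻¹ i<n))) le m m<N)))
    p (s≤s p≤n)))

-- Minimality of partitions

S-bounded : (α : Vec ℕ n) → ∀ {a} → (∀ i → lookup α i ℕ.≤ a) → ∀ {m} → a ℕ.≤ m → ∀ p → S α m p ≡ 0
S-bounded []      α≤a a≤m p       = ≡.refl
S-bounded (b ∷ α) α≤a a≤m zero    = cong₂ ℕ._+_ (ℕ.m≤n⇒m∸n≡0 (ℕ.≤-trans (α≤a zero) a≤m)) (S-bounded α (α≤a ∘ suc) a≤m zero)
S-bounded (b ∷ α) α≤a a≤m (suc p) =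
  cong₂ ℕ._+_ (ℕ.m≤n⇒m∸n≡0 (ℕ.m≤n⇒m≤1+n (ℕ.≤-trans (α≤a zero) a≤m))) (S-bounded α (α≤a ∘ suc) a≤m p)

partition-tail : ∀ {a} {lam : Vec ℕ n} → IsPartition (a ∷ lam) → IsPartition lam
partition-tail part i j i≤j = part (suc i) (suc j) (s≤s i≤j)

1+[m∸1+n]≡m∸n : ∀ {a m} → m ℕ.< a → suc (a ∸ suc m) ≡ a ∸ m
1+[m∸1+n]≡m∸n m<a = ≡.sym (ℕ.+-∸-assoc 1 m<a)

-- Every composition satisfies the two lower bounds `S-lower₁` and `S-lower₂`, and a partition
-- attains one of them: if its first p entries exceed m, each step lowers S by one; otherwise all
-- entries after the first p are at most m and contribute nothing at either level.
S-partition : (lam : Vec ℕ n) → IsPartition lam → ∀ m p → p ℕ.≤ n →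
  S lam m p ℕ.+ p ℕ.≤ S lam m 0 ⊎ S lam m p ℕ.≤ S lam (suc m) 0
S-partition lam part m zero _ = inj₁ (ℕ.≤-reflexive (ℕ.+-identityʳ _))
S-partition (a ∷ lam) part m (suc p) (s≤s p≤n) with m ℕ.<? a
... | no m≮a = inj₂ (ℕ.≤-trans (ℕ.≤-reflexive (S-bounded (a ∷ lam) (λ i → part zero i z≤n) (ℕ.≮⇒≥ m≮a) (suc p))) z≤n)
... | yes m<a with S-partition lam (partition-tail part) m p p≤n
...   | inj₂ le = inj₂ (ℕ.+-monoʳ-≤ (a ∸ suc m) le)
...   | inj₁ le = inj₁ (begin
  (a ∸ suc m) ℕ.+ S lam m p ℕ.+ suc p     ≡⟨ ℕ.+-suc _ p ⟩
  suc ((a ∸ suc m) ℕ.+ S lam m p ℕ.+ p)   ≡⟨ cong suc (ℕ.+-assoc (a ∸ suc m) _ _) ⟩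
  suc (a ∸ suc m) ℕ.+ (S lam m p ℕ.+ p)   ≤⟨ ℕ.+-mono-≤ (ℕ.≤-reflexive (1+[m∸1+n]≡m∸n m<a)) le ⟩
  (a ∸ m) ℕ.+ S lam m 0                   ∎)
  where open ℕ.≤-Reasoning

S-lower₁ : (α : Vec ℕ n) → ∀ m p → S α m 0 ℕ.≤ S α m p ℕ.+ p
S-lower₁ []      m p       = z≤n
S-lower₁ (a ∷ α) m zero    = ℕ.≤-reflexive (≡.sym (ℕ.+-identityʳ _))
S-lower₁ (a ∷ α) m (suc p) = begin
  (a ∸ m) ℕ.+ S α m 0                   ≤⟨ ℕ.+-mono-≤ (m∸n≤1+m∸1+n a m) (S-lower₁ α m p) ⟩
  suc (a ∸ suc m) ℕ.+ (S α m p ℕ.+ p)   ≡⟨ cong suc (ℕ.+-assoc (a ∸ suc m) _ _) ⟨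
  suc ((a ∸ suc m) ℕ.+ S α m p ℕ.+ p)   ≡⟨ ℕ.+-suc _ p ⟨
  (a ∸ suc m) ℕ.+ S α m p ℕ.+ suc p     ∎
  where open ℕ.≤-Reasoning

S-lower₂ : (α : Vec ℕ n) → ∀ m p → S α (suc m) 0 ℕ.≤ S α m p
S-lower₂ []      m p       = z≤n
S-lower₂ (a ∷ α) m zero    = ℕ.+-mono-≤ (ℕ.∸-monoʳ-≤ a (ℕ.n≤1+n m)) (S-lower₂ α m zero)
S-lower₂ (a ∷ α) m (suc p) = ℕ.+-monoʳ-≤ (a ∸ suc m) (S-lower₂ α m p)

partition-⊑ : (lam α : Vec ℕ n) → IsPartition lam → (∀ m → S α m 0 ≡ S lam m 0) → lam ⊑ α
partition-⊑ lam α part eq m p p≤n with S-partition lam part m p p≤n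
... | inj₁ le = ℕ.+-cancelʳ-≤ p _ _ (ℕ.≤-trans le (ℕ.≤-trans (ℕ.≤-reflexive (≡.sym (eq m))) (S-lower₁ α m p)))
... | inj₂ le = ℕ.≤-trans le (ℕ.≤-trans (ℕ.≤-reflexive (≡.sym (eq (suc m)))) (S-lower₂ α m p))

-- Orbits under permutation

open import Algebra.Properties.CommutativeMonoid.Sum ℕ.+-0-commutativeMonoid using (sum; sum-permute; sum-cong-≗)

S-sum : (α : Vec ℕ n) → ∀ m → S α m 0 ≡ sum (λ i → lookup α i ∸ m)
S-sum []      m = ≡.refl
S-sum (a ∷ α) m = cong ((a ∸ m) ℕ.+_) (S-sum α m)

S-orbit : (lam : Vec ℕ n) {τ : Vec ℕ n} → τ ∈S[ lam ] → ∀ m → S τ m 0 ≡ S lam m 0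
S-orbit lam (σ , ≡.refl) m = begin
  S (σ · lam) m 0                      ≡⟨ S-sum (σ · lam) m ⟩
  sum (λ i → lookup (σ · lam) i ∸ m)   ≡⟨ sum-cong-≗ {x = λ i → lookup (σ · lam) i ∸ m} (λ i → cong (_∸ m) (Vec.lookup∘tabulate (λ j → lookup lam (σ ⟨$⟩ˡ j)) i)) ⟩
  sum (λ i → lookup lam (σ ⟨$⟩ˡ i) ∸ m) ≡⟨ sum-permute (λ i → lookup lam i ∸ m) (Perm.flip σ) ⟨
  sum (λ i → lookup lam i ∸ m)         ≡⟨ S-sum lam m ⟨
  S lam m 0                            ∎
  where open ≡-Reasoning

∣orbit∣ : (lam : Vec ℕ n) {τ : Vec ℕ n} → τ ∈S[ lam ] → ∣ τ ∣ ≡ ∣ lam ∣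
∣orbit∣ lam {τ} τ∈ = ≡.trans (≡.sym (S-00 τ)) (≡.trans (S-orbit lam τ∈ 0) (S-00 lam))

∘ₚ-· : (ρ σ : Permutation′ n) (α : Vec ℕ n) → (ρ ∘ₚ σ) · α ≡ σ · (ρ · α)
∘ₚ-· ρ σ α = Vec.tabulate-cong (λ i → ≡.sym (Vec.lookup∘tabulate _ (σ ⟨$⟩ˡ i)))

swap-orbit : (i : Adjacent n) {lam τ : Vec ℕ n} → τ ∈S[ lam ] → swap i τ ∈S[ lam ]
swap-orbit i {lam} (σ , ≡.refl) = σ ∘ₚ s i , ≡.trans (∘ₚ-· σ (s i) lam) (s-swap i (σ · lam))

swap-orbit⁻ : (i : Adjacent n) {lam τ : Vec ℕ n} → swap i τ ∈S[ lam ] → τ ∈S[ lam ]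
swap-orbit⁻ i {lam} {τ} sτ∈ = subst (_∈S[ lam ]) (swap-involutive i τ) (swap-orbit i {lam} sτ∈)

-- A finite superset of the compositions of size at most N, bounding each entry separately; only
-- `∈-box` matters.
box : ∀ n → ℕ → List (Vec ℕ n)
box zero    N = [] ∷ []
box (suc n) N = List.cartesianProductWith _∷_ (upTo (suc N)) (box n N)

∈-box : ∀ {N} (α : Vec ℕ n) → ∣ α ∣ ℕ.≤ N → α ∈ box n N
∈-box []      _   = here ≡.refl
∈-box (a ∷ α) α≤N = ∈.∈-cartesianProductWith⁺ _∷_ (∈.∈-upTo⁺ (s≤s (ℕ.m+n≤o⇒m≤o a α≤N))) (∈-box α (ℕ.m+n≤o⇒n≤o a α≤N))

∈⇒≤sum : ∀ {x xs} → x ∈ xs → x ℕ.≤ sumᴸ xs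
∈⇒≤sum {x} {y ∷ xs} (here ≡.refl) = ℕ.m≤m+n x (sumᴸ xs)
∈⇒≤sum {x} {y ∷ xs} (there x∈)    = ℕ.m≤n⇒m≤o+n y (∈⇒≤sum x∈)

-- The statistic k and inversions

ge : ℕ → ℕ → ℕ
ge a b = if does (a ℕ.≤? b) then 1 else 0

count : ℕ → Vec ℕ n → ℕ
count a []      = 0
count a (b ∷ ν) = ge a b ℕ.+ count a ν

ge-yes : ∀ {a b} → a ℕ.≤ b → ge a b ≡ 1
ge-yes {a} {b} a≤b rewrite dec-true (a ℕ.≤? b) a≤b = ≡.refl

ge-no : ∀ {a b} → b ℕ.< a → ge a b ≡ 0
ge-no {a} {b} b<a rewrite dec-false (a ℕ.≤? b) (ℕ.<⇒≱ b<a) = ≡.refl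

ge-strict : ∀ {a b} → a ≢ b → ge a b ≡ ge (suc a) b
ge-strict {a} {b} a≢b with ℕ.<-cmp a b
... | tri< a<b _ _ = ≡.trans (ge-yes (ℕ.<⇒≤ a<b)) (≡.sym (ge-yes a<b))
... | tri≈ _ a≡b _ = contradiction a≡b a≢b
... | tri> _ _ b<a = ≡.trans (ge-no b<a) (≡.sym (ge-no (ℕ.m≤n⇒m≤1+n b<a)))

ge-suc : ∀ a b → ge (suc a) (suc b) ≡ ge a b
ge-suc zero    b = ≡.refl
ge-suc (suc a) b = ≡.refl

count-swap : ∀ a (i : Adjacent n) (ν : Vec ℕ n) → count a (swap i ν) ≡ count a ν
count-swap a (pos zero)    (b ∷ c ∷ ν)     = x∙yz≈y∙xz (ge a c) (ge a b) (count a ν)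
count-swap a (pos (suc i)) (b ∷ ν@(_ ∷ _)) = cong (ge a b ℕ.+_) (count-swap a (pos i) ν)

count-∷ʳ : ∀ a (ν : Vec ℕ n) b → count a (ν ∷ʳ b) ≡ ge a b ℕ.+ count a ν
count-∷ʳ a []      b = ≡.refl
count-∷ʳ a (c ∷ ν) b = ≡.trans (cong (ge a c ℕ.+_) (count-∷ʳ a ν b)) (x∙yz≈y∙xz (ge a c) (ge a b) (count a ν))

count-0 : (ν : Vec ℕ n) → count 0 ν ≡ n
count-0 []      = ≡.refl
count-0 (b ∷ ν) = cong suc (count-0 ν)

-- The contribution of a leading entry a to the k-statistic of an entry b.
bump : ℕ → ℕ → ℕ → ℕ
bump a b x = ge (suc b) a ℕ.+ x

-- All values of `k` at once, as shown by `k-ks`. The recursive form makes the effect of swaps and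
-- rotations on spectral points computable.
ks : Vec ℕ n → Vec ℕ n
ks []      = []
ks (a ∷ ν) = count a ν ∷ zipWith (bump a) ν (ks ν)

countᶠ : (Fin n → Bool) → ℕ
countᶠ {zero}  f = 0
countᶠ {suc n} f = (if f zero then 1 else 0) ℕ.+ countᶠ (f ∘ suc)

length-filter-tabulate : ∀ {P : Fin n → Set} (P? : ∀ i → Dec (P i)) {m} (f : Fin m → Fin n) →
  length (filter P? (List.tabulate f)) ≡ countᶠ (does ∘ P? ∘ f)
length-filter-tabulate P? {zero}  f = ≡.refl
length-filter-tabulate P? {suc m} f with does (P? (f zero))
... | true  = cong suc (length-filter-tabulate P? (f ∘ suc))
... | false = length-filter-tabulate P? (f ∘ suc)

countᶠ-false : ∀ n → countᶠ {n} (λ _ → false) ≡ 0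
countᶠ-false zero    = ≡.refl
countᶠ-false (suc n) = countᶠ-false n

countᶠ-count : ∀ a (ν : Vec ℕ n) → countᶠ (λ j → does (a ℕ.≤? lookup ν j)) ≡ count a ν
countᶠ-count a []      = ≡.refl
countᶠ-count a (b ∷ ν) = cong (ge a b ℕ.+_) (countᶠ-count a ν)

k-countᶠ : (μ : Vec ℕ n) (i : Fin n) → k μ i ≡
  countᶠ (λ j → does (j Fin.<? i) ∧ does (lookup μ i ℕ.<? lookup μ j))
    ℕ.+ countᶠ (λ j → does (i Fin.<? j) ∧ does (lookup μ i ℕ.≤? lookup μ j))
k-countᶠ μ i = cong₂ ℕ._+_ (length-filter-tabulate (λ j → (j Fin.<? i) ×-dec (lookup μ i ℕ.<? lookup μ j)) id)
                           (length-filter-tabulate (λ j → (i Fin.<? j) ×-dec (lookup μ i ℕ.≤? lookup μ j)) id)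

k-ks : (μ : Vec ℕ n) (i : Fin n) → k μ i ≡ lookup (ks μ) i
k-ks {suc n} (a ∷ μ) zero = ≡.trans (k-countᶠ (a ∷ μ) zero)
  (cong₂ ℕ._+_ (countᶠ-false n) (countᶠ-count a μ))
k-ks (a ∷ μ) (suc i) = begin
  k (a ∷ μ) (suc i)                         ≡⟨ k-countᶠ (a ∷ μ) (suc i) ⟩
  (ge (suc b) a ℕ.+ before) ℕ.+ after       ≡⟨ ℕ.+-assoc (ge (suc b) a) before after ⟩
  ge (suc b) a ℕ.+ (before ℕ.+ after)       ≡⟨ cong (ge (suc b) a ℕ.+_) (k-countᶠ μ i) ⟨
  bump a b (k μ i)                          ≡⟨ cong (bump a b) (k-ks μ i) ⟩
  bump a b (lookup (ks μ) i)                ≡⟨ Vec.lookup-zipWith (bump a) i μ (ks μ) ⟨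
  lookup (zipWith (bump a) μ (ks μ)) i      ∎
  where
  open ≡-Reasoning
  b = lookup μ i
  before = countᶠ (λ j → does (j Fin.<? i) ∧ does (b ℕ.<? lookup μ j))
  after  = countᶠ (λ j → does (i Fin.<? j) ∧ does (b ℕ.≤? lookup μ j))

bump-comm : ∀ a b (μ : Vec ℕ n) κ →
  zipWith (bump a) μ (zipWith (bump b) μ κ) ≡ zipWith (bump b) μ (zipWith (bump a) μ κ)
bump-comm a b []      []      = ≡.refl
bump-comm a b (c ∷ μ) (x ∷ κ) = cong₂ _∷_ (x∙yz≈y∙xz (ge (suc c) a) (ge (suc c) b) x) (bump-comm a b μ κ)

zipWith-∷ʳ : (f : A → B → C) (u : Vec A n) (v : Vec B n) → ∀ a b →
  zipWith f (u ∷ʳ a) (v ∷ʳ b) ≡ zipWith f u v ∷ʳ f a b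
zipWith-∷ʳ f []      []      a b = ≡.refl
zipWith-∷ʳ f (x ∷ u) (y ∷ v) a b = cong (f x y ∷_) (zipWith-∷ʳ f u v a b)

-- The strict comparison to the left and the weak one to the right in `k` disagree only on ties.
ks-swap : (i : Adjacent n) (μ : Vec ℕ n) → lookup μ (left i) ≢ lookup μ (right i) → ks (swap i μ) ≡ swap i (ks μ)
ks-swap (pos zero) (a ∷ b ∷ μ) a≢b = cong₂ _∷_ (cong (ℕ._+ count b μ) (ge-strict (a≢b ∘ ≡.sym)))
  (cong₂ _∷_ (cong (ℕ._+ count a μ) (≡.sym (ge-strict a≢b))) (bump-comm b a μ (ks μ)))
ks-swap (pos (suc i)) (a ∷ μ@(_ ∷ _)) ≢ = cong₂ _∷_ (count-swap a (pos i) μ)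
  (≡.trans (cong (zipWith (bump a) (swap (pos i) μ)) (ks-swap (pos i) μ ≢)) (≡.sym (swap-zipWith (bump a) (pos i) μ (ks μ))))

-- Of two equal neighbours, the left one counts the right one but not conversely. At such a spectral
-- point t x_i = x_{i+1}, and T_i acts as the scalar t there.
ks-equal : (i : Adjacent n) (μ : Vec ℕ n) → lookup μ (left i) ≡ lookup μ (right i) →
  lookup (ks μ) (left i) ≡ suc (lookup (ks μ) (right i))
ks-equal (pos zero) (a ∷ b ∷ μ) ≡.refl = ≡.trans
  (cong (ℕ._+ count a μ) (ge-yes (ℕ.≤-refl {a})))
  (cong (λ x → suc (x ℕ.+ count a μ)) (≡.sym (ge-no (ℕ.n<1+n a))))
ks-equal (pos (suc i)) (a ∷ μ@(_ ∷ _)) eq = begin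
  lookup (zipWith (bump a) μ (ks μ)) l     ≡⟨ Vec.lookup-zipWith (bump a) l μ (ks μ) ⟩
  bump a (lookup μ l) (lookup (ks μ) l)    ≡⟨ cong₂ (bump a) eq (ks-equal (pos i) μ eq) ⟩
  bump a (lookup μ r) (suc (lookup (ks μ) r)) ≡⟨ ℕ.+-suc _ _ ⟩
  suc (bump a (lookup μ r) (lookup (ks μ) r)) ≡⟨ cong suc (Vec.lookup-zipWith (bump a) r μ (ks μ)) ⟨
  suc (lookup (zipWith (bump a) μ (ks μ)) r) ∎
  where
  open ≡-Reasoning
  l = left (pos i)
  r = right (pos i)

-- The right-hand side is the rotation of `ks (suc a ∷ ν)`: an entry b counts `suc a` in front when
-- b < suc a, and counts `a` at the end when b ≤ a, which is the same condition.
ks-∷ʳ : (ν : Vec ℕ n) → ∀ a → ks (ν ∷ʳ a) ≡ zipWith (bump (suc a)) ν (ks ν) ∷ʳ count (suc a) ν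
ks-∷ʳ []      a = ≡.refl
ks-∷ʳ (b ∷ ν) a = cong₂ _∷_ (≡.trans (count-∷ʳ b ν a) (cong (ℕ._+ count b ν) (≡.sym (ge-suc b a)))) (begin
  zipWith (bump b) (ν ∷ʳ a) (ks (ν ∷ʳ a))
    ≡⟨ cong (zipWith (bump b) (ν ∷ʳ a)) (ks-∷ʳ ν a) ⟩
  zipWith (bump b) (ν ∷ʳ a) (zipWith (bump (suc a)) ν (ks ν) ∷ʳ count (suc a) ν)
    ≡⟨ zipWith-∷ʳ (bump b) ν _ a _ ⟩
  zipWith (bump b) ν (zipWith (bump (suc a)) ν (ks ν)) ∷ʳ count (suc a) (b ∷ ν)
    ≡⟨ cong (_∷ʳ count (suc a) (b ∷ ν)) (bump-comm b (suc a) ν (ks ν)) ⟩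
  zipWith (bump (suc a)) ν (zipWith (bump b) ν (ks ν)) ∷ʳ count (suc a) (b ∷ ν) ∎)
  where open ≡-Reasoning

ks-0 : (ν : Vec ℕ n) → ks (0 ∷ ν) ≡ n ∷ ks ν
ks-0 {n} ν = cong₂ _∷_ (count-0 ν) (absorb ν (ks ν))
  where
  absorb : ∀ {m} (ν : Vec ℕ m) κ → zipWith (bump 0) ν κ ≡ κ
  absorb []      []      = ≡.refl
  absorb (b ∷ ν) (x ∷ κ) = cong (x ∷_) (absorb ν κ)

-- The number of pairs i < j with α_i < α_j, that is, inversions with respect to decreasing order.
-- By `inv-act` and `sort` it is the least number of adjacent swaps leading from the partition to α.
inv : Vec ℕ n → ℕ
inv []      = 0
inv (a ∷ α) = count (suc a) α ℕ.+ inv α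

inv-swap : (i : Adjacent n) (α : Vec ℕ n) → lookup α (right i) ℕ.< lookup α (left i) →
  inv (swap i α) ≡ suc (inv α)
inv-swap (pos zero) (a ∷ b ∷ α) b<a = begin
  (ge (suc b) a ℕ.+ count (suc b) α) ℕ.+ (count (suc a) α ℕ.+ inv α)
    ≡⟨ cong (λ x → (x ℕ.+ count (suc b) α) ℕ.+ (count (suc a) α ℕ.+ inv α)) (ge-yes b<a) ⟩
  suc (count (suc b) α ℕ.+ (count (suc a) α ℕ.+ inv α))
    ≡⟨ cong suc (x∙yz≈y∙xz (count (suc b) α) (count (suc a) α) (inv α)) ⟩
  suc (count (suc a) α ℕ.+ (count (suc b) α ℕ.+ inv α))
    ≡⟨ cong (λ x → suc ((x ℕ.+ count (suc a) α) ℕ.+ (count (suc b) α ℕ.+ inv α))) (ge-no (ℕ.m<n⇒m<1+n b<a)) ⟨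
  suc ((ge (suc a) b ℕ.+ count (suc a) α) ℕ.+ (count (suc b) α ℕ.+ inv α)) ∎
  where open ≡-Reasoning
inv-swap (pos (suc i)) (a ∷ α@(_ ∷ _)) lt =
  ≡.trans (cong₂ ℕ._+_ (count-swap (suc a) (pos i) α) (inv-swap (pos i) α lt)) (ℕ.+-suc (count (suc a) α) _)

inv-swap-ascent : (i : Adjacent n) (α : Vec ℕ n) → lookup α (left i) ℕ.< lookup α (right i) →
  inv α ≡ suc (inv (swap i α))
inv-swap-ascent i α lt = ≡.trans (cong inv (≡.sym (swap-involutive i α)))
  (inv-swap i (swap i α) (≡.subst₂ ℕ._<_ (≡.sym (lookup-swap-right i α)) (≡.sym (lookup-swap-left i α)) lt))

descent⇐inv : (i : Adjacent n) (α : Vec ℕ n) → inv α ℕ.< inv (swap i α) → lookup α (right i) ℕ.< lookup α (left i)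
descent⇐inv i α lt with ℕ.<-cmp (lookup α (left i)) (lookup α (right i))
... | tri> _ _ r<l = r<l
... | tri≈ _ l≡r _ = contradiction (cong inv (≡.sym (swap-fixed i α l≡r))) (ℕ.<⇒≢ lt)
... | tri< l<r _ _ = contradiction (ℕ.≤-reflexive (≡.sym (inv-swap-ascent i α l<r))) (ℕ.<⇒≱ (ℕ.m<n⇒m<1+n lt))

count-bounded : ∀ {a} (α : Vec ℕ n) → (∀ i → lookup α i ℕ.≤ a) → count (suc a) α ≡ 0
count-bounded []      _   = ≡.refl
count-bounded (b ∷ α) α≤a = cong₂ ℕ._+_ (ge-no (s≤s (α≤a zero))) (count-bounded α (α≤a ∘ suc))

inv-partition : (lam : Vec ℕ n) → IsPartition lam → inv lam ≡ 0
inv-partition []        part = ≡.refl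
inv-partition (a ∷ lam) part =
  cong₂ ℕ._+_ (count-bounded lam (λ i → part zero (suc i) z≤n)) (inv-partition lam (partition-tail part))

-- Words and shortest permutations

act : List (Adjacent n) → Vec ℕ n → Vec ℕ n
act []      α = α
act (i ∷ w) α = swap i (act w α)

⟦⟧-act : (w : List (Adjacent n)) (α : Vec ℕ n) → ⟦ w ⟧ · α ≡ act w α
⟦⟧-act []      α = Vec.tabulate∘lookup α
⟦⟧-act (i ∷ w) α = ≡.trans (∘ₚ-· ⟦ w ⟧ (s i) α) (≡.trans (s-swap i (⟦ w ⟧ · α)) (cong (swap i) (⟦⟧-act w α)))

-- Each letter raises `inv` by at most one, and only when it acts at a descent.
inv-act : (w : List (Adjacent n)) {lam : Vec ℕ n} → IsPartition lam → inv (act w lam) ℕ.≤ length w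
inv-act []      {lam} part = ℕ.≤-reflexive (inv-partition lam part)
inv-act (i ∷ w) {lam} part with inv (act w lam) ℕ.<? inv (swap i (act w lam))
... | no ≮  = ℕ.m≤n⇒m≤1+n (ℕ.≤-trans (ℕ.≮⇒≥ ≮) (inv-act w part))
... | yes < = ℕ.≤-trans (ℕ.≤-reflexive (inv-swap i (act w lam) (descent⇐inv i (act w lam) <))) (s≤s (inv-act w part))

ascent⊎partition : (μ : Vec ℕ n) → (∃[ i ] lookup μ (left i) ℕ.< lookup μ (right i)) ⊎ IsPartition μ
ascent⊎partition []           = inj₂ λ ()
ascent⊎partition (a ∷ [])     = inj₂ λ { zero zero _ → ℕ.≤-refl }
ascent⊎partition (a ∷ μ′@(b ∷ μ)) with a ℕ.<? b | ascent⊎partition μ′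
... | yes a<b | _                   = inj₁ (pos zero , a<b)
... | no _    | inj₁ (pos i , lt)   = inj₁ (pos (suc i) , lt)
... | no a≮b  | inj₂ part           = inj₂ λ
        { zero    zero    _         → ℕ.≤-refl
        ; zero    (suc j) _         → ℕ.≤-trans (part zero j z≤n) (ℕ.≮⇒≥ a≮b)
        ; (suc i) (suc j) (s≤s i≤j) → part i j i≤j
        }

-- Swapping at ascents lowers `inv` by one each time until a partition is reached. This partition is
-- `lam`, because two partitions with the same sums at p = 0 are ⊑-below each other. The hypothesis
-- is stated through these sums, which are invariant under swaps.
sort : ∀ l {lam μ : Vec ℕ n} → IsPartition lam → (∀ m → S μ m 0 ≡ S lam m 0) → inv μ ≡ l →
  ∃[ w ] act w lam ≡ μ × length w ≡ l
sort l {lam} {μ} part eq inv≡ with ascent⊎partition μ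
... | inj₂ μ-part = [] , ⊑-antisym (partition-⊑ lam μ part eq) (partition-⊑ μ lam μ-part (≡.sym ∘ eq))
                  , ≡.trans (≡.sym (inv-partition μ μ-part)) inv≡
... | inj₁ (i , lt) with l | ≡.trans (≡.sym inv≡) (inv-swap-ascent i μ lt)
...   | suc l′ | eq′ with sort l′ part (λ m → ≡.trans (S-swap-0 i μ m) (eq m)) (≡.sym (ℕ.suc-injective eq′))
...     | w , act≡ , len≡ = i ∷ w , ≡.trans (cong (swap i) act≡) (swap-involutive i μ) , cong suc len≡

-- `Perm._≈_` compares the forward maps, whereas the action reads the inverse ones.
≈-· : (ρ σ : Permutation′ n) → ρ Perm.≈ σ → (α : Vec ℕ n) → ρ · α ≡ σ · α
≈-· ρ σ ρ≈σ α = Vec.tabulate-cong (λ i → cong (lookup α) (begin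
  ρ ⟨$⟩ˡ i                       ≡⟨ cong (ρ ⟨$⟩ˡ_) (Perm.inverseʳ σ) ⟨
  ρ ⟨$⟩ˡ (σ ⟨$⟩ʳ (σ ⟨$⟩ˡ i))     ≡⟨ cong (ρ ⟨$⟩ˡ_) (ρ≈σ (σ ⟨$⟩ˡ i)) ⟨
  ρ ⟨$⟩ˡ (ρ ⟨$⟩ʳ (σ ⟨$⟩ˡ i))     ≡⟨ Perm.inverseˡ ρ ⟩
  σ ⟨$⟩ˡ i                       ∎))
  where open ≡-Reasoning

module _ {lam μ : Vec ℕ n} {σ : Permutation′ n} {w : List (Adjacent n)}
  (shortest : IsShortest lam μ σ) (reduced : IsReducedWord σ w) where

  private
    module σ = IsShortest shortest
    module w = IsReducedWord reduced

  act-shortest : act w lam ≡ μ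
  act-shortest = ≡.trans (≡.sym (⟦⟧-act w lam)) (≡.trans (≈-· ⟦ w ⟧ σ w.represents lam) σ.maps)

  -- A shortest word v leading to μ is reduced, so it can be compared with w.
  length-shortest : ∀ l v → length v ℕ.≤ l → act v lam ≡ μ → length w ℕ.≤ length v
  length-shortest l v v≤l act≡ with length w ℕ.≤? length v
  ... | yes w≤v = w≤v
  ... | no w≰v = σ.minimal ⟦ v ⟧ (≡.trans (⟦⟧-act v lam) act≡) w v reduced record
    { represents = λ _ → ≡.refl
    ; minimal    = λ u u≈v → ℕ.≮⇒≥ λ u<v → shorter l v≤l u u<v
                     (≡.trans (≡.sym (⟦⟧-act u lam)) (≡.trans (≈-· ⟦ u ⟧ ⟦ v ⟧ u≈v lam) (≡.trans (⟦⟧-act v lam) act≡)))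
    }
    where
    shorter : ∀ l → length v ℕ.≤ l → ∀ u → length u ℕ.< length v → act u lam ≢ μ
    shorter zero    v≤0 u u<v act≡ = contradiction (ℕ.<-≤-trans u<v v≤0) λ ()
    shorter (suc l) v≤l u u<v act≡ = w≰v (ℕ.≤-trans
      (length-shortest l u (s≤s⁻¹ (ℕ.≤-trans u<v v≤l)) act≡) (ℕ.<⇒≤ u<v))

  length≤inv : IsPartition lam → (∀ m → S μ m 0 ≡ S lam m 0) → length w ℕ.≤ inv μ
  length≤inv part eq with sort (inv μ) part eq ≡.refl
  ... | v , act≡ , len≡ = ℕ.≤-trans (length-shortest (length v) v ℕ.≤-refl act≡) (ℕ.≤-reflexive len≡)
-- Polynomials and Hecke operators as functionals

-- The library has ring solvers with coefficients in ℕ, which cannot cancel, or in the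
-- ring itself, which needs a computing equality; with coefficients in ℤ both work.
module IntegerSolver (R : CommutativeRing 0ℓ 0ℓ) where
  open CommutativeRing R hiding (zero)
  open RingProperties ring using (-‿involutive; -‿+-comm; -0#≈0#; -‿distribˡ-*; -‿distribʳ-*)
  open import Algebra.Properties.Semiring.Mult semiring using (×-homo-+; ×1-homo-*; ×-homo-1) renaming (_×_ to _×ᴿ_)
  open SetoidReasoning setoid

  ⟦_⟧ᶻ : ℤ → Carrier
  ⟦ + m      ⟧ᶻ = m ×ᴿ 1#
  ⟦ -[1+ m ] ⟧ᶻ = - (suc m ×ᴿ 1#)

  neg-homo : ∀ i → ⟦ ℤ.- i ⟧ᶻ ≈ - ⟦ i ⟧ᶻ
  neg-homo (+ zero)  = sym -0#≈0#
  neg-homo (+ suc m) = refl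
  neg-homo -[1+ m ]  = sym (-‿involutive _)

  ⊖-homo : ∀ m l → ⟦ m ⊖ l ⟧ᶻ ≈ m ×ᴿ 1# - l ×ᴿ 1#
  ⊖-homo m       zero    = sym (trans (+-congˡ -0#≈0#) (+-identityʳ _))
  ⊖-homo zero    (suc l) = sym (+-identityˡ _)
  ⊖-homo (suc m) (suc l) = begin
    ⟦ suc m ⊖ suc l ⟧ᶻ            ≡⟨ cong ⟦_⟧ᶻ (ℤ.[1+m]⊖[1+n]≡m⊖n m l) ⟩
    ⟦ m ⊖ l ⟧ᶻ                    ≈⟨ ⊖-homo m l ⟩
    x - y                         ≈⟨ +-identityˡ _ ⟨
    0# + (x - y)                  ≈⟨ +-congʳ (-‿inverseʳ 1#) ⟨
    (1# - 1#) + (x - y)           ≈⟨ medial 1# (- 1#) x (- y) ⟩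
    (1# + x) + (- 1# - y)         ≈⟨ +-congˡ (-‿+-comm 1# y) ⟩
    (1# + x) - (1# + y)           ∎
    where
    open CommutativeSemigroupProperties +-commutativeSemigroup using () renaming (interchange to medial)
    x = m ×ᴿ 1#
    y = l ×ᴿ 1#

  plus-homo : ∀ i j → ⟦ i ℤ.+ j ⟧ᶻ ≈ ⟦ i ⟧ᶻ + ⟦ j ⟧ᶻ
  plus-homo (+ m)    (+ l)    = ×-homo-+ 1# m l
  plus-homo (+ m)    -[1+ l ] = ⊖-homo m (suc l)
  plus-homo -[1+ m ] (+ l)    = trans (⊖-homo l (suc m)) (+-comm _ _)
  plus-homo -[1+ m ] -[1+ l ] = begin
    - (suc (suc (m ℕ.+ l)) ×ᴿ 1#)         ≡⟨ cong (λ x → - (suc x ×ᴿ 1#)) (ℕ.+-suc m l) ⟨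
    - ((suc m ℕ.+ suc l) ×ᴿ 1#)           ≈⟨ -‿cong (×-homo-+ 1# (suc m) (suc l)) ⟩
    - (suc m ×ᴿ 1# + suc l ×ᴿ 1#)         ≈⟨ -‿+-comm _ _ ⟨
    - (suc m ×ᴿ 1#) - suc l ×ᴿ 1#         ∎

  times-homo⁺ : ∀ m j → ⟦ + m ℤ.* j ⟧ᶻ ≈ ⟦ + m ⟧ᶻ * ⟦ j ⟧ᶻ
  times-homo⁺ m (+ l)    = trans (reflexive (cong ⟦_⟧ᶻ (≡.sym (ℤ.pos-* m l)))) (×1-homo-* m l)
  times-homo⁺ m -[1+ l ] = begin
    ⟦ + m ℤ.* (ℤ.- + suc l) ⟧ᶻ     ≡⟨ cong ⟦_⟧ᶻ (ℤ.neg-distribʳ-* (+ m) (+ suc l)) ⟨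
    ⟦ ℤ.- (+ m ℤ.* + suc l) ⟧ᶻ     ≈⟨ neg-homo (+ m ℤ.* + suc l) ⟩
    - ⟦ + m ℤ.* + suc l ⟧ᶻ         ≈⟨ -‿cong (times-homo⁺ m (+ suc l)) ⟩
    - (⟦ + m ⟧ᶻ * ⟦ + suc l ⟧ᶻ)    ≈⟨ -‿distribʳ-* _ _ ⟩
    ⟦ + m ⟧ᶻ * - ⟦ + suc l ⟧ᶻ      ∎

  times-homo : ∀ i j → ⟦ i ℤ.* j ⟧ᶻ ≈ ⟦ i ⟧ᶻ * ⟦ j ⟧ᶻ
  times-homo (+ m)    j = times-homo⁺ m j
  times-homo -[1+ m ] j = begin
    ⟦ (ℤ.- + suc m) ℤ.* j ⟧ᶻ       ≡⟨ cong ⟦_⟧ᶻ (ℤ.neg-distribˡ-* (+ suc m) j) ⟨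
    ⟦ ℤ.- (+ suc m ℤ.* j) ⟧ᶻ       ≈⟨ neg-homo (+ suc m ℤ.* j) ⟩
    - ⟦ + suc m ℤ.* j ⟧ᶻ           ≈⟨ -‿cong (times-homo⁺ (suc m) j) ⟩
    - (⟦ + suc m ⟧ᶻ * ⟦ j ⟧ᶻ)      ≈⟨ -‿distribˡ-* _ _ ⟩
    - ⟦ + suc m ⟧ᶻ * ⟦ j ⟧ᶻ        ∎

  _≟ᶻ_ : ∀ i j → Maybe (⟦ i ⟧ᶻ ≈ ⟦ j ⟧ᶻ)
  i ≟ᶻ j with i ℤ.≟ j
  ... | yes ≡.refl = just refl
  ... | no _       = nothing

  morphism : ℤ.+-*-rawRing ACR.-Raw-AlmostCommutative⟶ ACR.fromCommutativeRing R
  morphism = record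
    { ⟦_⟧    = ⟦_⟧ᶻ
    ; +-homo = plus-homo
    ; *-homo = times-homo
    ; -‿homo = neg-homo
    ; 0-homo = refl
    ; 1-homo = ×-homo-1 1#
    }

  open Algebra.Solver.Ring ℤ.+-*-rawRing (ACR.fromCommutativeRing R) morphism _≟ᶻ_ public

module PolynomialFunctionals (D : IntegralDomain) where
  open IntegralDomain D hiding (zero)
  open Polynomial commutativeRing
  open SetoidReasoning setoid

  0-product : ∀ {x y} → x * y ≈ 0# → ¬ x ≈ 0# → y ≈ 0#
  0-product {x} {y} xy≈0 x≉0 with y ≈? 0#
  ... | yes y≈0 = y≈0
  ... | no y≉0  = contradiction xy≈0 (xy≉0 x≉0 y≉0)

  δ-view : (α β : Vec ℕ n) → α ≡ β ⊎ δ α β ≈ 0#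
  δ-view α β with α ≟ᵉ β
  ... | yes α≡β = inj₁ α≡β
  ... | no _    = inj₂ refl

  δ-iff : ∀ {m} {α β : Vec ℕ n} {γ ε : Vec ℕ m} → (α ≡ β → γ ≡ ε) → (γ ≡ ε → α ≡ β) → δ α β ≈ δ γ ε
  δ-iff {α = α} {β} {γ} {ε} f g with α ≟ᵉ β | γ ≟ᵉ ε
  ... | yes _   | yes _   = refl
  ... | no _    | no _    = refl
  ... | yes α≡β | no γ≢ε  = contradiction (f α≡β) γ≢ε
  ... | no α≢β  | yes γ≡ε = contradiction (g γ≡ε) α≢β

  -- The terms of the list cannot be treated one by one, since repeated exponents may cancel.
  -- Weighing each term with the indicator χ of φ ≠ 0 does not change `linear φ`, and the weighed
  -- polynomial has only zero coefficients.
  linear-vanish : (φ : Vec ℕ n → Carrier) → ∀ p → (∀ α → φ α ≈ 0# ⊎ coeff p α ≈ 0#) → linear φ p ≈ 0#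
  linear-vanish {n} φ p φp≈0 = begin
    linear φ p                          ≈⟨ linear-congˡ supported p ⟨
    linear (λ α → χ α * φ α) p          ≈⟨ linear-weigh φ p ⟨
    linear φ (weigh p)                  ≈⟨ linear-coeff≈0 φ (weigh p) (λ α → trans (coeff-weigh α p) (χp≈0 α)) ⟩
    0#                                  ∎
    where
    χ : Vec ℕ n → Carrier
    χ α = if does (φ α ≈? 0#) then 0# else 1#

    supported : ∀ α → χ α * φ α ≈ φ α
    supported α with φ α ≈? 0#
    ... | yes φα≈0 = trans (zeroˡ _) (sym φα≈0)
    ... | no _     = *-identityˡ _

    weigh : Poly n → Poly n
    weigh = List.map (λ (c , α) → (c * χ α , α))

    linear-weigh : ∀ ψ p → linear ψ (weigh p) ≈ linear (λ α → χ α * ψ α) p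
    linear-weigh ψ []            = refl
    linear-weigh ψ ((c , α) ∷ p) = +-cong (*-assoc c (χ α) (ψ α)) (linear-weigh ψ p)

    coeff-weigh : ∀ α p → coeff (weigh p) α ≈ χ α * coeff p α
    coeff-weigh α p = trans (linear-weigh (δ α) p)
      (trans (linear-congˡ at-α p) (linear-*ˡ (χ α) (δ α) p))
      where
      at-α : ∀ β → χ β * δ α β ≈ χ α * δ α β
      at-α β with α ≟ᵉ β
      ... | yes ≡.refl = refl
      ... | no _       = trans (zeroʳ _) (sym (zeroʳ _))

    χp≈0 : ∀ α → χ α * coeff p α ≈ 0#
    χp≈0 α with φ α ≈? 0# | φp≈0 α
    ... | yes _   | _         = zeroˡ _
    ... | no φα≉0 | inj₁ φα≈0 = contradiction φα≈0 φα≉0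
    ... | no _    | inj₂ pα≈0 = trans (*-congˡ pα≈0) (zeroʳ _)

  linear-const : (φ : Vec ℕ n → Carrier) → ∀ c p → linear φ (const c *ₚ p) ≈ c * linear φ p
  linear-const φ c p = begin
    linear φ (const c *ₚ p)                           ≈⟨ linear-* φ (const c) p ⟩
    c * linear (λ β → φ (replicate _ 0 ⊕ β)) p + 0#   ≈⟨ +-identityʳ _ ⟩
    c * linear (λ β → φ (replicate _ 0 ⊕ β)) p        ≈⟨ *-congˡ (linear-congˡ (λ β → linear-≡ φ (⊕-identityˡ β)) p) ⟩
    c * linear φ p                                    ∎

  module _ (a : Carrier) (p : Poly n) (b : Carrier) (r : Poly n) where
    -- Elimination without division. Typically `a` and `b` are the values of `r` and `p` at one
    -- point, where the combination then vanishes.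
    combination : Poly n
    combination = const a *ₚ p -ₚ const b *ₚ r

    linear-combination : ∀ φ → linear φ combination ≈ a * linear φ p - b * linear φ r
    linear-combination φ = trans (linear-- φ (const a *ₚ p) (const b *ₚ r))
      (+-cong (linear-const φ a p) (-‿cong (linear-const φ b r)))

    combination-0 : ∀ φ → linear φ p ≈ 0# → linear φ r ≈ 0# → linear φ combination ≈ 0#
    combination-0 φ p≈0 r≈0 = begin
      linear φ combination               ≈⟨ linear-combination φ ⟩
      a * linear φ p - b * linear φ r    ≈⟨ +-cong (trans (*-congˡ p≈0) (zeroʳ a)) (-‿cong (trans (*-congˡ r≈0) (zeroʳ b))) ⟩
      0# - 0#                            ≈⟨ -‿inverseʳ 0# ⟩
      0#                                 ∎

    combination-0⁻ˡ : ∀ φ → ¬ a ≈ 0# → linear φ combination ≈ 0# → linear φ r ≈ 0# → linear φ p ≈ 0#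
    combination-0⁻ˡ φ a≉0 eq r≈0 = 0-product (begin
      a * linear φ p                     ≈⟨ x-y≈0⇒x≈y (trans (sym (linear-combination φ)) eq) ⟩
      b * linear φ r                     ≈⟨ trans (*-congˡ r≈0) (zeroʳ b) ⟩
      0#                                 ∎) a≉0

    combination-0⁻ʳ : ∀ φ → linear φ combination ≈ 0# → linear φ p ≈ 0# → b * linear φ r ≈ 0#
    combination-0⁻ʳ φ eq p≈0 = begin
      b * linear φ r                     ≈⟨ x-y≈0⇒x≈y (trans (sym (linear-combination φ)) eq) ⟨
      a * linear φ p                     ≈⟨ trans (*-congˡ p≈0) (zeroʳ a) ⟩
      0#                                 ∎

  raise : Fin n → Vec ℕ n → Vec ℕ n
  raise i α = α [ i ]≔ suc (lookup α i)

  unit-⊕ : (i : Fin n) (α : Vec ℕ n) → replicate _ 0 [ i ]≔ 1 ⊕ α ≡ raise i α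
  unit-⊕ zero    (a ∷ α) = cong (suc a ∷_) (⊕-identityˡ α)
  unit-⊕ (suc i) (a ∷ α) = cong (a ∷_) (unit-⊕ i α)

  linear-var : (φ : Vec ℕ n → Carrier) → ∀ i p → linear φ (var i *ₚ p) ≈ linear (φ ∘ raise i) p
  linear-var φ i p = begin
    linear φ (var i *ₚ p)                                     ≈⟨ linear-* φ (var i) p ⟩
    1# * linear (λ β → φ (replicate _ 0 [ i ]≔ 1 ⊕ β)) p + 0# ≈⟨ trans (+-identityʳ _) (*-identityˡ _) ⟩
    linear (λ β → φ (replicate _ 0 [ i ]≔ 1 ⊕ β)) p           ≈⟨ linear-congˡ (λ β → linear-≡ φ (unit-⊕ i β)) p ⟩
    linear (φ ∘ raise i) p                                    ∎

  monomialValue-raise : (v : Vec Carrier n) → ∀ i α → monomialValue v (raise i α) ≈ lookup v i * monomialValue v α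
  monomialValue-raise (x ∷ v) zero    (a ∷ α) = *-assoc _ _ _
  monomialValue-raise (x ∷ v) (suc i) (a ∷ α) =
    trans (*-congˡ (monomialValue-raise v i α)) (x∙yz≈y∙xz* _ _ _)
    where open CommutativeSemigroupProperties *-commutativeSemigroup using () renaming (x∙yz≈y∙xz to x∙yz≈y∙xz*)

  monomialValue-swap : (i : Adjacent n) (v : Vec Carrier n) → ∀ α →
    monomialValue v (swap i α) ≈ monomialValue (swap i v) α
  monomialValue-swap (pos zero)    (x ∷ y ∷ v)     (a ∷ b ∷ α)     = x∙yz≈y∙xz* _ _ _
    where open CommutativeSemigroupProperties *-commutativeSemigroup using () renaming (x∙yz≈y∙xz to x∙yz≈y∙xz*)
  monomialValue-swap (pos (suc i)) (x ∷ v@(_ ∷ _)) (a ∷ α@(_ ∷ _)) = *-congˡ (monomialValue-swap (pos i) v α)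

-- TermLeft describes the terms of x_i ∂_i x^α and TermRight those of x_{i+1} ∂_i x^α.
TermLeft TermRight : ℕ → ℕ → ℕ → ℕ → Set
TermLeft  a b u v = u ℕ.+ v ≡ a ℕ.+ b × u ℕ.≤ a ⊔ b × v ℕ.< a ⊔ b
TermRight a b u v = u ℕ.+ v ≡ a ℕ.+ b × u ℕ.< a ⊔ b × v ℕ.≤ a ⊔ b

module _ {a b k : ℕ} (k<a∸b : k ℕ.< a ∸ b) where
  private
    b+k<a : b ℕ.+ k ℕ.< a
    b+k<a = ℕ.<-≤-trans (ℕ.+-monoʳ-< b k<a∸b) (ℕ.≤-reflexive (ℕ.m+[n∸m]≡n b≤a))
      where
      b≤a : b ℕ.≤ a
      b≤a = ℕ.<⇒≤ (ℕ.m∸n≢0⇒n<m (λ eq → ℕ.n≮0 (subst (k ℕ.<_) eq k<a∸b)))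

    k<a : k ℕ.< a
    k<a = ℕ.≤-<-trans (ℕ.m≤n+m k b) b+k<a

    sum≡ : suc (a ∸ suc k) ℕ.+ (b ℕ.+ k) ≡ a ℕ.+ b
    sum≡ = begin
      suc (a ∸ suc k) ℕ.+ (b ℕ.+ k)   ≡⟨ cong (ℕ._+ (b ℕ.+ k)) (1+[m∸1+n]≡m∸n k<a) ⟩
      (a ∸ k) ℕ.+ (b ℕ.+ k)           ≡⟨ cong ((a ∸ k) ℕ.+_) (ℕ.+-comm b k) ⟩
      (a ∸ k) ℕ.+ (k ℕ.+ b)           ≡⟨ ℕ.+-assoc (a ∸ k) k b ⟨
      (a ∸ k) ℕ.+ k ℕ.+ b             ≡⟨ cong (ℕ._+ b) (ℕ.m∸n+n≡m (ℕ.<⇒≤ k<a)) ⟩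
      a ℕ.+ b                         ∎
      where open ≡-Reasoning

    u≤ : suc (a ∸ suc k) ℕ.≤ a ⊔ b
    u≤ = ℕ.≤-trans (ℕ.≤-reflexive (1+[m∸1+n]≡m∸n k<a)) (ℕ.≤-trans (ℕ.m∸n≤m a k) (ℕ.m≤m⊔n a b))

    v< : b ℕ.+ k ℕ.< a ⊔ b
    v< = ℕ.<-≤-trans b+k<a (ℕ.m≤m⊔n a b)

  termLeft-down : TermLeft a b (suc (a ∸ suc k)) (b ℕ.+ k)
  termLeft-down = sum≡ , u≤ , v<

  termRight-down : TermRight a b (a ∸ suc k) (suc (b ℕ.+ k))
  termRight-down = ≡.trans (ℕ.+-suc _ _) sum≡ , u≤ , v<

term-flip : ∀ a b {u v} → TermLeft b a v u → TermRight a b u v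
term-flip a b {u} {v} (eq , v≤ , u<) =
  ≡.trans (ℕ.+-comm u v) (≡.trans eq (ℕ.+-comm b a)) , subst (u ℕ.<_) (ℕ.⊔-comm b a) u< , subst (v ℕ.≤_) (ℕ.⊔-comm b a) v≤

term-flip′ : ∀ a b {u v} → TermRight b a v u → TermLeft a b u v
term-flip′ a b {u} {v} (eq , v< , u≤) =
  ≡.trans (ℕ.+-comm u v) (≡.trans eq (ℕ.+-comm b a)) , subst (u ℕ.≤_) (ℕ.⊔-comm b a) u≤ , subst (v ℕ.<_) (ℕ.⊔-comm b a) v<

module HeckeFunctionals (D : IntegralDomain) (t : IntegralDomain.Carrier D) where
  open IntegralDomain D hiding (zero)
  open Polynomial commutativeRing
  open Hecke commutativeRing t
  open PolynomialFunctionals D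
  open IntegerSolver commutativeRing using (solve; _:=_; _:+_; _:*_; _:-_; con)
  open SetoidReasoning setoid

  linear-permute : (i : Adjacent n) (φ : Vec ℕ n → Carrier) → ∀ f →
    linear φ (permute (s i) f) ≈ linear (φ ∘ swap i) f
  linear-permute i φ []            = refl
  linear-permute i φ ((c , α) ∷ f) = +-cong (*-congˡ (linear-≡ φ (s-swap i α))) (linear-permute i φ f)

  module _ (i : Adjacent n) (f : Poly n) where
    module _ (φ : Vec ℕ n → Carrier) where
      x∂ y∂ : Carrier
      x∂ = linear (φ ∘ raise (left i)) (∂ i f)
      y∂ = linear (φ ∘ raise (right i)) (∂ i f)

      x∂-y∂ : x∂ - y∂ ≈ linear φ f - linear (φ ∘ swap i) f
      x∂-y∂ = begin
        x∂ - y∂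
          ≈⟨ +-cong (linear-var φ (left i) (∂ i f)) (-‿cong (linear-var φ (right i) (∂ i f))) ⟨
        linear φ (var (left i) *ₚ ∂ i f) - linear φ (var (right i) *ₚ ∂ i f)
          ≈⟨ linear-difference-* φ (var (left i)) (var (right i)) ⟨
        linear φ ((var (left i) -ₚ var (right i)) *ₚ ∂ i f)
          ≈⟨ linear-cong φ (∂-quotient i f) ⟩
        linear φ (f -ₚ permute (s i) f)
          ≈⟨ linear-- φ f (permute (s i) f) ⟩
        linear φ f - linear φ (permute (s i) f)
          ≈⟨ +-congˡ (-‿cong (linear-permute i φ f)) ⟩
        linear φ f - linear (φ ∘ swap i) f ∎
        where
        linear-difference-* : ∀ φ p r → linear φ ((p -ₚ r) *ₚ ∂ i f) ≈ linear φ (p *ₚ ∂ i f) - linear φ (r *ₚ ∂ i f)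
        linear-difference-* φ p r = trans (linear-* φ (p -ₚ r) (∂ i f)) (trans (linear-- _ p r)
          (sym (+-cong (linear-* φ p (∂ i f)) (-‿cong (linear-* φ r (∂ i f))))))

      linear-T : linear φ (T i f) ≈ t * linear φ f - (t * x∂ - y∂)
      linear-T = begin
        linear φ (T i f)
          ≈⟨ linear-- φ (const t *ₚ f) _ ⟩
        linear φ (const t *ₚ f) - linear φ ((const t *ₚ var (left i) -ₚ var (right i)) *ₚ ∂ i f)
          ≈⟨ +-cong (linear-const φ t f) (-‿cong (begin
            linear φ ((const t *ₚ var (left i) -ₚ var (right i)) *ₚ ∂ i f)
              ≈⟨ linear-* φ (const t *ₚ var (left i) -ₚ var (right i)) (∂ i f) ⟩
            linear ψ (const t *ₚ var (left i) -ₚ var (right i))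
              ≈⟨ linear-- ψ (const t *ₚ var (left i)) (var (right i)) ⟩
            linear ψ (const t *ₚ var (left i)) - linear ψ (var (right i))
              ≈⟨ +-congʳ (linear-const ψ t (var (left i))) ⟩
            t * linear ψ (var (left i)) - linear ψ (var (right i))
              ≈⟨ +-cong (*-congˡ (on-var (left i))) (-‿cong (on-var (right i))) ⟩
            t * x∂ - y∂ ∎)) ⟩
        t * linear φ f - (t * x∂ - y∂) ∎
        where
        ψ : Vec ℕ n → Carrier
        ψ α = linear (λ β → φ (α ⊕ β)) (∂ i f)

        on-var : ∀ j → linear ψ (var j) ≈ linear (φ ∘ raise j) (∂ i f)
        on-var j = trans (sym (linear-* φ (var j) (∂ i f))) (linear-var φ j (∂ i f))

      private
        F F′ : Carrier
        F  = linear φ f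
        F′ = linear (φ ∘ swap i) f

        x∂≈ : x∂ ≈ y∂ + (F - F′)
        x∂≈ = trans (solve 2 (λ x y → x := y :+ (x :- y)) refl x∂ y∂) (+-congˡ x∂-y∂)

        y∂≈ : y∂ ≈ x∂ - (F - F′)
        y∂≈ = trans (solve 2 (λ x y → y := x :- (x :- y)) refl x∂ y∂) (+-congˡ (-‿cong x∂-y∂))

      -- T_i f = t s_i f + (1 - t) x_{i+1} ∂_i f, after eliminating x_i ∂_i f. No term of x_{i+1}
      -- ∂_i x^α has the larger exponent of α at position i, so this form suits target exponents
      -- with τ_i ≥ τ_{i+1}.
      linear-T-right : linear φ (T i f) ≈ t * F′ + (1# - t) * y∂
      linear-T-right = begin
        linear φ (T i f)                          ≈⟨ linear-T ⟩
        t * F - (t * x∂ - y∂)                     ≈⟨ +-congˡ (-‿cong (+-congʳ (*-congˡ x∂≈))) ⟩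
        t * F - (t * (y∂ + (F - F′)) - y∂)        ≈⟨ solve 4 (λ t F F′ y →
                                                       (t :* F :- (t :* (y :+ (F :- F′)) :- y)) :=
                                                       (t :* F′ :+ (con (+ 1) :- t) :* y)) refl t F F′ y∂ ⟩
        -- The solver reads the constant 1 as `1# + 0#`.
        t * F′ + (1# + 0# - t) * y∂               ≈⟨ +-congˡ (*-congʳ (+-congʳ (+-identityʳ 1#))) ⟩
        t * F′ + (1# - t) * y∂                    ∎

      -- The mirror form T_i f = (t - 1) f + s_i f + (1 - t) x_i ∂_i f, suited to τ_i < τ_{i+1}.
      linear-T-left : linear φ (T i f) ≈ (t - 1#) * F + F′ + (1# - t) * x∂
      linear-T-left = begin
        linear φ (T i f)                          ≈⟨ linear-T ⟩
        t * F - (t * x∂ - y∂)                     ≈⟨ +-congˡ (-‿cong (+-congˡ (-‿cong y∂≈))) ⟩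
        t * F - (t * x∂ - (x∂ - (F - F′)))        ≈⟨ solve 4 (λ t F F′ x →
                                                       (t :* F :- (t :* x :- (x :- (F :- F′)))) :=
                                                       ((t :- con (+ 1)) :* F :+ F′ :+ (con (+ 1) :- t) :* x)) refl t F F′ x∂ ⟩
        (t - (1# + 0#)) * F + F′ + (1# + 0# - t) * x∂
          ≈⟨ +-cong (+-congʳ (*-congʳ (+-congˡ (-‿cong (+-identityʳ 1#))))) (*-congʳ (+-congʳ (+-identityʳ 1#))) ⟩
        (t - 1#) * F + F′ + (1# - t) * x∂         ∎

  -- This exhibits the transpose of `∂ i`. With it `linear-vanish` applies, and only the exponents
  -- in the support of f have to be examined.
  linear-∂ : (i : Adjacent n) (χ : Vec ℕ n → Carrier) → ∀ f →
    linear χ (∂ i f) ≈ linear (λ α → linear χ (∂ i ((1# , α) ∷ []))) f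
  linear-∂ i χ []            = refl
  linear-∂ {n} i χ ((c , α) ∷ f) = begin
    linear χ ((down c ++ up c) ++ ∂ i f)            ≈⟨ linear-+ χ (down c ++ up c) (∂ i f) ⟩
    linear χ (down c ++ up c) + linear χ (∂ i f)    ≈⟨ +-cong scale (linear-∂ i χ f) ⟩
    c * linear χ (down 1# ++ up 1#) + _             ≈⟨ +-congʳ (*-congˡ (trans (sym (+-identityʳ _)) (sym (linear-+ χ (down 1# ++ up 1#) [])))) ⟩
    c * linear χ (∂ i ((1# , α) ∷ [])) + _          ∎
    where
    open RingProperties ring using (-1*x≈-x; -‿distribʳ-*)
    a b : ℕ
    a = lookup α (left i)
    b = lookup α (right i)

    down up : Carrier → Poly n
    down c = applyUpTo (λ k →   c , α [ left i ]≔ (a ∸ suc k) [ right i ]≔ (b ℕ.+ k)) (a ∸ b)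
    up   c = applyUpTo (λ k → - c , α [ left i ]≔ (a ℕ.+ k) [ right i ]≔ (b ∸ suc k)) (b ∸ a)

    multiple : ∀ {d e} (γ : ℕ → Vec ℕ n) m → e ≈ c * d →
      linear χ (applyUpTo (λ k → e , γ k) m) ≈ c * linear χ (applyUpTo (λ k → d , γ k) m)
    multiple γ zero    e≈cd = sym (zeroʳ c)
    multiple γ (suc m) e≈cd = trans
      (+-cong (trans (*-congʳ e≈cd) (*-assoc _ _ _)) (multiple (γ ∘ suc) m e≈cd))
      (sym (distribˡ c _ _))

    scale : linear χ (down c ++ up c) ≈ c * linear χ (down 1# ++ up 1#)
    scale = begin
      linear χ (down c ++ up c)                  ≈⟨ linear-+ χ (down c) (up c) ⟩
      linear χ (down c) + linear χ (up c)        ≈⟨ +-cong (multiple _ (a ∸ b) (sym (*-identityʳ c)))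
                                                      (multiple _ (b ∸ a) (trans (-‿cong (sym (*-identityʳ c))) (-‿distribʳ-* c 1#))) ⟩
      c * linear χ (down 1#) + c * linear χ (up 1#) ≈⟨ distribˡ c _ _ ⟨
      c * (linear χ (down 1#) + linear χ (up 1#))   ≈⟨ *-congˡ (linear-+ χ (down 1#) (up 1#)) ⟨
      c * linear χ (down 1# ++ up 1#)               ∎

  module _ (i : Adjacent n) (α : Vec ℕ n) where
    put : ℕ → ℕ → Vec ℕ n
    put u v = α [ left i ]≔ u [ right i ]≔ v

    raise-put-left : ∀ u v → raise (left i) (put u v) ≡ put (suc u) v
    raise-put-left u v = ≡.trans
      (cong (λ w → put u v [ left i ]≔ suc w)
        (≡.trans (Vec.lookup∘update′ (left≢right i) (α [ left i ]≔ u) v) (Vec.lookup∘update (left i) α u)))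
      (≡.trans (Vec.[]≔-commutes (α [ left i ]≔ u) (right i) (left i) (left≢right i ∘ ≡.sym))
        (cong (_[ right i ]≔ v) (Vec.[]≔-idempotent α (left i))))

    raise-put-right : ∀ u v → raise (right i) (put u v) ≡ put u (suc v)
    raise-put-right u v = ≡.trans
      (cong (λ w → put u v [ right i ]≔ suc w) (Vec.lookup∘update (right i) (α [ left i ]≔ u) v))
      (Vec.[]≔-idempotent (α [ left i ]≔ u) (right i))

    module _ (χ : Vec ℕ n → Carrier) where
      private
        a b : ℕ
        a = lookup α (left i)
        b = lookup α (right i)

        linear-put : ∀ {c} (u v : ℕ → ℕ) m → (∀ k → k ℕ.< m → χ (put (u k) (v k)) ≈ 0#) →
          linear χ (applyUpTo (λ k → c , put (u k) (v k)) m) ≈ 0#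
        linear-put u v m χ≈0 = linear-0 χ _ (All.applyUpTo⁺₁ _ m (λ {k} → χ≈0 k))

      linear-∂-monomial :
        (∀ k → k ℕ.< a ∸ b → χ (put (a ∸ suc k) (b ℕ.+ k)) ≈ 0#) →
        (∀ k → k ℕ.< b ∸ a → χ (put (a ℕ.+ k) (b ∸ suc k)) ≈ 0#) →
        linear χ (∂ i ((1# , α) ∷ [])) ≈ 0#
      linear-∂-monomial down up = begin
        linear χ ((D₁ ++ D₂) ++ [])         ≈⟨ linear-+ χ (D₁ ++ D₂) [] ⟩
        linear χ (D₁ ++ D₂) + 0#            ≈⟨ +-identityʳ _ ⟩
        linear χ (D₁ ++ D₂)                 ≈⟨ linear-+ χ D₁ D₂ ⟩
        linear χ D₁ + linear χ D₂           ≈⟨ +-cong (linear-put _ _ (a ∸ b) down) (linear-put _ _ (b ∸ a) up) ⟩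
        0# + 0#                             ≈⟨ +-identityʳ 0# ⟩
        0#                                  ∎
        where
        D₁ D₂ : Poly n
        D₁ = applyUpTo (λ k →   1# , put (a ∸ suc k) (b ℕ.+ k)) (a ∸ b)
        D₂ = applyUpTo (λ k → - 1# , put (a ℕ.+ k) (b ∸ suc k)) (b ∸ a)

  module _ (i : Adjacent n) (f : Poly n) (φ : Vec ℕ n → Carrier) where
    x∂≈0 : (∀ α β → Related TermLeft i α β → φ β ≈ 0# ⊎ coeff f α ≈ 0#) → x∂ i f φ ≈ 0#
    x∂≈0 h = trans (linear-∂ i (φ ∘ raise (left i)) f) (linear-vanish _ f monomial)
      where
      monomial : ∀ α → linear (φ ∘ raise (left i)) (∂ i ((1# , α) ∷ [])) ≈ 0# ⊎ coeff f α ≈ 0#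
      monomial α with coeff f α ≈? 0#
      ... | yes fα≈0 = inj₂ fα≈0
      ... | no fα≉0 = inj₁ (linear-∂-monomial i α (φ ∘ raise (left i))
              (λ k k< → term (termLeft-down k<)) (λ k k< → term (term-flip′ (lookup α (left i)) (lookup α (right i)) (termRight-down k<))))
        where
        term : ∀ {u v} → TermLeft (lookup α (left i)) (lookup α (right i)) (suc u) v →
          φ (raise (left i) (put i α u v)) ≈ 0#
        term {u} {v} r with h α _ (related-update i α r)
        ... | inj₁ φ≈0  = trans (linear-≡ φ (raise-put-left i α u v)) φ≈0
        ... | inj₂ fα≈0 = contradiction fα≈0 fα≉0

    y∂≈0 : (∀ α β → Related TermRight i α β → φ β ≈ 0# ⊎ coeff f α ≈ 0#) → y∂ i f φ ≈ 0#
    y∂≈0 h = trans (linear-∂ i (φ ∘ raise (right i)) f) (linear-vanish _ f monomial)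
      where
      monomial : ∀ α → linear (φ ∘ raise (right i)) (∂ i ((1# , α) ∷ [])) ≈ 0# ⊎ coeff f α ≈ 0#
      monomial α with coeff f α ≈? 0#
      ... | yes fα≈0 = inj₂ fα≈0
      ... | no fα≉0 = inj₁ (linear-∂-monomial i α (φ ∘ raise (right i))
              (λ k k< → term (termRight-down k<)) (λ k k< → term (term-flip (lookup α (left i)) (lookup α (right i)) (termLeft-down k<))))
        where
        term : ∀ {u v} → TermRight (lookup α (left i)) (lookup α (right i)) u (suc v) →
          φ (raise (right i) (put i α u v)) ≈ 0#
        term {u} {v} r with h α _ (related-update i α r)
        ... | inj₁ φ≈0  = trans (linear-≡ φ (raise-put-right i α u v)) φ≈0
        ... | inj₂ fα≈0 = contradiction fα≈0 fα≉0

  coeff-swap : (i : Adjacent n) (f : Poly n) (τ : Vec ℕ n) → linear (δ τ ∘ swap i) f ≈ coeff f (swap i τ)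
  coeff-swap i f τ = linear-congˡ (λ α → δ-iff
    (λ eq → ≡.trans (cong (swap i) eq) (swap-involutive i α))
    (λ eq → ≡.trans (≡.sym (swap-involutive i τ)) (cong (swap i) eq))) f

  module _ (i : Adjacent n) (f : Poly n) (τ : Vec ℕ n) where
    private
      at-τ : ∀ {R} → (∀ α → Related R i α τ → coeff f α ≈ 0#) →
        ∀ α β → Related R i α β → δ τ β ≈ 0# ⊎ coeff f α ≈ 0#
      at-τ h α β r with δ-view τ β
      ... | inj₁ ≡.refl = inj₂ (h α r)
      ... | inj₂ δ≈0    = inj₁ δ≈0

    -- The hypothesis excludes x^τ as an interior term of T_i x^α for α in the support of f. In
    -- `linear-T-right` the exponent at i stays below the maximum, and τ_{i+1} ≤ τ_i forces the
    -- other one below it too, so every contribution of x_{i+1} ∂_i f is interior and vanishes.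
    coeff-T-≥ : lookup τ (right i) ℕ.≤ lookup τ (left i) →
      (∀ α → Related StrictlyWithin i α τ → coeff f α ≈ 0#) →
      coeff (T i f) τ ≈ t * coeff f (swap i τ)
    coeff-T-≥ r≤l h = begin
      coeff (T i f) τ                                            ≈⟨ linear-T-right i f (δ τ) ⟩
      t * linear (δ τ ∘ swap i) f + (1# - t) * y∂ i f (δ τ)      ≈⟨ +-cong (*-congˡ (coeff-swap i f τ))
                                                                      (trans (*-congˡ (y∂≈0 i f (δ τ) (at-τ strict))) (zeroʳ _)) ⟩
      t * coeff f (swap i τ) + 0#                                ≈⟨ +-identityʳ _ ⟩
      t * coeff f (swap i τ)                                     ∎
      where
      strict : ∀ α → Related TermRight i α τ → coeff f α ≈ 0#
      strict α r with related-entries r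
      ... | eq , u< , v≤ = h α (related-from-entries r (eq , u< , ℕ.≤-<-trans r≤l u<))

    coeff-T-< : lookup τ (left i) ℕ.< lookup τ (right i) →
      (∀ α → Related StrictlyWithin i α τ → coeff f α ≈ 0#) →
      coeff (T i f) τ ≈ (t - 1#) * coeff f τ + coeff f (swap i τ)
    coeff-T-< l<r h = begin
      coeff (T i f) τ
        ≈⟨ linear-T-left i f (δ τ) ⟩
      (t - 1#) * coeff f τ + linear (δ τ ∘ swap i) f + (1# - t) * x∂ i f (δ τ)
        ≈⟨ +-cong (+-congˡ (coeff-swap i f τ)) (trans (*-congˡ (x∂≈0 i f (δ τ) (at-τ strict))) (zeroʳ _)) ⟩
      (t - 1#) * coeff f τ + coeff f (swap i τ) + 0#
        ≈⟨ +-identityʳ _ ⟩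
      (t - 1#) * coeff f τ + coeff f (swap i τ) ∎
      where
      strict : ∀ α → Related TermLeft i α τ → coeff f α ≈ 0#
      strict α r with related-entries r
      ... | eq , u≤ , v< = h α (related-from-entries r (eq , ℕ.<-trans l<r v< , v<))

    coeff-T-0 : (∀ α → Related Within i α τ → coeff f α ≈ 0#) → coeff (T i f) τ ≈ 0#
    coeff-T-0 h = begin
      coeff (T i f) τ                                            ≈⟨ linear-T-right i f (δ τ) ⟩
      t * linear (δ τ ∘ swap i) f + (1# - t) * y∂ i f (δ τ)      ≈⟨ +-cong
        (*-congˡ (trans (coeff-swap i f τ) (h (swap i τ)
          (subst (Related Within i (swap i τ)) (swap-involutive i τ) (related-swap i (swap i τ))))))
        (*-congˡ (y∂≈0 i f (δ τ) (at-τ (λ α r → h α (related-map (λ { (eq , u< , v≤) → eq , ℕ.<⇒≤ u< , v≤ }) r))))) ⟩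
      t * 0# + (1# - t) * 0#                                     ≈⟨ +-cong (zeroʳ _) (zeroʳ _) ⟩
      0# + 0#                                                    ≈⟨ +-identityʳ 0# ⟩
      0#                                                         ∎

  module _ (i : Adjacent n) (f : Poly n) (v : Vec Carrier n) where
    private
      x y d : Carrier
      x = lookup v (left i)
      y = lookup v (right i)
      d = eval (∂ i f) v

      φ : Vec ℕ n → Carrier
      φ = monomialValue v

      x∂≈xd : x∂ i f φ ≈ x * d
      x∂≈xd = trans (linear-congˡ (monomialValue-raise v (left i)) (∂ i f)) (linear-*ˡ x φ (∂ i f))

      y∂≈yd : y∂ i f φ ≈ y * d
      y∂≈yd = trans (linear-congˡ (monomialValue-raise v (right i)) (∂ i f)) (linear-*ˡ y φ (∂ i f))

      eval-T′ : eval (T i f) v ≈ t * eval f v - (t * (x * d) - y * d)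
      eval-T′ = trans (linear-T i f φ) (+-congˡ (-‿cong (+-cong (*-congˡ x∂≈xd) (-‿cong y∂≈yd))))

    eval-T-fixed : t * x ≈ y → eval (T i f) v ≈ t * eval f v
    eval-T-fixed tx≈y = begin
      eval (T i f) v                              ≈⟨ eval-T′ ⟩
      t * eval f v - (t * (x * d) - y * d)        ≈⟨ +-congˡ (-‿cong (+-congʳ (trans (sym (*-assoc t x d)) (*-congʳ tx≈y)))) ⟩
      t * eval f v - (y * d - y * d)              ≈⟨ solve 3 (λ F y d → (F :- (y :* d :- y :* d)) := F) refl (t * eval f v) y d ⟩
      t * eval f v                                ∎

    -- Multiplication by x - y trades the divided difference for values of f at v and at the swapped
    -- point.
    eval-T : (x - y) * eval (T i f) v ≈ (x - y) * (t * eval f v) - (t * x - y) * (eval f v - eval f (swap i v))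
    eval-T = begin
      (x - y) * eval (T i f) v
        ≈⟨ *-congˡ eval-T′ ⟩
      (x - y) * (t * F - (t * (x * d) - y * d))
        ≈⟨ solve 5 (λ t F x y d → ((x :- y) :* (t :* F :- (t :* (x :* d) :- y :* d)))
             := ((x :- y) :* (t :* F) :- (t :* x :- y) :* (x :* d :- y :* d))) refl t F x y d ⟩
      (x - y) * (t * F) - (t * x - y) * (x * d - y * d)
        ≈⟨ +-congˡ (-‿cong (*-congˡ (begin
             x * d - y * d                        ≈⟨ +-cong x∂≈xd (-‿cong y∂≈yd) ⟨
             x∂ i f φ - y∂ i f φ                  ≈⟨ x∂-y∂ i f φ ⟩
             F - linear (φ ∘ swap i) f            ≈⟨ +-congˡ (-‿cong (linear-congˡ (monomialValue-swap i v) f)) ⟩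
             F - eval f (swap i v)                ∎))) ⟩
      (x - y) * (t * F) - (t * x - y) * (F - eval f (swap i v)) ∎
      where
      F = eval f v

-- Restriction to x₁ = c, and division by x₁ - c combined with rotation

Inverse : (D : IntegralDomain) (x y : IntegralDomain.Carrier D) → Set
Inverse D x y = x * y ≈ 1#
  where open IntegralDomain D

module Division (D : IntegralDomain) (q q⁻¹ : IntegralDomain.Carrier D) (q⁻¹*q≈1 : Inverse D q⁻¹ q) where
  open IntegralDomain D hiding (zero)
  open Polynomial commutativeRing
  open PolynomialFunctionals D
  open Exp semiring using (_^_; ^-congʳ)
  open IntegerSolver commutativeRing using (solve; _:=_; _:+_; _:*_; _:-_; :-_)
  open SetoidReasoning setoid

  -- A strict bound, so that e = 0 leaves only the zero polynomial and can start the induction in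
  -- `nondegenerate`.
  DegreeBelow : ℕ → Poly n → Set
  DegreeBelow e f = ∀ α → e ℕ.≤ ∣ α ∣ → coeff f α ≈ 0#

  linear-difference : (φ ψ : Vec ℕ n → Carrier) → ∀ p → linear (λ α → φ α - ψ α) p ≈ linear φ p - linear ψ p
  linear-difference φ ψ []            = sym (-‿inverseʳ 0#)
  linear-difference φ ψ ((c , α) ∷ p) = trans (+-congˡ (linear-difference φ ψ p))
    (solve 5 (λ c x y u v → (c :* (x :- y) :+ (u :- v)) := ((c :* x :+ u) :- (c :* y :+ v)))
      refl c (φ α) (ψ α) (linear φ p) (linear ψ p))

  linear-agree : (φ ψ : Vec ℕ n → Carrier) → ∀ p → (∀ α → φ α ≈ ψ α ⊎ coeff p α ≈ 0#) → linear φ p ≈ linear ψ p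
  linear-agree φ ψ p agree = x-y≈0⇒x≈y (trans (sym (linear-difference φ ψ p)) (linear-vanish _ p vanish))
    where
    vanish : ∀ α → φ α - ψ α ≈ 0# ⊎ coeff p α ≈ 0#
    vanish α with agree α
    ... | inj₁ φ≈ψ = inj₁ (x≈y⇒x-y≈0 φ≈ψ)
    ... | inj₂ p≈0 = inj₂ p≈0

  δ-size : (α β : Vec ℕ n) → ∣ β ∣ ℕ.< ∣ α ∣ → δ α β ≈ 0#
  δ-size α β β<α = δ-≢ {α = α} {β} λ { ≡.refl → ℕ.<-irrefl ≡.refl β<α }

  restrict : Carrier → Poly (suc n) → Poly n
  restrict c = List.map λ { (d , a ∷ α) → d * c ^ a , α }

  restrictᵀ : Carrier → (Vec ℕ n → Carrier) → Vec ℕ (suc n) → Carrier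
  restrictᵀ c φ (a ∷ α) = c ^ a * φ α

  linear-restrict : ∀ c (φ : Vec ℕ n → Carrier) p → linear φ (restrict c p) ≈ linear (restrictᵀ c φ) p
  linear-restrict c φ []                = refl
  linear-restrict c φ ((d , a ∷ α) ∷ p) = +-cong (*-assoc d _ _) (linear-restrict c φ p)

  eval-restrict : ∀ c (p : Poly (suc n)) v → eval (restrict c p) v ≈ eval p (c ∷ v)
  eval-restrict c p v = trans (linear-restrict c (monomialValue v) p) (linear-congˡ (λ { (a ∷ α) → refl }) p)

  restrict-degree : ∀ {e} c (p : Poly (suc n)) → DegreeBelow e p → DegreeBelow e (restrict c p)
  restrict-degree c p deg β e≤β = trans (linear-restrict c (δ β) p) (linear-vanish _ p monomial)
    where
    monomial : ∀ α → restrictᵀ c (δ β) α ≈ 0# ⊎ coeff p α ≈ 0#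
    monomial (a ∷ α) with δ-view β α
    ... | inj₁ ≡.refl = inj₂ (deg (a ∷ α) (ℕ.m≤n⇒m≤o+n a e≤β))
    ... | inj₂ δ≈0    = inj₁ (trans (*-congˡ δ≈0) (zeroʳ _))

  -- If p vanishes for x₁ = c, then p = (x₁ - c) g(x₂, …, xₙ, q⁻¹ x₁) for g = divide c p,
  -- and multiply c is the inverse operation. The functions marked ᵀ are transposes.
  quotient : Carrier → Carrier → ℕ → Vec ℕ n → Poly (suc n)
  quotient c d zero    α = []
  quotient c d (suc a) α = (d * q ^ a , α ∷ʳ a) ∷ quotient c (d * c) a α

  divide : Carrier → Poly (suc n) → Poly (suc n)
  divide c []                = []
  divide c ((d , a ∷ α) ∷ p) = quotient c d a α ++ divide c p

  quotientᵀ : Carrier → (Vec ℕ (suc n) → Carrier) → ℕ → Vec ℕ n → Carrier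
  quotientᵀ c φ zero    α = 0#
  quotientᵀ c φ (suc a) α = q ^ a * φ (α ∷ʳ a) + c * quotientᵀ c φ a α

  divideᵀ : Carrier → (Vec ℕ (suc n) → Carrier) → Vec ℕ (suc n) → Carrier
  divideᵀ c φ (a ∷ α) = quotientᵀ c φ a α

  linear-quotient : ∀ c (φ : Vec ℕ (suc n) → Carrier) d a α → linear φ (quotient c d a α) ≈ d * quotientᵀ c φ a α
  linear-quotient c φ d zero    α = sym (zeroʳ d)
  linear-quotient c φ d (suc a) α = trans (+-congˡ (linear-quotient c φ (d * c) a α))
    (solve 5 (λ d x y c u → ((d :* x) :* y :+ (d :* c) :* u) := (d :* (x :* y :+ c :* u)))
      refl d (q ^ a) (φ (α ∷ʳ a)) c (quotientᵀ c φ a α))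

  linear-divide : ∀ c (φ : Vec ℕ (suc n) → Carrier) p → linear φ (divide c p) ≈ linear (divideᵀ c φ) p
  linear-divide c φ []                = refl
  linear-divide c φ ((d , a ∷ α) ∷ p) = trans (linear-+ φ (quotient c d a α) (divide c p))
    (+-cong (linear-quotient c φ d a α) (linear-divide c φ p))

  quotientᵀ-0 : ∀ c (φ : Vec ℕ (suc n) → Carrier) a α → (∀ b → b ℕ.< a → φ (α ∷ʳ b) ≈ 0#) → quotientᵀ c φ a α ≈ 0#
  quotientᵀ-0 c φ zero    α φ≈0 = refl
  quotientᵀ-0 c φ (suc a) α φ≈0 = begin
    q ^ a * φ (α ∷ʳ a) + c * quotientᵀ c φ a α
      ≈⟨ +-cong (*-congˡ (φ≈0 a ℕ.≤-refl)) (*-congˡ (quotientᵀ-0 c φ a α (λ b b<a → φ≈0 b (ℕ.m<n⇒m<1+n b<a)))) ⟩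
    q ^ a * 0# + c * 0#   ≈⟨ +-cong (zeroʳ _) (zeroʳ _) ⟩
    0# + 0#               ≈⟨ +-identityʳ 0# ⟩
    0#                    ∎

  divide-degree : ∀ {e} c (p : Poly (suc n)) → DegreeBelow (suc e) p → DegreeBelow e (divide c p)
  divide-degree {e = e} c p deg β e≤β = trans (linear-divide c (δ β) p) (linear-vanish _ p monomial)
    where
    monomial : ∀ α → divideᵀ c (δ β) α ≈ 0# ⊎ coeff p α ≈ 0#
    monomial (a ∷ α) with suc e ℕ.≤? ∣ a ∷ α ∣
    ... | yes e<α = inj₂ (deg (a ∷ α) e<α)
    ... | no e≮α  = inj₁ (quotientᵀ-0 c (δ β) a α (λ b b<a → δ-size β (α ∷ʳ b) (ℕ.≤-<-trans (ℕ.≤-reflexive (∣∷ʳ∣ α b))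
            (ℕ.<-≤-trans (ℕ.+-monoˡ-< ∣ α ∣ b<a) (ℕ.≤-trans (s≤s⁻¹ (ℕ.≰⇒> e≮α)) e≤β)))))

  unrotateᵀ : Carrier → (Vec ℕ (suc n) → Carrier) → ℕ → Vec ℕ n → Carrier
  unrotateᵀ c φ a α = q⁻¹ ^ a * (φ (suc a ∷ α) - c * φ (a ∷ α))

  multiplyᵀ : Carrier → (Vec ℕ (suc n) → Carrier) → Vec ℕ (suc n) → Carrier
  multiplyᵀ c φ β = unrotateᵀ c φ (last β) (init β)

  multiply : Carrier → Poly (suc n) → Poly (suc n)
  multiply c []            = []
  multiply c ((d , β) ∷ p) =
    (d * q⁻¹ ^ last β , suc (last β) ∷ init β) ∷ (- (d * q⁻¹ ^ last β * c) , last β ∷ init β) ∷ multiply c p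

  linear-multiply : ∀ c (φ : Vec ℕ (suc n) → Carrier) p → linear φ (multiply c p) ≈ linear (multiplyᵀ c φ) p
  linear-multiply c φ []            = refl
  linear-multiply c φ ((d , β) ∷ p) = trans (+-congˡ (+-congˡ (linear-multiply c φ p)))
    (solve 6 (λ d r c x y u → ((d :* r) :* x :+ (:- (d :* r :* c) :* y :+ u)) := (d :* (r :* (x :- c :* y)) :+ u))
      refl d (q⁻¹ ^ last β) c (φ (suc (last β) ∷ init β)) (φ (last β ∷ init β)) (linear (multiplyᵀ c φ) p))

  multiplyᵀ-∷ʳ : ∀ c (φ : Vec ℕ (suc n) → Carrier) α a → multiplyᵀ c φ (α ∷ʳ a) ≈ unrotateᵀ c φ a α
  multiplyᵀ-∷ʳ c φ α a = reflexive (cong₂ (unrotateᵀ c φ) (Vec.last-∷ʳ a α) (Vec.init-∷ʳ a α))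

  ^-inverse : ∀ {x y} → x * y ≈ 1# → ∀ a → x ^ a * y ^ a ≈ 1#
  ^-inverse xy≈1 zero    = *-identityˡ 1#
  ^-inverse {x} {y} xy≈1 (suc a) = begin
    x * x ^ a * (y * y ^ a)   ≈⟨ solve 4 (λ x u y v → (x :* u :* (y :* v)) := ((x :* y) :* (u :* v))) refl x (x ^ a) y (y ^ a) ⟩
    (x * y) * (x ^ a * y ^ a) ≈⟨ *-cong xy≈1 (^-inverse xy≈1 a) ⟩
    1# * 1#                   ≈⟨ *-identityˡ 1# ⟩
    1#                        ∎

  -- p = p(c, x₂, …, xₙ) + multiply c (divide c p)
  linear-multiply-divide : ∀ c (φ : Vec ℕ (suc n) → Carrier) p →
    linear (multiplyᵀ c φ) (divide c p) ≈ linear φ p - linear (φ ∘ (0 ∷_)) (restrict c p)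
  linear-multiply-divide {n} c φ p = begin
    linear (multiplyᵀ c φ) (divide c p)                ≈⟨ linear-divide c (multiplyᵀ c φ) p ⟩
    linear (divideᵀ c (multiplyᵀ c φ)) p               ≈⟨ linear-congˡ (λ { (a ∷ α) → telescope a α }) p ⟩
    linear (λ α → φ α - restrictᵀ c (φ ∘ (0 ∷_)) α) p  ≈⟨ linear-difference φ _ p ⟩
    linear φ p - linear (restrictᵀ c (φ ∘ (0 ∷_))) p   ≈⟨ +-congˡ (-‿cong (linear-restrict c (φ ∘ (0 ∷_)) p)) ⟨
    linear φ p - linear (φ ∘ (0 ∷_)) (restrict c p)    ∎
    where
    telescope : ∀ a (α : Vec ℕ n) → quotientᵀ c (multiplyᵀ c φ) a α ≈ φ (a ∷ α) - c ^ a * φ (0 ∷ α)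
    telescope zero    α = sym (trans (+-congˡ (-‿cong (*-identityˡ _))) (-‿inverseʳ _))
    telescope (suc a) α = begin
      q ^ a * multiplyᵀ c φ (α ∷ʳ a) + c * quotientᵀ c (multiplyᵀ c φ) a α
        ≈⟨ +-cong (*-congˡ (multiplyᵀ-∷ʳ c φ α a)) (*-congˡ (telescope a α)) ⟩
      q ^ a * (q⁻¹ ^ a * (x - c * y)) + c * (y - c ^ a * z)
        ≈⟨ +-congʳ (trans (sym (*-assoc _ _ _)) (trans (*-congʳ (^-inverse (trans (*-comm q q⁻¹) q⁻¹*q≈1) a)) (*-identityˡ _))) ⟩
      (x - c * y) + c * (y - c ^ a * z)
        ≈⟨ solve 5 (λ x c y w z → ((x :- c :* y) :+ c :* (y :- w :* z)) := (x :- (c :* w) :* z)) refl x c y (c ^ a) z ⟩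
      x - c * c ^ a * z ∎
      where
      x = φ (suc a ∷ α)
      y = φ (a ∷ α)
      z = φ (0 ∷ α)

  monomialValue-∷ʳ : ∀ (v : Vec Carrier n) y α a → monomialValue (v ∷ʳ y) (α ∷ʳ a) ≈ monomialValue v α * y ^ a
  monomialValue-∷ʳ []      y []      a = *-comm _ _
  monomialValue-∷ʳ (x ∷ v) y (b ∷ α) a = trans (*-congˡ (monomialValue-∷ʳ v y α a)) (sym (*-assoc _ _ _))

  multiplyᵀ-monomialValue : ∀ c {x y} (v : Vec Carrier n) → x ≈ q * y → ∀ β →
    multiplyᵀ c (monomialValue (x ∷ v)) β ≈ (x - c) * monomialValue (v ∷ʳ y) β
  multiplyᵀ-monomialValue c {x} {y} v x≈qy β with Vec.initLast β
  ... | α , a , ≡.refl = begin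
    q⁻¹ ^ a * (x * x ^ a * m - c * (x ^ a * m))
      ≈⟨ solve 5 (λ r x w m c → (r :* (x :* w :* m :- c :* (w :* m))) := ((x :- c) :* (m :* (r :* w))))
           refl (q⁻¹ ^ a) x (x ^ a) m c ⟩
    (x - c) * (m * (q⁻¹ ^ a * x ^ a))
      ≈⟨ *-congˡ (*-congˡ (shrink a)) ⟩
    (x - c) * (m * y ^ a)
      ≈⟨ *-congˡ (monomialValue-∷ʳ v y α a) ⟨
    (x - c) * monomialValue (v ∷ʳ y) (α ∷ʳ a) ∎
    where
    m = monomialValue v α

    shrink : ∀ a → q⁻¹ ^ a * x ^ a ≈ y ^ a
    shrink zero    = *-identityˡ 1#
    shrink (suc a) = begin
      q⁻¹ * q⁻¹ ^ a * (x * x ^ a)   ≈⟨ solve 4 (λ r s x w → (r :* s :* (x :* w)) := ((r :* x) :* (s :* w))) refl q⁻¹ (q⁻¹ ^ a) x (x ^ a) ⟩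
      (q⁻¹ * x) * (q⁻¹ ^ a * x ^ a) ≈⟨ *-cong (trans (*-congˡ x≈qy) (trans (sym (*-assoc _ _ _)) (trans (*-congʳ q⁻¹*q≈1) (*-identityˡ y)))) (shrink a) ⟩
      y * y ^ a                     ∎

  eval-multiply : ∀ c {x y} (v : Vec Carrier n) → x ≈ q * y → ∀ p →
    eval (multiply c p) (x ∷ v) ≈ (x - c) * eval p (v ∷ʳ y)
  eval-multiply c {x} {y} v x≈qy p = begin
    eval (multiply c p) (x ∷ v)                             ≈⟨ linear-multiply c _ p ⟩
    linear (multiplyᵀ c (monomialValue (x ∷ v))) p          ≈⟨ linear-congˡ (multiplyᵀ-monomialValue c v x≈qy) p ⟩
    linear (λ β → (x - c) * monomialValue (v ∷ʳ y) β) p     ≈⟨ linear-*ˡ (x - c) (monomialValue (v ∷ʳ y)) p ⟩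
    (x - c) * eval p (v ∷ʳ y)                               ∎

  eval-divide : ∀ c {x y} (v : Vec Carrier n) → x ≈ q * y → ∀ p →
    (x - c) * eval (divide c p) (v ∷ʳ y) ≈ eval p (x ∷ v) - eval (restrict c p) v
  eval-divide c {x} {y} v x≈qy p = begin
    (x - c) * eval (divide c p) (v ∷ʳ y)
      ≈⟨ linear-*ˡ (x - c) (monomialValue (v ∷ʳ y)) (divide c p) ⟨
    linear (λ β → (x - c) * monomialValue (v ∷ʳ y) β) (divide c p)
      ≈⟨ linear-congˡ (multiplyᵀ-monomialValue c v x≈qy) (divide c p) ⟨
    linear (multiplyᵀ c (monomialValue (x ∷ v))) (divide c p)
      ≈⟨ linear-multiply-divide c (monomialValue (x ∷ v)) p ⟩
    eval p (x ∷ v) - linear (monomialValue (x ∷ v) ∘ (0 ∷_)) (restrict c p)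
      ≈⟨ +-congˡ (-‿cong (linear-congˡ (λ α → *-identityˡ _) (restrict c p))) ⟩
    eval p (x ∷ v) - eval (restrict c p) v ∎

  module _ (c : Carrier) {d : ℕ} (p : Poly (suc n)) (deg : DegreeBelow (suc d) p) where
    private
      below : ∀ (α : Vec ℕ n) b → ¬ suc d ℕ.≤ ∣ α ∷ʳ b ∣ → ∣ b ∷ α ∣ ℕ.≤ d
      below α b ≮ = ℕ.≤-trans (ℕ.≤-reflexive (≡.sym (∣∷ʳ∣ α b))) (s≤s⁻¹ (ℕ.≰⇒> ≮))

      unrotateᵀ-0 : ∀ φ a (α : Vec ℕ n) → φ (suc a ∷ α) ≈ 0# → φ (a ∷ α) ≈ 0# → unrotateᵀ c φ a α ≈ 0#
      unrotateᵀ-0 φ a α e₁ e₂ = begin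
        q⁻¹ ^ a * (φ (suc a ∷ α) - c * φ (a ∷ α))   ≈⟨ *-congˡ (+-cong e₁ (-‿cong (*-congˡ e₂))) ⟩
        q⁻¹ ^ a * (0# - c * 0#)                     ≈⟨ *-congˡ (+-congˡ (-‿cong (zeroʳ c))) ⟩
        q⁻¹ ^ a * (0# - 0#)                         ≈⟨ *-congˡ (-‿inverseʳ 0#) ⟩
        q⁻¹ ^ a * 0#                                ≈⟨ zeroʳ _ ⟩
        0#                                          ∎

    multiply-degree : DegreeBelow (suc (suc d)) (multiply c p)
    multiply-degree α d<α = trans (linear-multiply c (δ α) p) (linear-vanish _ p monomial)
      where
      monomial : ∀ β → multiplyᵀ c (δ α) β ≈ 0# ⊎ coeff p β ≈ 0#
      monomial β with Vec.initLast β
      ... | γ , b , ≡.refl with suc d ℕ.≤? ∣ γ ∷ʳ b ∣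
      ...   | yes d<β = inj₂ (deg (γ ∷ʳ b) d<β)
      ...   | no d≮β  = inj₁ (unrotateᵀ-0 (δ α) b γ
                (δ-size α (suc b ∷ γ) (ℕ.≤-<-trans (s≤s (below γ b d≮β)) d<α))
                (δ-size α (b ∷ γ) (ℕ.≤-<-trans (ℕ.m≤n⇒m≤1+n (below γ b d≮β)) d<α)))

    -- In top degree `multiply c p` is x₁ p(x₂, ..., xₙ, q⁻¹ x₁), since the summand with factor c
    -- has lower degree. So every top monomial contains x₁, and `coeff-multiply-suc` sees a rotation
    -- of exponents with a power of q⁻¹ from the substitution.
    coeff-multiply-0 : ∀ α → ∣ 0 ∷ α ∣ ≡ suc d → coeff (multiply c p) (0 ∷ α) ≈ 0#
    coeff-multiply-0 α α≡d = trans (linear-multiply c (δ (0 ∷ α)) p) (linear-vanish _ p monomial)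
      where
      monomial : ∀ β → multiplyᵀ c (δ (0 ∷ α)) β ≈ 0# ⊎ coeff p β ≈ 0#
      monomial β with Vec.initLast β
      ... | γ , b , ≡.refl with suc d ℕ.≤? ∣ γ ∷ʳ b ∣
      ...   | yes d<β = inj₂ (deg (γ ∷ʳ b) d<β)
      ...   | no d≮β  = inj₁ (unrotateᵀ-0 (δ (0 ∷ α)) b γ (δ-≢ {α = 0 ∷ α} {suc b ∷ γ} λ ())
                (δ-size (0 ∷ α) (b ∷ γ) (subst (_ ℕ.<_) (≡.sym α≡d) (s≤s (below γ b d≮β)))))

    coeff-multiply-suc : ∀ a α → ∣ a ∷ α ∣ ≡ d → coeff (multiply c p) (suc a ∷ α) ≈ q⁻¹ ^ a * coeff p (α ∷ʳ a)
    coeff-multiply-suc a α α≡d = begin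
      coeff (multiply c p) (suc a ∷ α)              ≈⟨ linear-multiply c (δ (suc a ∷ α)) p ⟩
      linear (multiplyᵀ c (δ (suc a ∷ α))) p        ≈⟨ linear-agree _ _ p monomial ⟩
      linear (λ β → q⁻¹ ^ a * δ (α ∷ʳ a) β) p       ≈⟨ linear-*ˡ (q⁻¹ ^ a) (δ (α ∷ʳ a)) p ⟩
      q⁻¹ ^ a * coeff p (α ∷ʳ a)                    ∎
      where
      monomial : ∀ β → multiplyᵀ c (δ (suc a ∷ α)) β ≈ q⁻¹ ^ a * δ (α ∷ʳ a) β ⊎ coeff p β ≈ 0#
      monomial β with Vec.initLast β
      ... | γ , b , ≡.refl with suc d ℕ.≤? ∣ γ ∷ʳ b ∣
      ...   | yes d<β = inj₂ (deg (γ ∷ʳ b) d<β)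
      ...   | no d≮β  = inj₁ (begin
        q⁻¹ ^ b * (δ (suc a ∷ α) (suc b ∷ γ) - c * δ (suc a ∷ α) (b ∷ γ))
          ≈⟨ *-congˡ (+-cong (δ-iff {α = suc a ∷ α} {suc b ∷ γ} {α ∷ʳ a} {γ ∷ʳ b}
               (λ { ≡.refl → ≡.refl })
               (λ eq → cong₂ (λ x v → suc x ∷ v) (Vec.∷ʳ-injectiveʳ α γ eq) (Vec.∷ʳ-injectiveˡ α γ eq)))
             (-‿cong (*-congˡ (δ-size (suc a ∷ α) (b ∷ γ) (subst (λ x → _ ℕ.< suc x) (≡.sym α≡d) (s≤s (below γ b d≮β))))))) ⟩
        q⁻¹ ^ b * (δ (α ∷ʳ a) (γ ∷ʳ b) - c * 0#)
          ≈⟨ *-congˡ (trans (+-congˡ (trans (-‿cong (zeroʳ c)) (sym (+-identityˡ _)))) (trans (+-congˡ (-‿inverseʳ 0#)) (+-identityʳ _))) ⟩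
        q⁻¹ ^ b * δ (α ∷ʳ a) (γ ∷ʳ b)
          ≈⟨ same-power (δ-view (α ∷ʳ a) (γ ∷ʳ b)) ⟩
        q⁻¹ ^ a * δ (α ∷ʳ a) (γ ∷ʳ b) ∎)
        where
        same-power : α ∷ʳ a ≡ γ ∷ʳ b ⊎ δ (α ∷ʳ a) (γ ∷ʳ b) ≈ 0# →
          q⁻¹ ^ b * δ (α ∷ʳ a) (γ ∷ʳ b) ≈ q⁻¹ ^ a * δ (α ∷ʳ a) (γ ∷ʳ b)
        same-power (inj₁ eq)  = *-congʳ (^-congʳ q⁻¹ (≡.sym (Vec.∷ʳ-injectiveʳ α γ eq)))
        same-power (inj₂ δ≈0) = trans (*-congˡ δ≈0) (trans (zeroʳ _) (trans (sym (zeroʳ _)) (*-congˡ (sym δ≈0))))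
-- Interpolation at the spectral points

-- Recovering the exponent of x is what separates the coordinates of distinct entries, whatever
-- their values of `k`.
Independent : (D : IntegralDomain) (x y : IntegralDomain.Carrier D) → Set
Independent D x y = ∀ a b k l → x ^ a * y ^ k ≈ x ^ b * y ^ l → a ≡ b
  where
  open IntegralDomain D
  open Exp semiring

module Interpolation (D : IntegralDomain) (q t q⁻¹ t⁻¹ : IntegralDomain.Carrier D)
  (q⁻¹*q≈1 : Inverse D q⁻¹ q) (t*t⁻¹≈1 : Inverse D t t⁻¹) (independent : Independent D q t) where

  open IntegralDomain D hiding (zero)
  open Polynomial commutativeRing
  open Hecke commutativeRing t
  open PolynomialFunctionals D
  open HeckeFunctionals D t
  open Division D q q⁻¹ q⁻¹*q≈1
  open Exp semiring using (_^_)
  open IntegerSolver commutativeRing using (solve; _:=_; _:+_; _:*_; _:-_)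
  open SetoidReasoning setoid

  coord : ℕ → ℕ → Carrier
  coord a x = q ^ a * t⁻¹ ^ x

  spectral : Vec ℕ n → Vec Carrier n
  spectral μ = tabulate (λ i → coord (lookup μ i) (k μ i))

  spectral-ks : (μ : Vec ℕ n) → spectral μ ≡ zipWith coord μ (ks μ)
  spectral-ks μ = lookup-extensional λ i → ≡.trans (Vec.lookup∘tabulate _ i)
    (≡.trans (cong (coord (lookup μ i)) (k-ks μ i)) (≡.sym (Vec.lookup-zipWith coord i μ (ks μ))))

  lookup-spectral : (μ : Vec ℕ n) → ∀ i → lookup (spectral μ) i ≡ coord (lookup μ i) (lookup (ks μ) i)
  lookup-spectral μ i = ≡.trans (cong (λ v → lookup v i) (spectral-ks μ)) (Vec.lookup-zipWith coord i μ (ks μ))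

  spectral-swap : (i : Adjacent n) (μ : Vec ℕ n) → lookup μ (left i) ≢ lookup μ (right i) →
    spectral (swap i μ) ≡ swap i (spectral μ)
  spectral-swap i μ l≢r = ≡.trans (spectral-ks (swap i μ)) (≡.trans (cong (zipWith coord (swap i μ)) (ks-swap i μ l≢r))
    (≡.trans (≡.sym (swap-zipWith coord i μ (ks μ))) (cong (swap i) (≡.sym (spectral-ks μ)))))

  spectral-0 : (ν : Vec ℕ n) → spectral (0 ∷ ν) ≡ coord 0 n ∷ spectral ν
  spectral-0 {n} ν = ≡.trans (spectral-ks (0 ∷ ν))
    (≡.trans (cong (zipWith coord (0 ∷ ν)) (ks-0 ν)) (cong (coord 0 n ∷_) (≡.sym (spectral-ks ν))))

  module _ (a : ℕ) (ν : Vec ℕ n) where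
    spectral-rest : Vec Carrier n
    spectral-rest = zipWith coord ν (zipWith (bump (suc a)) ν (ks ν))

    spectral-suc : spectral (suc a ∷ ν) ≡ coord (suc a) (count (suc a) ν) ∷ spectral-rest
    spectral-suc = spectral-ks (suc a ∷ ν)

    spectral-∷ʳ : spectral (ν ∷ʳ a) ≡ spectral-rest ∷ʳ coord a (count (suc a) ν)
    spectral-∷ʳ = ≡.trans (spectral-ks (ν ∷ʳ a)) (≡.trans (cong (zipWith coord (ν ∷ʳ a)) (ks-∷ʳ ν a))
      (zipWith-∷ʳ coord ν _ a _))

    coord-suc : coord (suc a) (count (suc a) ν) ≈ q * coord a (count (suc a) ν)
    coord-suc = *-assoc q _ _

  -- Multiplication by t^x t^y clears the negative powers of t, and `independent` applies.
  coord-injective : ∀ a b x y → coord a x ≈ coord b y → a ≡ b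
  coord-injective a b x y eq = independent a b y x (begin
    q ^ a * t ^ y                               ≈⟨ expand x (q ^ a * t ^ y) ⟩
    (q ^ a * t ^ y) * (t ^ x * t⁻¹ ^ x)         ≈⟨ solve 4 (λ u v w z → ((u :* v) :* (w :* z)) := ((u :* z) :* (v :* w)))
                                                     refl (q ^ a) (t ^ y) (t ^ x) (t⁻¹ ^ x) ⟩
    coord a x * (t ^ y * t ^ x)                 ≈⟨ *-congʳ eq ⟩
    coord b y * (t ^ y * t ^ x)                 ≈⟨ solve 4 (λ u v w z → ((u :* z) :* (v :* w)) := ((u :* w) :* (v :* z)))
                                                     refl (q ^ b) (t ^ y) (t ^ x) (t⁻¹ ^ y) ⟩
    (q ^ b * t ^ x) * (t ^ y * t⁻¹ ^ y)         ≈⟨ expand y (q ^ b * t ^ x) ⟨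
    q ^ b * t ^ x                               ∎)
    where
    expand : ∀ x u → u ≈ u * (t ^ x * t⁻¹ ^ x)
    expand x u = sym (trans (*-congˡ (^-inverse t*t⁻¹≈1 x)) (*-identityʳ u))

  coord-≉ : ∀ a b x y → a ≢ b → ¬ coord a x - coord b y ≈ 0#
  coord-≉ a b x y a≢b x-y≈0 = a≢b (coord-injective a b x y (x-y≈0⇒x≈y x-y≈0))

  t*coord : ∀ a x → t * coord a (suc x) ≈ coord a x
  t*coord a x = begin
    t * (q ^ a * (t⁻¹ * t⁻¹ ^ x))   ≈⟨ solve 4 (λ t y s z → (t :* (y :* (s :* z))) := ((t :* s) :* (y :* z))) refl t (q ^ a) t⁻¹ (t⁻¹ ^ x) ⟩
    (t * t⁻¹) * coord a x           ≈⟨ *-congʳ t*t⁻¹≈1 ⟩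
    1# * coord a x                  ≈⟨ *-identityˡ _ ⟩
    coord a x                       ∎

  t*coord-≉ : ∀ a b x y → a ≢ b → ¬ t * coord a x - coord b y ≈ 0#
  t*coord-≉ a b x y a≢b eq = a≢b (coord-injective a b x (suc y) (begin
    coord a x                        ≈⟨ *-identityˡ _ ⟨
    1# * coord a x                   ≈⟨ *-congʳ t*t⁻¹≈1 ⟨
    (t * t⁻¹) * coord a x            ≈⟨ solve 3 (λ t s z → ((t :* s) :* z) := (s :* (t :* z))) refl t t⁻¹ (coord a x) ⟩
    t⁻¹ * (t * coord a x)            ≈⟨ *-congˡ (x-y≈0⇒x≈y eq) ⟩
    t⁻¹ * coord b y                  ≈⟨ solve 3 (λ s y z → (s :* (y :* z)) := (y :* (s :* z))) refl t⁻¹ (q ^ b) (t⁻¹ ^ y) ⟩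
    coord b (suc y)                  ∎))

  -- The recursion is lexicographic: `restrict` removes a variable and keeps the degree bound,
  -- `divide` keeps the variables and lowers the bound. Both results vanish, and h is recovered from
  -- them by `linear-multiply-divide`.
  nondegenerate : ∀ n e (h : Poly n) → DegreeBelow e h →
    (∀ ν → ∣ ν ∣ ℕ.< e → eval h (spectral ν) ≈ 0#) → ∀ α → coeff h α ≈ 0#
  nondegenerate n       zero    h deg _ α  = deg α z≤n
  nondegenerate zero    (suc e) h deg h≈0 [] = trans (linear-congˡ (λ { [] → refl }) h) (h≈0 [] z<s)
  nondegenerate (suc n) (suc e) h deg h≈0 α = begin
    coeff h α
      ≈⟨ solve 2 (λ x y → x := ((x :- y) :+ y)) refl (coeff h α) _ ⟩
    coeff h α - linear (δ α ∘ (0 ∷_)) r + linear (δ α ∘ (0 ∷_)) r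
      ≈⟨ +-cong (sym (linear-multiply-divide c (δ α) h)) (linear-coeff≈0 _ r r≈0) ⟩
    linear (multiplyᵀ c (δ α)) g + 0#
      ≈⟨ +-identityʳ _ ⟩
    linear (multiplyᵀ c (δ α)) g
      ≈⟨ linear-coeff≈0 _ g g≈0 ⟩
    0# ∎
    where
    c : Carrier
    c = coord 0 n

    r : Poly n
    r = restrict c h

    g : Poly (suc n)
    g = divide c h

    r≈0 : ∀ β → coeff r β ≈ 0#
    r≈0 = nondegenerate n (suc e) r (restrict-degree c h deg) λ ν ν<e → trans (eval-restrict c h (spectral ν))
      (subst (λ v → eval h v ≈ 0#) (spectral-0 ν) (h≈0 (0 ∷ ν) ν<e))

    g-vanishes : ∀ ν → ∣ ν ∣ ℕ.< e → eval g (spectral ν) ≈ 0#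
    g-vanishes ν ν<e with Vec.initLast ν
    ... | β , a , ≡.refl = subst (λ v → eval g v ≈ 0#) (≡.sym (spectral-∷ʳ a β)) (0-product (begin
      (x - c) * eval g (v ∷ʳ y)          ≈⟨ eval-divide c v (coord-suc a β) h ⟩
      eval h (x ∷ v) - eval r v          ≈⟨ +-cong
                                              (subst (λ w → eval h w ≈ 0#) (spectral-suc a β)
                                                (h≈0 (suc a ∷ β) (s≤s (subst (ℕ._< e) (∣∷ʳ∣ β a) ν<e))))
                                              (-‿cong (linear-coeff≈0 _ r r≈0)) ⟩
      0# - 0#                            ≈⟨ -‿inverseʳ 0# ⟩
      0#                                 ∎) (coord-≉ (suc a) 0 (count (suc a) β) n λ ()))
      where
      x y : Carrier
      x = coord (suc a) (count (suc a) β)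
      y = coord a (count (suc a) β)
      v = spectral-rest a β

    g≈0 : ∀ β → coeff g β ≈ 0#
    g≈0 = nondegenerate (suc n) e g (divide-degree c h deg) g-vanishes

  -- E*_μ up to a scalar, with the triangularity that its definition entails.
  record Interpolant {n} (μ : Vec ℕ n) (f : Poly n) : Set where
    field
      degree     : DegreeBelow (suc ∣ μ ∣) f
      vanishing  : ∀ ν → ∣ ν ∣ ℕ.≤ ∣ μ ∣ → ν ≢ μ → eval f (spectral ν) ≈ 0#
      value      : ¬ eval f (spectral μ) ≈ 0#
      leading    : ¬ coeff f μ ≈ 0#
      triangular : ∀ α → ∣ α ∣ ≡ ∣ μ ∣ → ¬ α ⊑ μ → coeff f α ≈ 0#

  -- For distinct entries the swapped point is the spectral point of `swap i ν`, and x - y can be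
  -- cancelled in `eval-T`. For equal entries t x = y removes the divided difference, and the value
  -- of f at ν alone suffices.
  T-vanishes : (i : Adjacent n) (f : Poly n) (ν : Vec ℕ n) → eval f (spectral ν) ≈ 0# →
    (lookup ν (left i) ≢ lookup ν (right i) → eval f (spectral (swap i ν)) ≈ 0#) →
    eval (T i f) (spectral ν) ≈ 0#
  T-vanishes i f ν fν≈0 fsν≈0 with lookup ν (left i) ℕ.≟ lookup ν (right i)
  ... | yes l≡r = trans (eval-T-fixed i f (spectral ν) (begin
    t * lookup (spectral ν) (left i)                         ≡⟨ cong (t *_) (lookup-spectral ν (left i)) ⟩
    t * coord (lookup ν (left i)) (lookup (ks ν) (left i))   ≡⟨ cong₂ (λ a x → t * coord a x) l≡r (ks-equal i ν l≡r) ⟩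
    t * coord (lookup ν (right i)) (suc (lookup (ks ν) (right i))) ≈⟨ t*coord (lookup ν (right i)) (lookup (ks ν) (right i)) ⟩
    coord (lookup ν (right i)) (lookup (ks ν) (right i))     ≡⟨ lookup-spectral ν (right i) ⟨
    lookup (spectral ν) (right i)                            ∎))
    (trans (*-congˡ fν≈0) (zeroʳ t))
  ... | no l≢r = 0-product (begin
    (x - y) * eval (T i f) (spectral ν)
      ≈⟨ eval-T i f (spectral ν) ⟩
    (x - y) * (t * eval f (spectral ν)) - (t * x - y) * (eval f (spectral ν) - eval f (swap i (spectral ν)))
      ≈⟨ +-cong (*-congˡ (*-congˡ fν≈0)) (-‿cong (*-congˡ (+-cong fν≈0
           (-‿cong (subst (λ v → eval f v ≈ 0#) (spectral-swap i ν l≢r) (fsν≈0 l≢r)))))) ⟩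
    (x - y) * (t * 0#) - (t * x - y) * (0# - 0#)
      ≈⟨ +-cong (trans (*-congˡ (zeroʳ t)) (zeroʳ _)) (-‿cong (trans (*-congˡ (-‿inverseʳ 0#)) (zeroʳ _))) ⟩
    0# - 0#
      ≈⟨ -‿inverseʳ 0# ⟩
    0# ∎) x≉y
    where
    x = lookup (spectral ν) (left i)
    y = lookup (spectral ν) (right i)

    x≉y : ¬ x - y ≈ 0#
    x≉y = ≡.subst₂ (λ x y → ¬ x - y ≈ 0#) (≡.sym (lookup-spectral ν (left i))) (≡.sym (lookup-spectral ν (right i)))
      (coord-≉ (lookup ν (left i)) (lookup ν (right i)) (lookup (ks ν) (left i)) (lookup (ks ν) (right i)) l≢r)

  T-degree : ∀ {e} (i : Adjacent n) (f : Poly n) → DegreeBelow e f → DegreeBelow e (T i f)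
  T-degree i f deg τ e≤τ = coeff-T-0 i f τ (λ α r → deg α (ℕ.≤-trans e≤τ (ℕ.≤-reflexive (∣related∣ r))))

  -- If x^τ is an interior term of T_i x^α, strict convexity gives a level at which the sum of α
  -- exceeds that of τ, so α ⋠ τ.
  dominated⇒strict≈0 : (i : Adjacent n) (f : Poly n) (τ : Vec ℕ n) →
    (∀ α → ∣ α ∣ ≡ ∣ τ ∣ → ¬ α ≼ τ → coeff f α ≈ 0#) →
    ∀ α → Related StrictlyWithin i α τ → coeff f α ≈ 0#
  dominated⇒strict≈0 i f τ dom α r = dom α
    (≡.sym (∣related∣ (related-map (λ { (eq , u< , v<) → eq , ℕ.<⇒≤ u< , ℕ.<⇒≤ v< }) r)))
    (λ α≼τ → let m , lt = S-strictlyRelated r in ℕ.<⇒≱ lt (α≼τ m))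

  module _ (i : Adjacent n) {κ : Vec ℕ n} {f : Poly n} (F : Interpolant κ f)
    (descent : lookup κ (right i) ℕ.< lookup κ (left i)) where

    private
      module F = Interpolant F
      -- Θ is chosen such that g = Δ T_i f - Θ f vanishes at the spectral point of κ.
      x y Δ Θ : Carrier
      x = lookup (spectral κ) (left i)
      y = lookup (spectral κ) (right i)
      Δ = x - y
      Θ = Δ * t - (t * x - y)

      μ : Vec ℕ n
      μ = swap i κ

      g : Poly n
      g = combination Δ (T i f) Θ f

      l≢r : lookup κ (left i) ≢ lookup κ (right i)
      l≢r = ℕ.<⇒≢ descent ∘ ≡.sym

      x≡ : x ≡ coord (lookup κ (left i)) (lookup (ks κ) (left i))
      x≡ = lookup-spectral κ (left i)
      y≡ : y ≡ coord (lookup κ (right i)) (lookup (ks κ) (right i))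
      y≡ = lookup-spectral κ (right i)

      Δ≉0 : ¬ Δ ≈ 0#
      Δ≉0 = ≡.subst₂ (λ x y → ¬ x - y ≈ 0#) (≡.sym x≡) (≡.sym y≡) (coord-≉ (lookup κ (left i)) (lookup κ (right i)) (lookup (ks κ) (left i)) (lookup (ks κ) (right i)) l≢r)

      ty≉x : ¬ t * y - x ≈ 0#
      ty≉x = ≡.subst₂ (λ x y → ¬ t * y - x ≈ 0#) (≡.sym x≡) (≡.sym y≡) (t*coord-≉ (lookup κ (right i)) (lookup κ (left i)) (lookup (ks κ) (right i)) (lookup (ks κ) (left i)) (l≢r ∘ ≡.sym))

      μ↑ : lookup μ (left i) ℕ.< lookup μ (right i)
      μ↑ = ≡.subst₂ ℕ._<_ (≡.sym (lookup-swap-left i κ)) (≡.sym (lookup-swap-right i κ)) descent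

      μ≢κ : μ ≢ κ
      μ≢κ μ≡κ = l≢r (≡.trans (≡.sym (lookup-swap-right i κ)) (cong (λ v → lookup v (right i)) μ≡κ))

      κ⊑μ : κ ⊑ μ
      κ⊑μ = ⊑-lift i descent (λ _ _ _ → ℕ.≤-refl) (related-refl i κ)

      spectral-μ : spectral μ ≡ swap i (spectral κ)
      spectral-μ = spectral-swap i κ l≢r

      eval-μ : eval f (swap i (spectral κ)) ≈ 0#
      eval-μ = subst (λ v → eval f v ≈ 0#) spectral-μ (F.vanishing μ (ℕ.≤-reflexive (∣swap∣ i κ)) μ≢κ)

      F₀ : Carrier
      F₀ = eval f (spectral κ)

      vanishing-κ : eval g (spectral κ) ≈ 0#
      vanishing-κ = begin
        eval g (spectral κ)
          ≈⟨ linear-combination Δ (T i f) Θ f (monomialValue (spectral κ)) ⟩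
        Δ * eval (T i f) (spectral κ) - Θ * F₀
          ≈⟨ +-congʳ (eval-T i f (spectral κ)) ⟩
        Δ * (t * F₀) - (t * x - y) * (F₀ - eval f (swap i (spectral κ))) - Θ * F₀
          ≈⟨ +-congʳ (+-congˡ (-‿cong (*-congˡ (trans (+-congˡ (-‿cong eval-μ))
               (trans (+-congˡ (trans (sym (+-identityˡ _)) (-‿inverseʳ 0#))) (+-identityʳ F₀)))))) ⟩
        Δ * (t * F₀) - (t * x - y) * F₀ - (Δ * t - (t * x - y)) * F₀
          ≈⟨ solve 4 (λ Δ t F w → (Δ :* (t :* F) :- w :* F :- (Δ :* t :- w) :* F) := (F :- F)) refl Δ t F₀ (t * x - y) ⟩
        F₀ - F₀
          ≈⟨ -‿inverseʳ F₀ ⟩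
        0# ∎

      -- At the swapped point x and y exchange roles and f vanishes, so `eval-T` leaves (y - x) T_i
      -- f = (t y - x) F₀. Both factors on the right are nonzero.
      Tf-μ : ¬ eval (T i f) (swap i (spectral κ)) ≈ 0#
      Tf-μ Tf≈0 = xy≉0 ty≉x F.value (begin
        (t * y - x) * F₀
          ≈⟨ solve 5 (λ x y t u v → ((t :* y :- x) :* v) :=
               (((y :- x) :* (t :* u)) :- (t :* y :- x) :* (u :- v) :+ (((t :* y :- x) :* u) :- ((y :- x) :* (t :* u)))))
               refl x y t (eval f sκ) F₀ ⟩
        (y - x) * (t * eval f sκ) - (t * y - x) * (eval f sκ - F₀) + ((t * y - x) * eval f sκ - (y - x) * (t * eval f sκ))
          ≈⟨ +-cong (sym eval-T-μ) (+-cong (trans (*-congˡ eval-μ) (zeroʳ _))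
               (-‿cong (trans (*-congˡ (trans (*-congˡ eval-μ) (zeroʳ _))) (zeroʳ _)))) ⟩
        (y - x) * eval (T i f) sκ + (0# - 0#)
          ≈⟨ +-cong (trans (*-congˡ Tf≈0) (zeroʳ _)) (-‿inverseʳ 0#) ⟩
        0# + 0#
          ≈⟨ +-identityʳ 0# ⟩
        0# ∎)
        where
        sκ = swap i (spectral κ)

        eval-T-μ : (y - x) * eval (T i f) sκ ≈ (y - x) * (t * eval f sκ) - (t * y - x) * (eval f sκ - F₀)
        eval-T-μ = transport (lookup-swap-left i (spectral κ)) (lookup-swap-right i (spectral κ))
          (swap-involutive i (spectral κ)) (eval-T i f sκ)
          where
          transport : ∀ {x′ x y′ y : Carrier} {v w : Vec Carrier n} → x′ ≡ x → y′ ≡ y → v ≡ w →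
            (x′ - y′) * eval (T i f) sκ ≈ (x′ - y′) * (t * eval f sκ) - (t * x′ - y′) * (eval f sκ - eval f v) →
            (x - y) * eval (T i f) sκ ≈ (x - y) * (t * eval f sκ) - (t * x - y) * (eval f sκ - eval f w)
          transport ≡.refl ≡.refl ≡.refl eq = eq

      triangular-κ : ∀ α → ∣ α ∣ ≡ ∣ μ ∣ → ¬ α ⊑ κ → coeff f α ≈ 0#
      triangular-κ α α≡μ = F.triangular α (≡.trans α≡μ (∣swap∣ i κ))

      coeff-μ : coeff f μ ≈ 0#
      coeff-μ = triangular-κ μ ≡.refl (λ μ⊑κ → μ≢κ (⊑-antisym μ⊑κ κ⊑μ))

      -- Since μ has an ascent at i, the coefficient moves from κ to μ without a factor. The
      -- remaining term carries the coefficient of x^μ in f, which is zero because μ lies strictly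
      -- above κ.
      coeff-T-μ : coeff (T i f) μ ≈ coeff f κ
      coeff-T-μ = begin
        coeff (T i f) μ
          ≈⟨ coeff-T-< i f μ μ↑ (dominated⇒strict≈0 i f μ (λ α α≡μ α⋠μ →
               triangular-κ α α≡μ (λ α⊑κ → α⋠μ (λ m → ℕ.≤-trans (α⊑κ m 0 z≤n) (ℕ.≤-reflexive (≡.sym (S-swap-0 i κ m))))))) ⟩
        (t - 1#) * coeff f μ + coeff f (swap i μ)
          ≈⟨ +-cong (trans (*-congˡ coeff-μ) (zeroʳ _)) (reflexive (cong (coeff f) (swap-involutive i κ))) ⟩
        0# + coeff f κ
          ≈⟨ +-identityˡ _ ⟩
        coeff f κ ∎

    swap-interpolant : ∃[ g ] Interpolant (swap i κ) g
    swap-interpolant = g , record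
      { degree     = subst (λ d → DegreeBelow (suc d) g) (≡.sym (∣swap∣ i κ)) degree
      ; vanishing  = λ ν ν≤μ → vanishing ν (ℕ.≤-trans ν≤μ (ℕ.≤-reflexive (∣swap∣ i κ)))
      ; value      = subst (λ v → ¬ eval g v ≈ 0#) (≡.sym spectral-μ) (λ g≈0 → Tf-μ (combination-0⁻ˡ Δ (T i f) Θ f _ Δ≉0 g≈0 eval-μ))
      ; leading    = λ g≈0 → F.leading (trans (sym coeff-T-μ) (combination-0⁻ˡ Δ (T i f) Θ f (δ μ) Δ≉0 g≈0 coeff-μ))
      ; triangular = triangular
      }
      where
      degree : DegreeBelow (suc ∣ κ ∣) g
      degree α d<α = combination-0 Δ (T i f) Θ f (δ α) (T-degree i f F.degree α d<α) (F.degree α d<α)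

      vanishing : ∀ ν → ∣ ν ∣ ℕ.≤ ∣ κ ∣ → ν ≢ μ → eval g (spectral ν) ≈ 0#
      vanishing ν ν≤κ ν≢μ with ν ≟ᵉ κ
      ... | yes ≡.refl = vanishing-κ
      ... | no ν≢κ     = combination-0 Δ (T i f) Θ f _
              (T-vanishes i f ν fν≈0 (λ _ → F.vanishing (swap i ν) (ℕ.≤-trans (ℕ.≤-reflexive (∣swap∣ i ν)) ν≤κ)
                (λ sν≡κ → ν≢μ (≡.trans (≡.sym (swap-involutive i ν)) (cong (swap i) sν≡κ)))))
              fν≈0
        where
        fν≈0 : eval f (spectral ν) ≈ 0#
        fν≈0 = F.vanishing ν ν≤κ ν≢κ

      triangular : ∀ α → ∣ α ∣ ≡ ∣ μ ∣ → ¬ α ⊑ μ → coeff g α ≈ 0#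
      triangular α α≡μ α⋢μ = combination-0 Δ (T i f) Θ f (δ α)
        (coeff-T-0 i f α λ β r → triangular-κ β (≡.trans (≡.sym (∣related∣ r)) α≡μ)
          (λ β⊑κ → α⋢μ (⊑-lift i descent β⊑κ r)))
        (triangular-κ α α≡μ (λ α⊑κ → α⋢μ (⊑-lift i descent α⊑κ (related-refl i α))))

  module _ (a : ℕ) (μ : Vec ℕ n) {f : Poly (suc n)} (F : Interpolant (μ ∷ʳ a) f) where
    private
      module F = Interpolant F
      c : Carrier
      c = coord 0 n

      g : Poly (suc n)
      g = multiply c f

      size : ∣ μ ∷ʳ a ∣ ≡ a ℕ.+ ∣ μ ∣
      size = ∣∷ʳ∣ μ a

      f-degree : DegreeBelow (suc (a ℕ.+ ∣ μ ∣)) f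
      f-degree = subst (λ d → DegreeBelow (suc d) f) size F.degree

      eval-g : ∀ b ν → eval g (spectral (suc b ∷ ν)) ≈
        (coord (suc b) (count (suc b) ν) - c) * eval f (spectral (ν ∷ʳ b))
      eval-g b ν = begin
        eval g (spectral (suc b ∷ ν))                   ≡⟨ cong (eval g) (spectral-suc b ν) ⟩
        eval g (_ ∷ spectral-rest b ν)                  ≈⟨ eval-multiply c (spectral-rest b ν) (coord-suc b ν) f ⟩
        _ * eval f (spectral-rest b ν ∷ʳ _)             ≡⟨ cong (λ v → (coord (suc b) (count (suc b) ν) - c) * eval f v) (spectral-∷ʳ b ν) ⟨
        _ * eval f (spectral (ν ∷ʳ b))                  ∎

      vanishing : ∀ ν → ∣ ν ∣ ℕ.≤ suc (a ℕ.+ ∣ μ ∣) → ν ≢ suc a ∷ μ → eval g (spectral ν) ≈ 0#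
      -- These points lie on the hyperplane, so the factor x₁ - c kills g whatever f is at the
      -- rotated point.
      vanishing (zero ∷ ν) _ _ = begin
        eval g (spectral (0 ∷ ν))     ≡⟨ cong (eval g) (spectral-0 ν) ⟩
        eval g (c ∷ spectral ν)       ≈⟨ eval-multiply c (spectral ν) (sym (trans (sym (*-assoc _ _ _))
                                           (trans (*-congʳ (trans (*-comm q q⁻¹) q⁻¹*q≈1)) (*-identityˡ c)))) f ⟩
        (c - c) * _                   ≈⟨ *-congʳ (-‿inverseʳ c) ⟩
        0# * _                        ≈⟨ zeroˡ _ ⟩
        0#                            ∎
      vanishing (suc b ∷ ν) (s≤s ν≤) ν≢ = trans (eval-g b ν) (trans (*-congˡ (F.vanishing (ν ∷ʳ b)
        (≡.subst₂ ℕ._≤_ (≡.sym (∣∷ʳ∣ ν b)) (≡.sym size) ν≤)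
        (λ eq → ν≢ (cong₂ (λ x v → suc x ∷ v) (Vec.∷ʳ-injectiveʳ ν μ eq) (Vec.∷ʳ-injectiveˡ ν μ eq))))) (zeroʳ _))

      q⁻¹^≉0 : ∀ b → ¬ q⁻¹ ^ b ≈ 0#
      q⁻¹^≉0 b eq = 1≉0 (trans (sym (^-inverse q⁻¹*q≈1 b)) (trans (*-congʳ eq) (zeroˡ _)))

      triangular : ∀ α → ∣ α ∣ ≡ suc (a ℕ.+ ∣ μ ∣) → ¬ α ⊑ suc a ∷ μ → coeff g α ≈ 0#
      triangular (zero ∷ α)  α≡ _  = coeff-multiply-0 c f f-degree α α≡
      triangular (suc b ∷ α) α≡ α⋢ = trans (coeff-multiply-suc c f f-degree b α b+α≡)
        (trans (*-congˡ (F.triangular (α ∷ʳ b) (≡.trans (∣∷ʳ∣ α b) (≡.trans b+α≡ (≡.sym size)))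
          (λ le → α⋢ (⊑-rotate α μ b a b+α≡ le)))) (zeroʳ _))
        where
        b+α≡ : b ℕ.+ ∣ α ∣ ≡ a ℕ.+ ∣ μ ∣
        b+α≡ = ℕ.suc-injective α≡

    suc-interpolant : ∃[ g ] Interpolant (suc a ∷ μ) g
    suc-interpolant = g , record
      { degree     = multiply-degree c f f-degree
      ; vanishing  = vanishing
      ; value      = λ g≈0 → xy≉0 (coord-≉ (suc a) 0 (count (suc a) μ) n λ ()) F.value (trans (sym (eval-g a μ)) g≈0)
      ; leading    = λ g≈0 → xy≉0 (q⁻¹^≉0 a) F.leading (trans (sym (coeff-multiply-suc c f f-degree a μ ≡.refl)) g≈0)
      ; triangular = triangular
      }

  private
    ∣∣≡0 : (μ ν : Vec ℕ n) → ∣ μ ∣ ≡ 0 → ∣ ν ∣ ≡ 0 → μ ≡ ν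
    ∣∣≡0 []         []         _  _  = ≡.refl
    ∣∣≡0 (zero ∷ μ) (zero ∷ ν) e₁ e₂ = cong (0 ∷_) (∣∣≡0 μ ν e₁ e₂)

    positive-entry : ∀ {d} (μ : Vec ℕ n) → ∣ μ ∣ ≡ suc d → ∃[ j ] 0 ℕ.< lookup μ j
    positive-entry (suc a ∷ μ) _  = zero , z<s
    positive-entry (zero ∷ μ)  eq with positive-entry μ eq
    ... | j , 0<μj = suc j , 0<μj

    ∣replicate-0∣ : ∀ n → ∣ replicate n 0 ∣ ≡ 0
    ∣replicate-0∣ zero    = ≡.refl
    ∣replicate-0∣ (suc n) = ∣replicate-0∣ n

    monomialValue-0 : (v : Vec Carrier n) → monomialValue v (replicate n 0) ≈ 1#
    monomialValue-0 []      = refl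
    monomialValue-0 (x ∷ v) = trans (*-identityˡ _) (monomialValue-0 v)

  zero-interpolant : (μ : Vec ℕ n) → ∣ μ ∣ ≡ 0 → Interpolant μ (const 1#)
  zero-interpolant {n} μ μ≡0 = record
    { degree     = λ α d<α → trans (single (δ α)) (δ-size α (replicate n 0)
                     (ℕ.≤-<-trans (ℕ.≤-reflexive (∣replicate-0∣ n)) (ℕ.≤-<-trans z≤n d<α)))
    ; vanishing  = λ ν ν≤μ ν≢μ → contradiction (∣∣≡0 ν μ (ℕ.n≤0⇒n≡0 (ℕ.≤-trans ν≤μ (ℕ.≤-reflexive μ≡0))) μ≡0) ν≢μ
    ; value      = λ e → 1≉0 (trans (sym (trans (single (monomialValue (spectral μ))) (monomialValue-0 (spectral μ)))) e)
    ; leading    = λ e → 1≉0 (trans (sym (trans (single (δ μ)) (trans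
                     (linear-≡ (δ μ) (∣∣≡0 (replicate n 0) μ (∣replicate-0∣ n) μ≡0)) (δ-refl μ)))) e)
    ; triangular = λ α α≡μ α⋢μ → contradiction
                     (subst (α ⊑_) (∣∣≡0 α μ (≡.trans α≡μ μ≡0) μ≡0) (λ _ _ _ → ℕ.≤-refl)) α⋢μ
    }
    where
    single : ∀ φ → linear φ (const 1#) ≈ φ (replicate n 0)
    single φ = trans (+-identityʳ _) (*-identityˡ _)

  -- Inside the induction on d, a positive entry is brought to the front, where rotation lowers the
  -- degree. If its left neighbour is positive, that neighbour is taken instead. If it is zero,
  -- `swap i μ` has a descent at i with the positive entry one place further left, and
  -- `swap-interpolant` leads back to μ.
  interpolant : ∀ d (μ : Vec ℕ n) → ∣ μ ∣ ≡ d → ∃[ f ] Interpolant μ f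
  interpolant zero        μ μ≡0 = const 1# , zero-interpolant μ μ≡0
  interpolant {n} (suc d) μ μ≡d = let j , 0<μj = positive-entry μ μ≡d in
    positive (toℕ j) μ j ≡.refl 0<μj μ≡d
    where
    positive : ∀ {n} m (μ : Vec ℕ n) j → toℕ j ≡ m → 0 ℕ.< lookup μ j → ∣ μ ∣ ≡ suc d → ∃[ f ] Interpolant μ f
    positive m       (suc a ∷ μ) zero    j≡m 0<μj μ≡d =
      let f , F = interpolant d (μ ∷ʳ a) (≡.trans (∣∷ʳ∣ μ a) (ℕ.suc-injective μ≡d)) in suc-interpolant a μ F
    positive (suc m) μ           (suc j) j≡m 0<μj μ≡d with lookup μ (inject₁ j) in μj≡
    ... | suc _ = positive m μ (inject₁ j) (≡.trans (Fin.toℕ-inject₁ j) (ℕ.suc-injective j≡m))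
                    (subst (0 ℕ.<_) (≡.sym μj≡) z<s) μ≡d
    ... | zero =
      let i = pos j
          f , F = positive m (swap i μ) (inject₁ j) (≡.trans (Fin.toℕ-inject₁ j) (ℕ.suc-injective j≡m))
                    (subst (0 ℕ.<_) (≡.sym (lookup-swap-left i μ)) 0<μj) (≡.trans (∣swap∣ i μ) μ≡d)
      in subst (λ κ → ∃[ f ] Interpolant κ f) (swap-involutive i μ)
           (swap-interpolant i F (≡.subst₂ ℕ._<_ (≡.sym (≡.trans (lookup-swap-right i μ) μj≡)) (≡.sym (lookup-swap-left i μ)) 0<μj))

  -- E is proportional to the constructed interpolant f: a E - b f vanishes at the point of μ as
  -- well, hence is zero, and a ≠ 0.
  E*-triangular : (μ : Vec ℕ n) (E : Poly n) → DegreeBelow (suc ∣ μ ∣) E →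
    (∀ ν → ∣ ν ∣ ℕ.≤ ∣ μ ∣ → ν ≢ μ → eval E (spectral ν) ≈ 0#) →
    ∀ α → ∣ α ∣ ≡ ∣ μ ∣ → ¬ α ⊑ μ → coeff E α ≈ 0#
  E*-triangular {n} μ E degree vanishing α α≡μ α⋢μ =
    combination-0⁻ˡ a E b f (δ α) F.value (h≈0 α) (F.triangular α α≡μ α⋢μ)
    where
    f = proj₁ (interpolant ∣ μ ∣ μ ≡.refl)
    module F = Interpolant (proj₂ (interpolant ∣ μ ∣ μ ≡.refl))
    a = eval f (spectral μ)
    b = eval E (spectral μ)
    h = combination a E b f

    h-vanishes : ∀ ν → ∣ ν ∣ ℕ.< suc ∣ μ ∣ → eval h (spectral ν) ≈ 0#
    h-vanishes ν (s≤s ν≤μ) with ν ≟ᵉ μ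
    ... | yes ≡.refl = trans (linear-combination a E b f _) (trans (+-congˡ (-‿cong (*-comm b a))) (-‿inverseʳ (a * b)))
    ... | no ν≢μ     = combination-0 a E b f _ (vanishing ν ν≤μ ν≢μ) (F.vanishing ν ν≤μ ν≢μ)

    h≈0 : ∀ α → coeff h α ≈ 0#
    h≈0 = nondegenerate n (suc ∣ μ ∣) h
      (λ α μ<α → combination-0 a E b f (δ α) (degree α μ<α) (F.degree α μ<α)) h-vanishes

  -- Such an h is a linear combination of the interpolants of the μ in L; one of them is eliminated
  -- for each point removed from L.
  span-triangular : ∀ {d} (L : List (Vec ℕ n)) → (∀ {μ} → μ ∈ L → ∣ μ ∣ ≡ d) →
    ∀ h → DegreeBelow (suc d) h → (∀ ν → ∣ ν ∣ ℕ.≤ d → ν ∉ L → eval h (spectral ν) ≈ 0#) →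
    ∀ α → ∣ α ∣ ≡ d → (∀ {μ} → μ ∈ L → ¬ α ⊑ μ) → coeff h α ≈ 0#
  span-triangular {n} {d} [] L≡d h degree vanishing α _ _ =
    nondegenerate n (suc d) h degree (λ { ν (s≤s ν≤d) → vanishing ν ν≤d λ () }) α
  span-triangular {n} (μ ∷ L) L≡d h degree vanishing α α≡d α⋢ with L≡d (here ≡.refl)
  ... | ≡.refl = combination-0⁻ˡ a h b f (δ α) F.value
      (span-triangular L (L≡d ∘ there) h′ degree′ vanishing′ α α≡d (α⋢ ∘ there))
      (F.triangular α α≡d (α⋢ (here ≡.refl)))
    where
    f = proj₁ (interpolant ∣ μ ∣ μ ≡.refl)
    module F = Interpolant (proj₂ (interpolant ∣ μ ∣ μ ≡.refl))
    a = eval f (spectral μ)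
    b = eval h (spectral μ)
    h′ = combination a h b f

    degree′ : DegreeBelow (suc ∣ μ ∣) h′
    degree′ α μ<α = combination-0 a h b f (δ α) (degree α μ<α) (F.degree α μ<α)

    vanishing′ : ∀ ν → ∣ ν ∣ ℕ.≤ ∣ μ ∣ → ν ∉ L → eval h′ (spectral ν) ≈ 0#
    vanishing′ ν ν≤μ ν∉L with ν ≟ᵉ μ
    ... | yes ≡.refl = trans (linear-combination a h b f _) (trans (+-congˡ (-‿cong (*-comm b a))) (-‿inverseʳ (a * b)))
    ... | no ν≢μ     = combination-0 a h b f _
                         (vanishing ν ν≤μ λ { (here ν≡μ) → ν≢μ ν≡μ ; (there ν∈L) → ν∉L ν∈L })
                         (F.vanishing ν ν≤μ ν≢μ)

  module _ {d : ℕ} (h : Poly n) (degree : DegreeBelow (suc d) h)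
    (support : ∀ ν → ∣ ν ∣ ℕ.≤ d → ¬ eval h (spectral ν) ≈ 0# → ∣ ν ∣ ≡ d × coeff h ν ≈ 0#) where

    private
      ω : Vec ℕ n → ℕ
      ω = weight d

      bound : ℕ
      bound = sumᴸ (List.map ω (box n d))

      ω≤bound : ∀ ν → ∣ ν ∣ ℕ.≤ d → ω ν ℕ.≤ bound
      ω≤bound ν ν≤d = ∈⇒≤sum (∈.∈-map⁺ ω (∈-box ν ν≤d))

      -- Descending induction on the weight: once h vanishes at all points of larger weight,
      -- the coefficient of x^ν in h comes from the interpolant of ν alone.
      vanishes : ∀ l ν → ∣ ν ∣ ℕ.≤ d → bound ℕ.< l ℕ.+ ω ν → eval h (spectral ν) ≈ 0#
      vanishes zero    ν ν≤d bound< = contradiction (ω≤bound ν ν≤d) (ℕ.<⇒≱ bound<)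
      vanishes (suc l) ν ν≤d bound< with eval h (spectral ν) ≈? 0#
      ... | yes hν≈0 = hν≈0
      ... | no hν≉0 with support ν ν≤d hν≉0
      -- Neither h nor h′ contains x^ν, so b times the leading coefficient of f is zero; that
      -- coefficient is not, hence b is.
      ...   | ≡.refl , coeff≈0 = 0-product (trans (*-comm _ _) (combination-0⁻ʳ a h b f (δ ν) h′≈0 coeff≈0)) F.leading
        where
        f = proj₁ (interpolant ∣ ν ∣ ν ≡.refl)
        module F = Interpolant (proj₂ (interpolant ∣ ν ∣ ν ≡.refl))
        a = eval f (spectral ν)
        b = eval h (spectral ν)
        h′ = combination a h b f

        Other : Vec ℕ n → Set
        Other μ = ∣ μ ∣ ≡ ∣ ν ∣ × ω μ ℕ.≤ ω ν × μ ≢ ν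

        other? : ∀ μ → Dec (Other μ)
        other? μ = (∣ μ ∣ ℕ.≟ ∣ ν ∣) ×-dec (ω μ ℕ.≤? ω ν) ×-dec ¬? (μ ≟ᵉ ν)

        L : List (Vec ℕ n)
        L = filter other? (box n d)

        L⇒other : ∀ {μ} → μ ∈ L → Other μ
        L⇒other μ∈L = proj₂ (∈.∈-filter⁻ other? {xs = box n d} μ∈L)

        vanishing′ : ∀ μ → ∣ μ ∣ ℕ.≤ ∣ ν ∣ → μ ∉ L → eval h′ (spectral μ) ≈ 0#
        vanishing′ μ μ≤d μ∉L with μ ≟ᵉ ν
        ... | yes ≡.refl = trans (linear-combination a h b f _) (trans (+-congˡ (-‿cong (*-comm b a))) (-‿inverseʳ (a * b)))
        ... | no μ≢ν     = combination-0 a h b f _ hμ≈0 (F.vanishing μ μ≤d μ≢ν)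
          where
          hμ≈0 : eval h (spectral μ) ≈ 0#
          hμ≈0 with eval h (spectral μ) ≈? 0# | ω μ ℕ.≤? ω ν
          ... | yes eq | _        = eq
          ... | no hμ≉0 | yes μ≤ν = contradiction
                  (∈.∈-filter⁺ other? (∈-box μ μ≤d) (proj₁ (support μ μ≤d hμ≉0) , μ≤ν , μ≢ν)) μ∉L
          ... | no _    | no μ≰ν  = vanishes l μ μ≤d (ℕ.<-≤-trans bound<
                  (ℕ.≤-trans (ℕ.≤-reflexive (≡.sym (ℕ.+-suc l (ω ν)))) (ℕ.+-monoʳ-≤ l (ℕ.≰⇒> μ≰ν))))

        h′≈0 : coeff h′ ν ≈ 0#
        h′≈0 = span-triangular L (proj₁ ∘ L⇒other) h′
          (λ α μ<α → combination-0 a h b f (δ α) (degree α μ<α) (F.degree α μ<α)) vanishing′ ν ≡.refl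
          -- ν ⊑ μ with μ ≢ ν would give ν a smaller weight than μ, but L holds only weights up to
          -- that of ν.
          (λ {μ} μ∈L ν⊑μ → let μ≡ , μ≤ν , μ≢ν = L⇒other μ∈L in
            ℕ.<⇒≱ (weight-strict d ℕ.≤-refl (ℕ.≤-reflexive μ≡) ν⊑μ (μ≢ν ∘ ≡.sym)) μ≤ν)

    -- The orbit enters only through `support`, which speaks of points with nonzero value of h; that
    -- is decidable, so membership in the orbit never has to be decided.
    uniqueness : ∀ α → coeff h α ≈ 0#
    uniqueness = nondegenerate n (suc d) h degree
      (λ { ν (s≤s ν≤d) → vanishes (suc bound) ν ν≤d (s≤s (ℕ.m≤m+n bound (ω ν))) })

  -- Hecke operators on the orbit of a partition

  record Orbital {n} (lam μ : Vec ℕ n) (f : Poly n) : Set where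
    field
      degree       : DegreeBelow (suc ∣ lam ∣) f
      vanishing    : ∀ ν → ∣ ν ∣ ℕ.≤ ∣ lam ∣ → ν ∉S[ lam ] → eval f (spectral ν) ≈ 0#
      -- `≼` is insensitive to permuting entries, so this bound is kept by every T_i. It is strong
      -- enough to exclude interior terms x^τ with τ in the orbit.
      dominated    : ∀ α → ∣ α ∣ ≡ ∣ lam ∣ → ¬ α ≼ lam → coeff f α ≈ 0#
      coefficients : ∀ τ → τ ∈S[ lam ] → coeff f τ ≈ δ τ μ

  -- The terms of T_i with factor t - 1 or t would need coefficient one at some τ with an ascent, or
  -- at the swap of some τ without one. Neither of these is μ, which has a descent at i, so only the
  -- plain move from μ to `swap i μ` remains.
  T-orbital : (i : Adjacent n) {lam μ : Vec ℕ n} {f : Poly n} → lookup μ (right i) ℕ.< lookup μ (left i) →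
    Orbital lam μ f → Orbital lam (swap i μ) (T i f)
  T-orbital i {lam} {μ} {f} μ↓ F = record
    { degree       = T-degree i f F.degree
    ; vanishing    = λ ν ν≤ ν∉ → T-vanishes i f ν (F.vanishing ν ν≤ ν∉) (λ _ →
                       F.vanishing (swap i ν) (ℕ.≤-trans (ℕ.≤-reflexive (∣swap∣ i ν)) ν≤) (ν∉ ∘ swap-orbit⁻ i {lam}))
    ; dominated    = λ α α≡ α⋠ → coeff-T-0 i f α λ β r → F.dominated β (≡.trans (≡.sym (∣related∣ r)) α≡)
                       (λ β≼ → α⋠ (λ m → ℕ.≤-trans (≼-related r m) (β≼ m)))
    ; coefficients = coefficients
    }
    where
    module F = Orbital F

    strict : ∀ τ → τ ∈S[ lam ] → ∀ α → Related StrictlyWithin i α τ → coeff f α ≈ 0#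
    strict τ τ∈ = dominated⇒strict≈0 i f τ (λ α α≡ α⋠τ → F.dominated α (≡.trans α≡ (∣orbit∣ lam τ∈))
      (λ α≼ → α⋠τ (λ m → ℕ.≤-trans (α≼ m) (ℕ.≤-reflexive (≡.sym (S-orbit lam τ∈ m))))))

    coefficients : ∀ τ → τ ∈S[ lam ] → coeff (T i f) τ ≈ δ τ (swap i μ)
    coefficients τ τ∈ with lookup τ (left i) ℕ.<? lookup τ (right i)
    ... | yes l<r = begin
      coeff (T i f) τ                              ≈⟨ coeff-T-< i f τ l<r (strict τ τ∈) ⟩
      (t - 1#) * coeff f τ + coeff f (swap i τ)    ≈⟨ +-cong (*-congˡ (trans (F.coefficients τ τ∈) (δ-≢ τ≢μ)))
                                                             (F.coefficients (swap i τ) (swap-orbit i {lam} τ∈)) ⟩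
      (t - 1#) * 0# + δ (swap i τ) μ               ≈⟨ trans (+-congʳ (zeroʳ _)) (+-identityˡ _) ⟩
      δ (swap i τ) μ                               ≈⟨ δ-iff (λ eq → ≡.trans (≡.sym (swap-involutive i τ)) (cong (swap i) eq))
                                                            (λ eq → ≡.trans (cong (swap i) eq) (swap-involutive i μ)) ⟩
      δ τ (swap i μ)                               ∎
      where
      τ≢μ : τ ≢ μ
      τ≢μ ≡.refl = ℕ.<-asym l<r μ↓
    ... | no l≮r = begin
      coeff (T i f) τ                              ≈⟨ coeff-T-≥ i f τ (ℕ.≮⇒≥ l≮r) (strict τ τ∈) ⟩
      t * coeff f (swap i τ)                       ≈⟨ *-congˡ (trans (F.coefficients (swap i τ) (swap-orbit i {lam} τ∈)) (δ-≢ sτ≢μ)) ⟩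
      t * 0#                                       ≈⟨ zeroʳ t ⟩
      0#                                           ≈⟨ δ-≢ (λ τ≡sμ → sτ≢μ (≡.trans (cong (swap i) τ≡sμ) (swap-involutive i μ))) ⟨
      δ τ (swap i μ)                               ∎
      where
      sτ≢μ : swap i τ ≢ μ
      sτ≢μ ≡.refl = l≮r (≡.subst₂ ℕ._<_ (lookup-swap-right i τ) (lookup-swap-left i τ) μ↓)

  E*-orbital : (lam : Vec ℕ n) (E : Poly n) → IsPartition lam → DegreeBelow (suc ∣ lam ∣) E → coeff E lam ≈ 1# →
    (∀ ν → ∣ ν ∣ ℕ.≤ ∣ lam ∣ → ν ≢ lam → eval E (spectral ν) ≈ 0#) → Orbital lam lam E
  E*-orbital lam E part degree monic vanishing = record
    { degree       = degree
    ; vanishing    = λ ν ν≤ ν∉ → vanishing ν ν≤ (λ { ≡.refl → ν∉ (Perm.id , Vec.tabulate∘lookup lam) })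
    ; dominated    = λ α α≡ α⋠ → E*-triangular lam E degree vanishing α α≡ (λ α⊑ → α⋠ (λ m → α⊑ m 0 z≤n))
    ; coefficients = coefficients
    }
    where
    coefficients : ∀ τ → τ ∈S[ lam ] → coeff E τ ≈ δ τ lam
    coefficients τ τ∈ with τ ≟ᵉ lam
    ... | yes ≡.refl = monic
    ... | no τ≢lam   = E*-triangular lam E degree vanishing τ (∣orbit∣ lam τ∈)
                         (λ τ⊑ → τ≢lam (⊑-antisym τ⊑ (partition-⊑ lam τ part (S-orbit lam τ∈))))

  -- A letter raises `inv` by at most one, so a word no longer than the final `inv` must act at a
  -- descent in every letter. This is the condition of `T-orbital`.
  word-orbital : (lam : Vec ℕ n) (E : Poly n) → IsPartition lam → Orbital lam lam E →
    ∀ w → length w ℕ.≤ inv (act w lam) → Orbital lam (act w lam) (Tʷ w E)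
  word-orbital lam E part orbital []      _   = orbital
  word-orbital lam E part orbital (i ∷ w) len =
    T-orbital i μ↓ (word-orbital lam E part orbital w (s≤s⁻¹ (ℕ.≤-trans len (ℕ.≤-reflexive (inv-swap i μ μ↓)))))
    where
    μ  = act w lam
    μ↓ = descent⇐inv i μ (ℕ.≤-<-trans (inv-act w part) len)
-- The field ℚ(q,t)

module Monomials (D : IntegralDomain) where
  open IntegralDomain D hiding (zero)
  open Polynomial commutativeRing
  open PolynomialFunctionals D
  open SetoidReasoning setoid
  open Exp (CommutativeRing.semiring (ₚ-commutativeRing 2)) using (_^_)

  private
    X Y : Poly 2
    X = var zero
    Y = var (suc zero)

  linear-X^aY^b : ∀ (φ : Vec ℕ 2 → Carrier) a b → linear φ (X ^ a *ₚ Y ^ b) ≈ φ (a ∷ b ∷ [])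
  linear-X^aY^b φ zero    b = trans (linear-cong φ (*ₚ-identityˡ (Y ^ b))) (linear-Y^b φ b)
    where
    linear-Y^b : ∀ (φ : Vec ℕ 2 → Carrier) b → linear φ (Y ^ b) ≈ φ (0 ∷ b ∷ [])
    linear-Y^b φ zero    = trans (+-identityʳ _) (*-identityˡ _)
    linear-Y^b φ (suc b) = trans (linear-var φ (suc zero) (Y ^ b)) (linear-Y^b (φ ∘ raise (suc zero)) b)
  linear-X^aY^b φ (suc a) b = begin
    linear φ (X *ₚ X ^ a *ₚ Y ^ b)              ≈⟨ linear-cong φ (*ₚ-assoc X (X ^ a) (Y ^ b)) ⟩
    linear φ (X *ₚ (X ^ a *ₚ Y ^ b))            ≈⟨ linear-var φ zero (X ^ a *ₚ Y ^ b) ⟩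
    linear (φ ∘ raise zero) (X ^ a *ₚ Y ^ b)    ≈⟨ linear-X^aY^b (φ ∘ raise zero) a b ⟩
    φ (suc a ∷ b ∷ [])                          ∎

  monomials-independent : ∀ a b x y → X ^ a *ₚ Y ^ x ≈ₚ X ^ b *ₚ Y ^ y → a ≡ b
  monomials-independent a b x y eq with δ-view (a ∷ x ∷ []) (b ∷ y ∷ [])
  ... | inj₁ ≡.refl = ≡.refl
  ... | inj₂ δ≈0    = contradiction (begin
    1#                                    ≈⟨ δ-refl α ⟨
    δ α α                                 ≈⟨ linear-X^aY^b (δ α) a x ⟨
    coeff (X ^ a *ₚ Y ^ x) α              ≈⟨ coeff-≈ eq α ⟩
    coeff (X ^ b *ₚ Y ^ y) α              ≈⟨ linear-X^aY^b (δ α) b y ⟩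
    δ α (b ∷ y ∷ [])                      ≈⟨ δ≈0 ⟩
    0#                                    ∎) 1≉0
    where
    α = a ∷ x ∷ []

module Embedding (D : IntegralDomain) where
  open IntegralDomain D hiding (zero)
  open FieldOfFractions D
  open SetoidReasoning setoid
  private module F = IntegralDomain fractionDomain
  open Exp semiring using (_^_)
  open Exp F.semiring using () renaming (_^_ to _^ᶠ_)

  embed-* : ∀ x y → embed x *ᶠ embed y ≃ embed (x * y)
  embed-* x y = cross (*-congˡ (sym (*-identityˡ 1#)))

  embed-^ : ∀ x a → embed x ^ᶠ a ≃ embed (x ^ a)
  embed-^ x zero    = F.refl
  embed-^ x (suc a) = F.trans (F.*-congˡ {embed x} (embed-^ x a)) (embed-* x (x ^ a))

  embed-injective : ∀ x y → embed x ≃ embed y → x ≈ y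
  embed-injective x y eq = begin
    x        ≈⟨ *-identityʳ x ⟨
    x * 1#   ≈⟨ uncross eq ⟩
    y * 1#   ≈⟨ *-identityʳ y ⟩
    y        ∎

  embed-monomial : ∀ x y a b → embed x ^ᶠ a *ᶠ embed y ^ᶠ b ≃ embed (x ^ a * y ^ b)
  embed-monomial x y a b = F.trans (F.*-cong (embed-^ x a) (embed-^ y b)) (embed-* (x ^ a) (y ^ b))

  embed-monomial-injective : ∀ x y a b c d → embed x ^ᶠ a *ᶠ embed y ^ᶠ b ≃ embed x ^ᶠ c *ᶠ embed y ^ᶠ d →
    x ^ a * y ^ b ≈ x ^ c * y ^ d
  embed-monomial-injective x y a b c d eq = embed-injective (x ^ a * y ^ b) (x ^ c * y ^ d)
    (F.trans (F.sym (embed-monomial x y a b)) (F.trans eq (embed-monomial x y c d)))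

open import Defs using (K; q; t; t⁻¹; Poly; _≈ₚ_; coeff; eval; Tʷ; spectral)
open FieldOfFractions ℚ[q,t] using (Fraction; embed-≄0; _⁻¹[_]; *ᶠ-inverseʳ)
open CommutativeRing K using (_≈_) renaming (_*_ to _*ᴷ_; trans to ≈-trans; sym to ≈-sym; *-comm to *ᴷ-comm; 1# to 1ᴷ)
open Exp (CommutativeRing.semiring K) using (_^_)

private
  q⁻¹ : Fraction
  q⁻¹ = q ⁻¹[ embed-≄0 (PolynomialDomain.var≉0 ℚ-domain zero) ]

abstract
  q⁻¹*q≈1 : q⁻¹ *ᴷ q ≈ 1ᴷ
  q⁻¹*q≈1 = ≈-trans (*ᴷ-comm q⁻¹ q) (*ᶠ-inverseʳ q (embed-≄0 (PolynomialDomain.var≉0 ℚ-domain zero)))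

  t*t⁻¹≈1 : t *ᴷ t⁻¹ ≈ 1ᴷ
  t*t⁻¹≈1 = *ᶠ-inverseʳ t (embed-≄0 (PolynomialDomain.var≉0 ℚ-domain (suc zero)))

  qt-independent : ∀ a b x y → q ^ a *ᴷ t ^ x ≈ q ^ b *ᴷ t ^ y → a ≡ b
  qt-independent a b x y eq = Monomials.monomials-independent ℚ-domain a b x y
    (Embedding.embed-monomial-injective ℚ[q,t] _ _ a x b y eq)

private
  module I = Interpolation ℚ⟨q,t⟩ q t q⁻¹ t⁻¹ q⁻¹*q≈1 t*t⁻¹≈1 qt-independent
  module P = Polynomial K
  module 𝕂 = IntegralDomain ℚ⟨q,t⟩

-- Characterisation and uniqueness over ℚ(q,t)

Characterised-resp-≈ₚ : ∀ {d} {lam μ : Vec ℕ n} {f g : Poly n} → f ≈ₚ g → Characterised lam μ d g → Characterised lam μ d f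
Characterised-resp-≈ₚ f≈g G = record
  { degree       = λ α d<α → ≈-trans (P.coeff-≈ f≈g α) (G.degree α d<α)
  ; vanishing    = λ ν ν≤ ν∉ → ≈-trans (P.linear-cong (P.monomialValue (spectral ν)) f≈g) (G.vanishing ν ν≤ ν∉)
  ; coefficients = λ τ τ∈ → ≈-trans (P.coeff-≈ f≈g τ) (G.coefficients τ τ∈)
  }
  where module G = Characterised G

Orbital⇒Characterised : (lam : Vec ℕ n) {μ : Vec ℕ n} {f : Poly n} → ∣ μ ∣ ≡ ∣ lam ∣ →
  I.Orbital lam μ f → Characterised lam μ ∣ μ ∣ f
Orbital⇒Characterised lam {μ} μ≡lam F = record
  { degree       = λ α μ<α → F.degree α (ℕ.≤-<-trans (ℕ.≤-reflexive (≡.sym μ≡lam)) μ<α)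
  ; vanishing    = λ ν ν≤μ → F.vanishing ν (ℕ.≤-trans ν≤μ (ℕ.≤-reflexive μ≡lam))
  ; coefficients = F.coefficients
  }
  where module F = I.Orbital F

Characterised-unique : (lam μ : Vec ℕ n) → ∣ μ ∣ ≡ ∣ lam ∣ → ∀ {f g} →
  Characterised lam μ ∣ μ ∣ f → Characterised lam μ ∣ μ ∣ g → g ≈ₚ f
Characterised-unique {n} lam μ μ≡lam {f} {g} F G = P.coeffs-≈ λ α → P.x-y≈0⇒x≈y
  (≈-trans (≈-sym (P.linear-- (P.δ α) g f)) (I.uniqueness h h-degree h-support α))
  where
  module F = Characterised F
  module G = Characterised G
  h : Poly n
  h = g P.-ₚ f

  h≈0 : ∀ φ → P.linear φ g ≈ P.linear φ f → P.linear φ h ≈ 𝕂.0#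
  h≈0 φ eq = ≈-trans (P.linear-- φ g f) (P.x≈y⇒x-y≈0 eq)

  h-degree : ∀ α → ∣ μ ∣ ℕ.< ∣ α ∣ → coeff h α ≈ 𝕂.0#
  h-degree α μ<α = h≈0 (P.δ α) (≈-trans (G.degree α μ<α) (≈-sym (F.degree α μ<α)))

  h-support : ∀ ν → ∣ ν ∣ ℕ.≤ ∣ μ ∣ → ¬ eval h (spectral ν) ≈ 𝕂.0# → ∣ ν ∣ ≡ ∣ μ ∣ × coeff h ν ≈ 𝕂.0#
  h-support ν ν≤μ hν≉0 = size , coeff≈0
    where
    -- Membership in the orbit is only known up to double negation, but both conclusions are decidable.
    in-orbit : ¬ ν ∉S[ lam ]
    in-orbit ν∉ = hν≉0 (h≈0 (P.monomialValue (spectral ν)) (≈-trans (G.vanishing ν ν≤μ ν∉) (≈-sym (F.vanishing ν ν≤μ ν∉))))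

    size : ∣ ν ∣ ≡ ∣ μ ∣
    size with ∣ ν ∣ ℕ.≟ ∣ μ ∣
    ... | yes eq = eq
    ... | no ν≢μ = contradiction (λ ν∈ → ν≢μ (≡.trans (∣orbit∣ lam ν∈) (≡.sym μ≡lam))) in-orbit

    coeff≈0 : coeff h ν ≈ 𝕂.0#
    coeff≈0 with coeff h ν 𝕂.≈? 𝕂.0#
    ... | yes eq = eq
    ... | no hν≉0 = contradiction (λ ν∈ → hν≉0 (h≈0 (P.δ ν) (≈-trans (G.coefficients ν ν∈) (≈-sym (F.coefficients ν ν∈))))) in-orbit

IsF*⇒Characterised : (lam : Vec ℕ n) {μ : Vec ℕ n} → IsPartition lam → μ ∈S[ lam ] →
  ∀ {f} → IsF* lam μ f → Characterised lam μ ∣ μ ∣ f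
IsF*⇒Characterised lam {μ} part μ∈ F = Characterised-resp-≈ₚ f≈TE
  (Orbital⇒Characterised lam (∣orbit∣ lam μ∈) (subst (λ ν → I.Orbital lam ν (Tʷ word E)) act≡μ
    (I.word-orbital lam E part (I.E*-orbital lam E part E.degree E.monic E.vanishing) word
      (ℕ.≤-trans (length≤inv σ-shortest reduced part (S-orbit lam μ∈)) (ℕ.≤-reflexive (cong inv (≡.sym act≡μ)))))))
  where
  open IsF* F
  module E = IsE* E-is-E*
  act≡μ : act word lam ≡ μ
  act≡μ = act-shortest σ-shortest reduced

theorem2p17 : ∀ {n d : ℕ} (lam μ : Vec ℕ n) → IsPartition lam → μ ∈S[ lam ] → ∣ μ ∣ ≡ d →
    ∀ (f : Poly n) → IsF* lam μ f →
    Characterised lam μ d f × (∀ (g : Poly n) → Characterised lam μ d g → g ≈ₚ f)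
theorem2p17 lam μ part μ∈ ≡.refl f F = F′ , λ g → Characterised-unique lam μ (∣orbit∣ lam μ∈) F′
  where
  F′ : Characterised lam μ ∣ μ ∣ f
  F′ = IsF*⇒Characterised lam part μ∈ F
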